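{- Let $n,m\ge 0$ with $n+m>0$, let $N\ge 1$, and let $V=V_0\oplus V_1$ with $V_0=V_1=\mathbb{C}^N$. Let $\widetilde{\mathcal{L}}_{n,m}$ be the bidegree-$(n,m)$ component of the free Lie superalgebra on $V$, regarded as a $\mathrm{GL}(\mathbb{C}^N)$-module via the diagonal embedding $\mathrm{GL}(\mathbb{C}^N)\hookrightarrow \mathrm{GL}(\mathbb{C}^N)\oplus\mathrm{GL}(\mathbb{C}^N)$. Then its character is \[ \operatorname{ch}(\widetilde{\mathcal{L}}_{n,m};x_1,\dots,x_N)=\frac{1}{n+m}\sum_{d\mid \gcd(n,m)} (-1)^{m+\frac{m}{d}}\mu(d)\binom{\frac{n+m}{d}}{\frac{m}{d}}\, p_d(x_1,\dots,x_N)^{\frac{n+m}{d}}, \] where $\mu$ is the Möbius function and $p_d(x_1,\dots,x_N)=x_1^d+\cdots+x_N^d$.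
   Context: A super vector space $V=V_0\oplus V_1$ has tensor superalgebra $\widetilde{T}(V)=\bigoplus_{d\ge0}(V_0\oplus V_1)^{\otimes d}$ with concatenation product; it is bigraded, $\widetilde{T}_{n,m}(V)$ being spanned by tensors with $n$ factors from $V_0$ and $m$ factors from $V_1$, and $\mathbb{Z}/2$-graded by the parity of $m$. The super commutator is $[x,y]=xy-(-1)^{|x||y|}yx$ for homogeneous $x,y$ of parities $|x|,|y|$, extended bilinearly. The free Lie superalgebra $\widetilde{\mathcal{L}}(V)\subseteq\widetilde{T}(V)$ is the span of all iterated super commutators of elements of $V$ (equivalently the Lie sub-superalgebra generated by $V$); $\widetilde{\mathcal{L}}_{n,m}=\widetilde{\mathcal{L}}(V)\cap \widetilde{T}_{n,m}(V)$ is spanned by iterated bracketings with $n$ entries from $V_0$ and $m$ from $V_1$. $\mathrm{GL}(V_0)\oplus\mathrm{GL}(V_1)$ acts naturally. The character of a $\mathrm{GL}(\mathbb{C}^N)$-module is the trace of $\mathrm{diag}(x_1,\dots,x_N)$. -}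

module Defs where

open import Algebra.Apartness.Bundles using (HeytingField; HeytingCommutativeRing)
open import Algebra.Bundles using (CommutativeRing)
open import Algebra.Module.Bundles using (Module)
open import Algebra.Module.Structures.Biased using (IsModuleFromLeft)
import Algebra.Apartness.Properties.HeytingCommutativeRing as HeytingProperties
import Algebra.Properties.CommutativeMonoid.Sum as MonoidSum
import Algebra.Properties.Ring as RingProperties
import Algebra.Properties.Semiring.Exp as Exp
import Algebra.Properties.Semiring.Mult as Mult
import Algebra.Properties.Semiring.Sum as SemiringSum
open import Data.Bool.Base using (if_then_else_)
open import Data.Fin.Base using (Fin; zero; suc; toℕ)
import Data.Fin.Properties as Fin
open import Data.Integer.Base as ℤ using (ℤ; -[1+_]; +_)
open import Data.List.Base using (List; []; _∷_; length; filter)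
open import Data.List.Relation.Unary.Unique.DecPropositional using (unique?)
open import Data.Nat.Base as ℕ using (ℕ; zero; suc; NonZero; _≤_; z≤n; s≤s; _⊔_)
open import Data.Nat.Divisibility using (_∣?_)
import Data.Nat.Properties as ℕ
open import Data.Nat.Primality.Factorisation using (factorise; factors)
open import Data.Parity.Base as Parity using (Parity; 0ℙ; 1ℙ)
import Data.Parity.Properties as Parity
open import Data.Product.Base using (∃-syntax; Σ-syntax; _×_; _,_; proj₁; proj₂)
open import Data.Vec.Functional using (Vector)
import Level as L
open import Relation.Binary.PropositionalEquality as ≡ using (_≡_)
open import Relation.Nullary using (does; yes; no)
open import Relation.Nullary.Negation using (¬_)
open import Relation.Unary using (Pred; _∩_)

μ : (d : ℕ) → .{{NonZero d}} → ℤ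
μ d = if does (unique? ℕ._≟_ ps) then ℤ.-1ℤ ℤ.^ length ps else ℤ.0ℤ
  where ps = factors (factorise d)

module LinearAlgebra
  {c ℓ m ℓm} {R : CommutativeRing c ℓ} (M : Module R m ℓm) where

  open CommutativeRing R using (Carrier; _≈_; 0#)
  open Module M
  open SemiringSum (CommutativeRing.semiring R) using (sum)
  open MonoidSum +ᴹ-commutativeMonoid using () renaming (sum to sumᴹ)

  combination : ∀ {k} → Vector Carrier k → Vector Carrierᴹ k → Carrierᴹ
  combination a b = sumᴹ (λ i → a i *ₗ b i)

  Span : ∀ {i} {I : Set i} → (I → Carrierᴹ) → Pred Carrierᴹ (c L.⊔ ℓm L.⊔ i)
  Span {I = I} e x =
    ∃[ k ] Σ[ a ∈ Vector Carrier k ] Σ[ s ∈ Vector I k ]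
      x ≈ᴹ combination a (λ j → e (s j))

  record IsBasis {p} (P : Pred Carrierᴹ p) {k} (b : Vector Carrierᴹ k)
                 : Set (c L.⊔ ℓ L.⊔ m L.⊔ ℓm L.⊔ p) where
    field
      members     : ∀ i → P (b i)
      independent : ∀ a → combination a b ≈ᴹ 0ᴹ → ∀ i → a i ≈ 0#
      spanning    : ∀ x → P x → ∃[ a ] x ≈ᴹ combination a b

  -- IsTrace P φ t: the subspace P is finite-dimensional, φ maps it to
  -- itself, and φ restricted to P has trace t.  The sum of the diagonal
  -- entries does not depend on the basis, so one basis suffices.  Column j
  -- of A holds the coordinates of φ (b j).
  IsTrace : ∀ {p} → Pred Carrierᴹ p → (Carrierᴹ → Carrierᴹ) → Carrier →
            Set (c L.⊔ ℓ L.⊔ m L.⊔ ℓm L.⊔ p)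
  IsTrace P φ t =
    ∃[ k ] Σ[ b ∈ Vector Carrierᴹ k ] IsBasis P b ×
    (Σ[ A ∈ (Fin k → Fin k → Carrier) ]
      (∀ j → φ (b j) ≈ᴹ combination (λ i → A i j) b) ×
      sum (λ i → A i i) ≈ t)

-- The library has no ℂ; a Heyting field, in which x # y means that x - y is
-- invertible, takes its place, with characteristic zero as a hypothesis below.
module Field {c ℓ₁ ℓ₂} (F : HeytingField c ℓ₁ ℓ₂) where

  open HeytingField F public
  open HeytingCommutativeRing heytingCommutativeRing public using (commutativeRing)
  open CommutativeRing commutativeRing public
    using (ring; semiring)
  open HeytingProperties heytingCommutativeRing public using (x-0≈x)
  open RingProperties ring public using (-0#≈0#)
  open Mult semiring public using () renaming (_×_ to _·_)
  open Exp semiring public using (_^_)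
  open SemiringSum semiring public using (sum; sum-cong-≋; sum-replicate-zero)

  fromℕ : ℕ → Carrier
  fromℕ n = n · 1#

  fromℤ : ℤ → Carrier
  fromℤ (+ n)    = fromℕ n
  fromℤ -[1+ n ] = - fromℕ (suc n)

  CharacteristicZero : Set ℓ₂
  CharacteristicZero = ∀ n → .{{NonZero n}} → fromℕ n # 0#

  _⁻¹[_] : ∀ x → x # 0# → Carrier
  x ⁻¹[ x#0 ] = proj₁ (#⇒invertible x#0)

  ⁻¹-inverseˡ : ∀ x (x#0 : x # 0#) → x ⁻¹[ x#0 ] * x ≈ 1#
  ⁻¹-inverseˡ x x#0 =
    trans (*-congˡ (sym (x-0≈x x))) (proj₁ (proj₂ (#⇒invertible x#0)))

  ⁻¹-inverseʳ : ∀ x (x#0 : x # 0#) → x * x ⁻¹[ x#0 ] ≈ 1#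
  ⁻¹-inverseʳ x x#0 = trans (*-comm _ _) (⁻¹-inverseˡ x x#0)

  -- The index k runs over 0, …, n - 1 and stands for the divisor k + 1.
  sumOverDivisors : ℕ → (∀ d → .{{NonZero d}} → Carrier) → Carrier
  sumOverDivisors n f =
    sum {n} (λ k → if does (suc (toℕ k) ∣? n) then f (suc (toℕ k)) else 0#)

  powerSum : ∀ {N} → ℕ → Vector Carrier N → Carrier
  powerSum d x = sum (λ i → x i ^ d)

module FreeLieSuperalgebra {c ℓ₁ ℓ₂} (F : HeytingField c ℓ₁ ℓ₂) (N : ℕ) where

  open Field F

  -- (p , i) is the i-th standard basis vector of V_p; words in these letters
  -- are the monomial basis of the tensor algebra.
  Letter : Set
  Letter = Parity × Fin N

  Word : Set
  Word = List Letter

  count : Parity → Word → ℕ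
  count p w = length (filter (λ l → proj₁ l Parity.≟ p) w)

  parityOf : Word → Parity
  parityOf w = ℕ.parity (count 1ℙ w)

  -- Coefficient functions on words with a bound on the length of the words
  -- in the support, i.e. finitely supported ones, as there are finitely many
  -- letters.
  record Tensor : Set (c L.⊔ ℓ₁) where
    field
      coeff    : Word → Carrier
      bound    : ℕ
      vanishes : ∀ w → bound ≤ length w → coeff w ≈ 0#

  open Tensor public

  infix 4 _≈ᵀ_
  _≈ᵀ_ : Tensor → Tensor → Set ℓ₁
  x ≈ᵀ y = ∀ w → coeff x w ≈ coeff y w

  0ᵀ : Tensor
  0ᵀ = record { coeff = λ _ → 0# ; bound = 0 ; vanishes = λ _ _ → refl }

  infixl 6 _+ᵀ_ _-ᵀ_
  _+ᵀ_ : Tensor → Tensor → Tensor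
  x +ᵀ y = record
    { coeff    = λ w → coeff x w + coeff y w
    ; bound    = bound x ⊔ bound y
    ; vanishes = λ w b≤w → trans
        (+-cong (vanishes x w (ℕ.≤-trans (ℕ.m≤m⊔n _ _) b≤w))
                (vanishes y w (ℕ.≤-trans (ℕ.m≤n⊔m (bound x) _) b≤w)))
        (+-identityʳ 0#)
    }

  -ᵀ_ : Tensor → Tensor
  -ᵀ x = record
    { coeff    = λ w → - coeff x w
    ; bound    = bound x
    ; vanishes = λ w b≤w → trans (-‿cong (vanishes x w b≤w)) -0#≈0#
    }

  _-ᵀ_ : Tensor → Tensor → Tensor
  x -ᵀ y = x +ᵀ (-ᵀ y)

  infixr 7 _*ₗᵀ_
  _*ₗᵀ_ : Carrier → Tensor → Tensor
  a *ₗᵀ x = record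
    { coeff    = λ w → a * coeff x w
    ; bound    = bound x
    ; vanishes = λ w b≤w → trans (*-congˡ (vanishes x w b≤w)) (zeroʳ a)
    }

  tensorModule : Module commutativeRing (c L.⊔ ℓ₁) ℓ₁
  tensorModule = record
    { Carrierᴹ = Tensor
    ; _≈ᴹ_     = _≈ᵀ_
    ; _+ᴹ_     = _+ᵀ_
    ; _*ₗ_     = _*ₗᵀ_
    ; _*ᵣ_     = λ x a → a *ₗᵀ x
    ; 0ᴹ       = 0ᵀ
    ; -ᴹ_      = -ᵀ_
    ; isModule = IsModuleFromLeft.isModule {commutativeRing = commutativeRing} record
      { isLeftModule = record
        { isLeftSemimodule = record
          { +ᴹ-isCommutativeMonoid = record
            { isMonoid = record
              { isSemigroup = record
                { isMagma = record
                  { isEquivalence = record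
                    { refl  = λ _ → refl
                    ; sym   = λ e w → sym (e w)
                    ; trans = λ e f w → trans (e w) (f w)
                    }
                  ; ∙-cong = λ e f w → +-cong (e w) (f w)
                  }
                ; assoc = λ _ _ _ _ → +-assoc _ _ _
                }
              ; identity = (λ _ _ → +-identityˡ _) , (λ _ _ → +-identityʳ _)
              }
            ; comm = λ _ _ _ → +-comm _ _
            }
          ; isPreleftSemimodule = record
            { *ₗ-cong      = λ e f w → *-cong e (f w)
            ; *ₗ-zeroˡ     = λ _ _ → zeroˡ _
            ; *ₗ-distribʳ  = λ _ _ _ _ → distribʳ _ _ _
            ; *ₗ-identityˡ = λ _ _ → *-identityˡ _
            ; *ₗ-assoc     = λ _ _ _ _ → *-assoc _ _ _
            ; *ₗ-zeroʳ     = λ _ _ → zeroʳ _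
            ; *ₗ-distribˡ  = λ _ _ _ _ → distribˡ _ _ _
            }
          }
        ; -ᴹ‿cong    = λ e w → -‿cong (e w)
        ; -ᴹ‿inverse = (λ _ _ → -‿inverseˡ _) , (λ _ _ → -‿inverseʳ _)
        }
      }
    }

  open LinearAlgebra tensorModule public

  -- The coefficient of w in f g is the sum of f u * g v over all u ++ v ≡ w.
  concat : (Word → Carrier) → (Word → Carrier) → Word → Carrier
  concat f g []      = f [] * g []
  concat f g (a ∷ w) = f [] * g (a ∷ w) + concat (λ u → f (a ∷ u)) g w

  private
    concat-zeroˡ : ∀ f g w → (∀ u → f u ≈ 0#) → concat f g w ≈ 0#
    concat-zeroˡ f g []      f≈0 = trans (*-congʳ (f≈0 [])) (zeroˡ _)
    concat-zeroˡ f g (a ∷ w) f≈0 = trans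
      (+-cong (trans (*-congʳ (f≈0 [])) (zeroˡ _))
              (concat-zeroˡ _ g w (λ u → f≈0 (a ∷ u))))
      (+-identityʳ 0#)

    concat-vanishes :
      ∀ f g d e → (∀ u → d ≤ length u → f u ≈ 0#) →
      (∀ v → e ≤ length v → g v ≈ 0#) →
      ∀ w → d ℕ.+ e ≤ length w → concat f g w ≈ 0#
    concat-vanishes f g zero    e f≈0 g≈0 w       _ =
      concat-zeroˡ f g w (λ u → f≈0 u z≤n)
    concat-vanishes f g (suc d) e f≈0 g≈0 (a ∷ w) (s≤s d+e≤w) = trans
      (+-cong
        (trans (*-congˡ (g≈0 (a ∷ w)
                  (ℕ.m≤n⇒m≤1+n (ℕ.≤-trans (ℕ.m≤n+m e d) d+e≤w))))
               (zeroʳ _))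
        (concat-vanishes _ g d e (λ u d≤u → f≈0 (a ∷ u) (s≤s d≤u)) g≈0 w d+e≤w))
      (+-identityʳ 0#)

  infixl 7 _⊗_
  _⊗_ : Tensor → Tensor → Tensor
  x ⊗ y = record
    { coeff    = concat (coeff x) (coeff y)
    ; bound    = bound x ℕ.+ bound y
    ; vanishes = concat-vanishes _ _ _ _ (vanishes x) (vanishes y)
    }

  HasBidegree : ℕ → ℕ → Pred Tensor ℓ₁
  HasBidegree n m x =
    ∀ w → ¬ (count 0ℙ w ≡ n × count 1ℙ w ≡ m) → coeff x w ≈ 0#

  homogeneousPart : Parity → Tensor → Tensor
  homogeneousPart p x = record
    { coeff    = λ w → if does (parityOf w Parity.≟ p) then coeff x w else 0#
    ; bound    = bound x
    ; vanishes = part-vanishes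
    }
    where
    part-vanishes : ∀ w → bound x ≤ length w →
      (if does (parityOf w Parity.≟ p) then coeff x w else 0#) ≈ 0#
    part-vanishes w b≤w with parityOf w Parity.≟ p
    ... | yes _ = vanishes x w b≤w
    ... | no  _ = refl

  koszulSign : Parity → Parity → Carrier
  koszulSign 1ℙ 1ℙ = - 1#
  koszulSign _  _  = 1#

  homogeneousCommutator : Parity → Parity → Tensor → Tensor → Tensor
  homogeneousCommutator p q x y = x ⊗ y -ᵀ koszulSign p q *ₗᵀ (y ⊗ x)

  [_,_] : Tensor → Tensor → Tensor
  [ x , y ] = part 0ℙ 0ℙ +ᵀ part 0ℙ 1ℙ +ᵀ part 1ℙ 0ℙ +ᵀ part 1ℙ 1ℙ
    where
    part : Parity → Parity → Tensor
    part p q =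
      homogeneousCommutator p q (homogeneousPart p x) (homogeneousPart q y)

  -- v p is the component in V_p.
  V : Set c
  V = Parity → Vector Carrier N

  ι : V → Tensor
  ι v = record { coeff = ι-coeff ; bound = 2 ; vanishes = ι-vanishes }
    where
    ι-coeff : Word → Carrier
    ι-coeff ((p , i) ∷ []) = v p i
    ι-coeff _              = 0#

    ι-vanishes : ∀ w → 2 ≤ length w → ι-coeff w ≈ 0#
    ι-vanishes (_ ∷ [])    (s≤s ())
    ι-vanishes (_ ∷ _ ∷ _) _ = refl

  data Bracketing : Set c where
    leaf : V → Bracketing
    node : Bracketing → Bracketing → Bracketing

  iteratedCommutator : Bracketing → Tensor
  iteratedCommutator (leaf v)   = ι v
  iteratedCommutator (node s t) = [ iteratedCommutator s , iteratedCommutator t ]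

  FreeLie : Pred Tensor (c L.⊔ ℓ₁)
  FreeLie = Span iteratedCommutator

  FreeLieComponent : ℕ → ℕ → Pred Tensor (c L.⊔ ℓ₁)
  FreeLieComponent n m = FreeLie ∩ HasBidegree n m

  Matrix : Set c
  Matrix = Fin N → Fin N → Carrier

  infixl 7 _*ᴹ_
  _*ᴹ_ : Matrix → Matrix → Matrix
  (A *ᴹ B) i k = sum (λ j → A i j * B j k)

  diagonalMatrix : Vector Carrier N → Matrix
  diagonalMatrix x i j = if does (i Fin.≟ j) then x i else 0#

  1ᴹ : Matrix
  1ᴹ = diagonalMatrix (λ _ → 1#)

  record GL : Set (c L.⊔ ℓ₁) where
    field
      matrix   : Matrix
      inverse  : Matrix
      inverseˡ : ∀ i j → (inverse *ᴹ matrix) i j ≈ 1ᴹ i j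
      inverseʳ : ∀ i j → (matrix *ᴹ inverse) i j ≈ 1ᴹ i j

  private
    sum-zero : ∀ {k} (f : Vector Carrier k) → (∀ i → f i ≈ 0#) → sum f ≈ 0#
    sum-zero {k} f f≈0 = trans (sum-cong-≋ f≈0) (sum-replicate-zero k)

    sum-single : ∀ {k} (i : Fin k) a (f : Vector Carrier k) →
      sum (λ j → (if does (i Fin.≟ j) then a else 0#) * f j) ≈ a * f i
    sum-single zero    a f = trans
      (+-congˡ (sum-zero (λ j → 0# * f (suc j)) (λ j → zeroˡ (f (suc j)))))
      (+-identityʳ _)
    sum-single (suc i) a f = trans
      (+-cong (zeroˡ _) (sum-single i a (λ j → f (suc j)))) (+-identityˡ _)

    diagonal-inverse : ∀ x y → (∀ i → x i * y i ≈ 1#) →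
      ∀ i j → (diagonalMatrix x *ᴹ diagonalMatrix y) i j ≈ 1ᴹ i j
    diagonal-inverse x y xy≈1 i j =
      trans (sum-single i (x i) (λ k → diagonalMatrix y k j)) rest
      where
      rest : x i * diagonalMatrix y i j ≈ 1ᴹ i j
      rest with i Fin.≟ j
      ... | yes _ = xy≈1 i
      ... | no  _ = zeroʳ (x i)

  diag : (x : Vector Carrier N) → (∀ i → x i # 0#) → GL
  diag x x#0 = record
    { matrix   = diagonalMatrix x
    ; inverse  = diagonalMatrix x⁻¹
    ; inverseˡ = diagonal-inverse x⁻¹ x (λ i → ⁻¹-inverseˡ (x i) (x#0 i))
    ; inverseʳ = diagonal-inverse x x⁻¹ (λ i → ⁻¹-inverseʳ (x i) (x#0 i))
    }
    where
    x⁻¹ : Vector Carrier N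
    x⁻¹ i = x i ⁻¹[ x#0 i ]

  -- g p acts on V_p.
  GL⊕GL : Set (c L.⊔ ℓ₁)
  GL⊕GL = Parity → GL

  diagonalEmbedding : GL → GL⊕GL
  diagonalEmbedding g _ = g

  -- g v_{p,j} = Σᵢ (g p) i j v_{p,i}, extended multiplicatively to words; read
  -- off on the coefficient of a word with first letter (p , i).
  actCoeff : GL⊕GL → (Word → Carrier) → Word → Carrier
  actCoeff g f []            = f []
  actCoeff g f ((p , i) ∷ w) =
    sum (λ j → GL.matrix (g p) i j * actCoeff g (λ u → f ((p , j) ∷ u)) w)

  private
    act-vanishes : ∀ g f w → (∀ u → length u ≡ length w → f u ≈ 0#) →
                   actCoeff g f w ≈ 0#
    act-vanishes g f []            f≈0 = f≈0 [] ≡.refl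
    act-vanishes g f ((p , i) ∷ w) f≈0 = sum-zero
      (λ j → GL.matrix (g p) i j * actCoeff g (λ u → f ((p , j) ∷ u)) w)
      (λ j → trans
        (*-congˡ (act-vanishes g (λ u → f ((p , j) ∷ u)) w
                   (λ u u≡w → f≈0 ((p , j) ∷ u) (≡.cong suc u≡w))))
        (zeroʳ _))

  act : GL⊕GL → Tensor → Tensor
  act g x = record
    { coeff    = actCoeff g (coeff x)
    ; bound    = bound x
    ; vanishes = λ w b≤w → act-vanishes g (coeff x) w
        (λ u u≡w → vanishes x u (≡.subst (bound x ≤_) (≡.sym u≡w) b≤w))
    }

  -- ch is the value at x of the character of P, a module over the diagonally
  -- embedded GL.
  IsCharacterValue : ∀ {p} → Pred Tensor p →
    (x : Vector Carrier N) → (∀ i → x i # 0#) → Carrier → Set (c L.⊔ ℓ₁ L.⊔ p)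
  IsCharacterValue P x x#0 ch =
    IsTrace P (act (diagonalEmbedding (diag x x#0))) ch

{-# OPTIONS --safe #-}

-- Order the letters, and words lexicographically. Let P_a = a for a letter a,
-- P_w = [P_u , P_v] for a Lyndon word w = uv with v its smallest proper suffix,
-- and P_uu = [P_u , P_u] for u Lyndon of odd parity; these w and uu are the
-- super-Lyndon words. P_w is 1 or 2 times w plus larger words, so the P_w are
-- independent. They span: for Lyndon u < v the bracket [P_u , P_v] is P_uv, or
-- else the Jacobi identity on the factorisation of u turns it into brackets of
-- words smaller than v, and one inducts on the total length and on the larger
-- word. Since diag(x) multiplies P_w by the product of the x_i over the letters
-- of w, the character is the sum of these weights over the super-Lyndon words of
-- bidegree (n , m). A word w = u^e with u primitive has one Lyndon rotation if
-- e = 1, two rotations that are squares of odd Lyndon words if e = 2 and u is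
-- odd, and no super-Lyndon rotation otherwise. This number is the sum of
-- (-1)^(m + m/d) μ(d) over the divisors d of e, that is, over those d for which
-- w is a d-th power, and the words that are d-th powers have total weight
-- C((n+m)/d, m/d) p_d^((n+m)/d).
module Submission where

open import Defs
open import Algebra.Apartness.Bundles using (HeytingField)
open import Algebra.Bundles using (CommutativeRing)
import Algebra.Properties.AbelianGroup as AbelianGroupProperties
import Algebra.Properties.CommutativeSemigroup as CommutativeSemigroupProperties
import Algebra.Properties.CommutativeSemiring.Exp as CommutativeExp
import Algebra.Properties.Ring as RingProperties
import Algebra.Properties.Semiring.Mult as SemiringMult
import Algebra.Properties.Semiring.Sum as SemiringSum
import Algebra.Solver.Ring.NaturalCoefficients.Default as NaturalSolver
open import Data.Bool.Base using (if_then_else_)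
open import Data.Fin.Base as Fin using (Fin; zero; suc; toℕ; fromℕ<)
import Data.Fin.Properties as Finₚ
open import Data.Integer.Base as ℤ using (-[1+_]; +_)
import Data.Integer.Properties as ℤₚ
open import Data.List.Base as List
  using (List; []; _∷_; _∷ʳ_; _++_; length; map; filter; lookup; upTo)
import Data.List.Properties as Listₚ
open import Data.List.Membership.Propositional using (_∈_)
import Data.List.Membership.Propositional.Properties as ∈ₚ
open import Data.List.Membership.Propositional.Properties.WithK using (unique∧set⇒bag)
open import Data.List.Relation.Binary.BagAndSetEquality using (∼bag⇒↭)
import Data.List.Relation.Binary.Lex.Strict as Lex
import Data.List.Relation.Binary.Pointwise as Pointwise
open import Data.List.Relation.Binary.Permutation.Propositional as ↭ using (_↭_)
import Data.List.Relation.Binary.Permutation.Propositional.Properties as ↭ₚ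
import Data.List.Relation.Binary.Permutation.Setoid.Properties as ↭ₛ
open import Data.List.Relation.Unary.All as All using (All; []; _∷_)
import Data.List.Relation.Unary.All.Properties as Allₚ
open import Data.List.Relation.Unary.AllPairs using ([]; _∷_)
open import Data.List.Relation.Unary.Any as Any using (here; there)
import Data.List.Relation.Unary.Any.Properties as Anyₚ
open import Data.List.Relation.Unary.Unique.Propositional using (Unique)
import Data.List.Relation.Unary.Unique.DecPropositional as DecUnique
import Data.List.Relation.Unary.Unique.Propositional.Properties as Unique
open import Data.Nat.Base as ℕ using (ℕ; zero; suc; NonZero; _/_; z≤n; s≤s)
open import Data.Nat.Combinatorics as C using (_C_)
import Data.Nat.DivMod as DivMod
open import Data.Nat.Divisibility as ∣ using (_∣_; _∣?_; divides)
open import Data.Nat.GCD using (gcd; gcd[m,n]∣m; gcd[m,n]∣n; gcd-greatest;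
  gcd[m,n]≡0⇒m≡0; gcd[m,n]≡0⇒n≡0)
open import Data.Nat.Induction using (<-wellFounded; <-rec)
open import Data.Nat.ListAction using (product)
open import Data.Nat.Primality using (Prime; euclidsLemma; prime⇒nonZero; prime[2]; ¬prime[1])
open import Data.Nat.Primality.Factorisation
  using (PrimeFactorisation; factorise; factors; factorisationUnique;
         factorisationHasAllPrimeFactors)
import Data.Nat.Properties as ℕₚ
open import Data.Parity.Base as Parity using (Parity; 0ℙ; 1ℙ)
import Data.Parity.Properties as Parityₚ
open import Data.Product.Base using (∃-syntax; _×_; _,_; proj₁; proj₂)
open import Data.Sum.Base using (_⊎_; inj₁; inj₂)
open import Data.Unit.Base using (⊤; tt)
open import Data.Vec.Functional using (Vector)
open import Function.Base using (_∘_; id; case_of_)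
open import Function.Bundles using (mk⇔)
open import Induction.WellFounded using (Acc; acc)
open import Level using (_⊔_)
import Relation.Binary.Construct.On as On
open import Relation.Binary.Core using (Rel)
open import Relation.Binary.Definitions using (DecidableEquality; Tri; tri<; tri≈; tri>)
open import Relation.Binary.PropositionalEquality as ≡ using (_≡_; _≢_)
import Relation.Binary.Reasoning.Setoid as SetoidReasoning
open import Relation.Binary.Structures using (IsStrictTotalOrder)
open import Relation.Binary.Structures.Biased using (isStrictTotalOrderᶜ)
open import Relation.Nullary using (Dec; does; yes; no; ¬_; ¬?; contradiction)
open import Relation.Nullary.Decidable using (map′; _×-dec_; _⊎-dec_)
open import Relation.Unary using (Pred; Decidable)

-- Equality in the field is not decidable, so a basis cannot be found by elimination. It is indexed
-- by a decidable set of words, and case distinctions are made on words, trees, parities and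
-- numbers, never on scalars. Two obstacles shape the spanning argument. A bracket must be rewritten
-- into words below its larger factor, not merely into super-Lyndon words; otherwise the nested
-- brackets left by the Jacobi identity could not be fed to the induction. And the lexicographic
-- order descends forever through longer and longer words, so the total length is held fixed during
-- the inner induction. Rewriting produces trees while the basis is indexed by words; taking the
-- smallest suffix as right factor makes the bracketing of a word unique. In the signed Möbius sum
-- all signs are 1 for odd `e`. For even `e` the divisors d and 2d with d odd are paired: μ changes
-- sign, and the pair cancels unless `e / 2` and the number of odd letters of u are both odd. Each
-- word is counted once for each of its n + m rotations, so the count yields n + m times the
-- character, and a single division remains for the end.

-- Finite sums over lists, and indicators.

module ListSum {c ℓ} (R : CommutativeRing c ℓ) where

  open CommutativeRing R
  open SemiringSum semiring using (sum)
  open SetoidReasoning setoid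

  Σ : ∀ {a} {A : Set a} → List A → (A → Carrier) → Carrier
  Σ xs f = List.foldr (λ x s → f x + s) 0# xs

  module _ {a} {A : Set a} where

    Σ-cong : ∀ (xs : List A) {f g} → (∀ {x} → x ∈ xs → f x ≈ g x) → Σ xs f ≈ Σ xs g
    Σ-cong []       f≈g = refl
    Σ-cong (x ∷ xs) f≈g = +-cong (f≈g (here ≡.refl)) (Σ-cong xs (f≈g ∘ there))

    Σ-zero : ∀ (xs : List A) {f} → (∀ {x} → x ∈ xs → f x ≈ 0#) → Σ xs f ≈ 0#
    Σ-zero []       f≈0 = refl
    Σ-zero (x ∷ xs) f≈0 =
      trans (+-cong (f≈0 (here ≡.refl)) (Σ-zero xs (f≈0 ∘ there))) (+-identityˡ 0#)

    Σ-+ : ∀ (xs : List A) f g → Σ xs (λ x → f x + g x) ≈ Σ xs f + Σ xs g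
    Σ-+ []       f g = sym (+-identityˡ 0#)
    Σ-+ (x ∷ xs) f g = begin
      f x + g x + Σ xs (λ y → f y + g y) ≈⟨ +-congˡ (Σ-+ xs f g) ⟩
      f x + g x + (Σ xs f + Σ xs g)      ≈⟨ +-assoc _ _ _ ⟩
      f x + (g x + (Σ xs f + Σ xs g))    ≈⟨ +-congˡ (+-assoc _ _ _) ⟨
      f x + (g x + Σ xs f + Σ xs g)      ≈⟨ +-congˡ (+-congʳ (+-comm _ _)) ⟩
      f x + (Σ xs f + g x + Σ xs g)      ≈⟨ +-congˡ (+-assoc _ _ _) ⟩
      f x + (Σ xs f + (g x + Σ xs g))    ≈⟨ +-assoc _ _ _ ⟨
      f x + Σ xs f + (g x + Σ xs g)      ∎

    Σ-*ˡ : ∀ (xs : List A) k f → k * Σ xs f ≈ Σ xs (λ x → k * f x)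
    Σ-*ˡ []       k f = zeroʳ k
    Σ-*ˡ (x ∷ xs) k f = trans (distribˡ _ _ _) (+-congˡ (Σ-*ˡ xs k f))

    Σ-*ʳ : ∀ (xs : List A) k f → Σ xs f * k ≈ Σ xs (λ x → f x * k)
    Σ-*ʳ xs k f = begin
      Σ xs f * k           ≈⟨ *-comm _ _ ⟩
      k * Σ xs f           ≈⟨ Σ-*ˡ xs k f ⟩
      Σ xs (λ x → k * f x) ≈⟨ Σ-cong xs (λ _ → *-comm _ _) ⟩
      Σ xs (λ x → f x * k) ∎

    Σ-++ : ∀ (xs ys : List A) f → Σ (xs ++ ys) f ≈ Σ xs f + Σ ys f
    Σ-++ []       ys f = sym (+-identityˡ _)
    Σ-++ (x ∷ xs) ys f = trans (+-congˡ (Σ-++ xs ys f)) (sym (+-assoc _ _ _))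

    Σ-↭ : ∀ {xs ys : List A} f → xs ↭ ys → Σ xs f ≈ Σ ys f
    Σ-↭ f ↭.refl          = refl
    Σ-↭ f (↭.prep x p)    = +-congˡ (Σ-↭ f p)
    Σ-↭ f (↭.swap {xs} {ys} x y p) = begin
      f x + (f y + Σ xs f) ≈⟨ +-assoc _ _ _ ⟨
      f x + f y + Σ xs f   ≈⟨ +-cong (+-comm _ _) (Σ-↭ f p) ⟩
      f y + f x + Σ ys f   ≈⟨ +-assoc _ _ _ ⟩
      f y + (f x + Σ ys f) ∎
    Σ-↭ f (↭.trans p q)   = trans (Σ-↭ f p) (Σ-↭ f q)

    Σ-map : ∀ {b} {B : Set b} (g : B → A) ys f → Σ (map g ys) f ≈ Σ ys (f ∘ g)
    Σ-map g []       f = refl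
    Σ-map g (y ∷ ys) f = +-congˡ (Σ-map g ys f)

    -- Duplicate-free lists with the same members are permutations of one another, so a bijection is
    -- given as an injective map together with its image, and no matching of positions has to be
    -- written down.
    Σ-reindex : ∀ {b} {B : Set b} {xs : List A} {ys : List B} →
      Unique xs → Unique ys →
      (g : B → A) → (∀ {y z} → g y ≡ g z → y ≡ z) →
      (∀ {y} → y ∈ ys → g y ∈ xs) → (∀ {x} → x ∈ xs → ∃[ y ] y ∈ ys × g y ≡ x) →
      ∀ f → Σ xs f ≈ Σ ys (f ∘ g)
    Σ-reindex {xs = xs} {ys} xs! ys! g g-inj into onto f = trans
      (Σ-↭ f (∼bag⇒↭ (unique∧set⇒bag xs! (Unique.map⁺ g-inj ys!) (mk⇔ to from))))
      (Σ-map g ys f)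
      where
      to : ∀ {x} → x ∈ xs → x ∈ map g ys
      to x∈xs with y , y∈ys , ≡.refl ← onto x∈xs = ∈ₚ.∈-map⁺ g y∈ys
      from : ∀ {x} → x ∈ map g ys → x ∈ xs
      from x∈ys with y , y∈ys , ≡.refl ← ∈ₚ.∈-map⁻ g x∈ys = into y∈ys

    Σ-sameMembers : ∀ {xs ys : List A} → Unique xs → Unique ys →
      (∀ {x} → x ∈ ys → x ∈ xs) → (∀ {x} → x ∈ xs → x ∈ ys) → ∀ f → Σ xs f ≈ Σ ys f
    Σ-sameMembers xs! ys! into onto =
      Σ-reindex xs! ys! id id into (λ x∈xs → _ , onto x∈xs , ≡.refl)

  Σ-swap : ∀ {a b} {A : Set a} {B : Set b} (xs : List A) (ys : List B) (f : A → B → Carrier) →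
           Σ xs (λ x → Σ ys (f x)) ≈ Σ ys (λ y → Σ xs (λ x → f x y))
  Σ-swap []       ys f = sym (Σ-zero ys (λ _ → refl))
  Σ-swap (x ∷ xs) ys f =
    trans (+-congˡ (Σ-swap xs ys f)) (sym (Σ-+ ys (f x) _))

  𝟙 : ∀ {p} {P : Set p} → Dec P → Carrier
  𝟙 P? = if does P? then 1# else 0#

  𝟙-yes : ∀ {p} {P : Set p} (P? : Dec P) → P → 𝟙 P? ≈ 1#
  𝟙-yes (yes _) _ = refl
  𝟙-yes (no ¬p) p = contradiction p ¬p

  𝟙-no : ∀ {p} {P : Set p} (P? : Dec P) → ¬ P → 𝟙 P? ≈ 0#
  𝟙-no (yes p) ¬p = contradiction p ¬p
  𝟙-no (no _)  _  = refl

  𝟙-⇔ : ∀ {p q} {P : Set p} {Q : Set q} (P? : Dec P) (Q? : Dec Q) →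
        (P → Q) → (Q → P) → 𝟙 P? ≈ 𝟙 Q?
  𝟙-⇔ (yes p) Q? f g = sym (𝟙-yes Q? (f p))
  𝟙-⇔ (no ¬p) Q? f g = sym (𝟙-no Q? (¬p ∘ g))

  if≈𝟙* : ∀ {p} {P : Set p} (P? : Dec P) t → (if does P? then t else 0#) ≈ 𝟙 P? * t
  if≈𝟙* (yes _) t = sym (*-identityˡ t)
  if≈𝟙* (no _)  t = sym (zeroˡ t)

  module _ {a} {A : Set a} where

    Σ-filter : ∀ {p} {P : Pred A p} (P? : Decidable P) xs f →
               Σ (filter P? xs) f ≈ Σ xs (λ x → 𝟙 (P? x) * f x)
    Σ-filter P? []       f = refl
    Σ-filter P? (x ∷ xs) f with P? x
    ... | yes _ = +-cong (sym (*-identityˡ _)) (Σ-filter P? xs f)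
    ... | no  _ = trans (Σ-filter P? xs f)
                        (trans (sym (+-identityˡ _)) (+-congʳ (sym (zeroˡ _))))

    Σ-single : ∀ {xs : List A} {f} x → Unique xs → x ∈ xs →
               (∀ {y} → y ∈ xs → y ≢ x → f y ≈ 0#) → Σ xs f ≈ f x
    Σ-single x (x∉ ∷ _) (here ≡.refl) f≈0 =
      trans (+-congˡ (Σ-zero _ λ y∈ → f≈0 (there y∈) (λ y≡x → All.lookup x∉ y∈ (≡.sym y≡x))))
            (+-identityʳ _)
    Σ-single x (y∉ ∷ xs!) (there x∈xs) f≈0 =
      trans (+-cong (f≈0 (here ≡.refl) (All.lookup y∉ x∈xs))
                    (Σ-single x xs! x∈xs (f≈0 ∘ there)))
            (+-identityˡ _)

    Σ≈sum : ∀ (xs : List A) f → Σ xs f ≈ sum (λ i → f (lookup xs i))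
    Σ≈sum []       f = refl
    Σ≈sum (x ∷ xs) f = +-congˡ (Σ≈sum xs f)

  Σ-tabulate : ∀ {a} {A : Set a} {n} (g : Fin n → A) f →
               Σ (List.tabulate g) f ≈ sum (f ∘ g)
  Σ-tabulate {n = ℕ.zero}  g f = refl
  Σ-tabulate {n = ℕ.suc n} g f = +-congˡ (Σ-tabulate (g ∘ suc) f)

-- The Möbius function at multiples of a prime, and lists of divisors.

module Möbius where

  open import Data.Nat.Base hiding (_⊔_)
  open PrimeFactorisation using (isFactorisation; factorsPrime)

  private
    unique? = DecUnique.unique? ℕₚ._≟_

  -- `μ` is computed from one chosen factorisation. Uniqueness up to order lets any other serve, in
  -- particular a prime put in front of the factors of `c`, from which the value at `p * c` is read
  -- off.
  μ-factors : ∀ d .{{_ : NonZero d}} (f : PrimeFactorisation d) →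
    μ d ≡ (if does (unique? (factors f)) then ℤ.-1ℤ ℤ.^ length (factors f) else ℤ.0ℤ)
  μ-factors d f = helper (factorisationUnique (factorise d) f) (unique? _) (unique? _)
    where
    Unique-↭ : ∀ {ps qs : List ℕ} → ps ↭ qs → Unique ps → Unique qs
    Unique-↭ p = ↭ₛ.Unique-resp-↭ (≡.setoid ℕ) (↭.↭⇒↭ₛ p)
    helper : ∀ {ps qs} → ps ↭ qs → (ps! : Dec (Unique ps)) (qs! : Dec (Unique qs)) →
      (if does ps! then ℤ.-1ℤ ℤ.^ length ps else ℤ.0ℤ) ≡
      (if does qs! then ℤ.-1ℤ ℤ.^ length qs else ℤ.0ℤ)
    helper p (yes _) (yes _) = ≡.cong (ℤ.-1ℤ ℤ.^_) (↭ₚ.↭-length p)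
    helper p (yes u) (no ¬u) = contradiction (Unique-↭ p u) ¬u
    helper p (no ¬u) (yes u) = contradiction (Unique-↭ (↭.↭-sym p) u) ¬u
    helper p (no _)  (no _)  = ≡.refl

  ∷-factorisation : ∀ {p c} → Prime p → PrimeFactorisation c → PrimeFactorisation (p * c)
  ∷-factorisation {p} p-prime f = record
    { factors         = p ∷ factors f
    ; isFactorisation = ≡.cong (p *_) (isFactorisation f)
    ; factorsPrime    = p-prime ∷ factorsPrime f
    }

  module _ {p c} (p-prime : Prime p) .{{_ : NonZero c}} .{{_ : NonZero (p * c)}} where

    private
      f = factorise c

    ∈-factors⇒∣ : p ∈ factors f → p ∣ c
    ∈-factors⇒∣ p∈ = ≡.subst (p ∣_) (≡.sym (isFactorisation f)) (∣product p∈)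
      where
      ∣product : ∀ {ps} → p ∈ ps → p ∣ product ps
      ∣product (here ≡.refl) = ∣.m∣m*n _
      ∣product {q ∷ _} (there p∈ps) = ∣.∣n⇒∣m*n q (∣product p∈ps)

    μ-∤ : ¬ p ∣ c → μ (p * c) ≡ ℤ.- μ c
    μ-∤ p∤c = ≡.trans (μ-factors (p * c) (∷-factorisation p-prime f))
                      (helper (unique? (p ∷ factors f)) (unique? (factors f)))
      where
      helper : ∀ (p∷ps! : Dec (Unique (p ∷ factors f))) (ps! : Dec (Unique (factors f))) →
        (if does p∷ps! then ℤ.-1ℤ ℤ.^ length (p ∷ factors f) else ℤ.0ℤ) ≡
        ℤ.- (if does ps! then ℤ.-1ℤ ℤ.^ length (factors f) else ℤ.0ℤ)
      helper (yes _)       (yes _) = ℤₚ.-1*i≡-i (ℤ.-1ℤ ℤ.^ length (factors f))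
      helper (yes (_ ∷ u)) (no ¬u) = contradiction u ¬u
      helper (no ¬u)       (yes u) = contradiction
        (Allₚ.¬Any⇒All¬ _ (λ p∈ → p∤c (∈-factors⇒∣ p∈)) ∷ u) ¬u
      helper (no _)        (no _)  = ≡.refl

    μ-∣ : p ∣ c → μ (p * c) ≡ ℤ.0ℤ
    μ-∣ p∣c = ≡.trans (μ-factors (p * c) (∷-factorisation p-prime f))
                      (helper (unique? (p ∷ factors f)))
      where
      p∈ : p ∈ factors f
      p∈ = factorisationHasAllPrimeFactors p-prime
        (≡.subst (p ∣_) (isFactorisation f) p∣c) (factorsPrime f)
      helper : ∀ (p∷ps! : Dec (Unique (p ∷ factors f))) →
        (if does p∷ps! then ℤ.-1ℤ ℤ.^ length (p ∷ factors f) else ℤ.0ℤ) ≡ ℤ.0ℤ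
      helper (yes (p∉ ∷ _)) = contradiction ≡.refl (All.lookup p∉ p∈)
      helper (no _)         = ≡.refl

  -- The enumeration by `suc ∘ toℕ` is that of `sumOverDivisors`, so the two sums can be compared
  -- term by term.
  divisors : ℕ → List ℕ
  divisors n = filter (_∣? n) (List.tabulate {n = n} (suc ∘ toℕ))

  divisors-! : ∀ n → Unique (divisors n)
  divisors-! n = Unique.filter⁺ (_∣? n) {xs = List.tabulate {n = n} (suc ∘ toℕ)}
    (Unique.tabulate⁺ (Finₚ.toℕ-injective ∘ ℕₚ.suc-injective))

  ∈-divisors⁺ : ∀ {d n} .{{_ : NonZero n}} → d ∣ n → d ∈ divisors n
  ∈-divisors⁺ {d} {n} d∣n = ∈ₚ.∈-filter⁺ (_∣? n) (helper d d∣n) d∣n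
    where
    helper : ∀ d → d ∣ n → d ∈ List.tabulate {n = n} (suc ∘ toℕ)
    helper zero    0∣n = contradiction (∣.0∣⇒≡0 0∣n) (≢-nonZero⁻¹ n)
    helper (suc d) d∣n = ≡.subst (λ k → suc k ∈ List.tabulate {n = n} (suc ∘ toℕ))
      (Finₚ.toℕ-fromℕ< (∣.∣⇒≤ d∣n)) (∈ₚ.∈-tabulate⁺ (fromℕ< (∣.∣⇒≤ d∣n)))

  ∈-divisors⁻ : ∀ {d n} → d ∈ divisors n → d ∣ n
  ∈-divisors⁻ {n = n} d∈ = proj₂ (∈ₚ.∈-filter⁻ (_∣? n) {xs = List.tabulate {n = n} (suc ∘ toℕ)} d∈)

  2∣⇒even : ∀ {d} → 2 ∣ d → parity d ≡ 0ℙ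
  2∣⇒even (divides q ≡.refl) = ≡.trans (Parityₚ.*-homo-* q 2) (Parityₚ.*-zeroʳ _)

  2∤⇒odd : ∀ {d} → ¬ 2 ∣ d → parity d ≡ 1ℙ
  2∤⇒odd {zero}        2∤d = contradiction (2 ∣.∣0) 2∤d
  2∤⇒odd {suc zero}    2∤d = ≡.refl
  2∤⇒odd {suc (suc d)} 2∤d = 2∤⇒odd {d} (2∤d ∘ ∣.∣m∣n⇒∣m+n (∣.∣-refl {2}))

-- Sums of the Möbius function over divisors, with and without signs.

module MöbiusSums {c ℓ₁ ℓ₂} (F : HeytingField c ℓ₁ ℓ₂) where

  open Möbius
  open Field F
  open ListSum commutativeRing public
  open RingProperties ring using (-‿involutive; -‿distribˡ-*; -‿distribʳ-*; -1*x≈-x) public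
  open SetoidReasoning setoid

  -- Lists of naturals carry no `NonZero` proofs, hence this total version with the junk value 0 at
  -- 0; `divisorSign` follows the same convention.
  μ# : ℕ → Carrier
  μ# zero      = 0#
  μ# d@(suc _) = fromℤ (μ d)

  μ#≈ : ∀ d .{{_ : NonZero d}} → μ# d ≈ fromℤ (μ d)
  μ#≈ (suc _) = refl

  fromℤ-neg : ∀ z → fromℤ (ℤ.- z) ≈ - fromℤ z
  fromℤ-neg (+ zero)     = sym -0#≈0#
  fromℤ-neg (+ (suc n))  = refl
  fromℤ-neg -[1+ n ]     = sym (-‿involutive _)

  module _ {p} (p-prime : Prime p) where

    private instance
      p≢0 : NonZero p
      p≢0 = prime⇒nonZero p-prime

    μ#-* : ∀ c → μ# (p ℕ.* c) ≈ 𝟙 (¬? (p ∣? c)) * (- μ# c)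
    μ#-* zero = begin
      μ# (p ℕ.* 0)                    ≡⟨ ≡.cong μ# (ℕₚ.*-zeroʳ p) ⟩
      0#                              ≈⟨ zeroʳ _ ⟨
      𝟙 (¬? (p ∣? 0)) * 0#            ≈⟨ *-congˡ -0#≈0# ⟨
      𝟙 (¬? (p ∣? 0)) * (- 0#)        ∎
    μ#-* c@(suc c-1) = trans (μ#≈ (p ℕ.* c)) (cases (p ∣? c))
      where
      instance
        pc≢0 : NonZero (p ℕ.* c)
        pc≢0 = ℕₚ.m*n≢0 p c
      cases : (d : Dec (p ∣ c)) → fromℤ (μ (p ℕ.* c)) ≈ 𝟙 (¬? d) * (- fromℤ (μ c))
      cases (yes p∣c) = trans (reflexive (≡.cong fromℤ (μ-∣ p-prime p∣c))) (sym (zeroˡ _))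
      cases (no p∤c)  = begin
        fromℤ (μ (p ℕ.* c))      ≡⟨ ≡.cong fromℤ (μ-∤ p-prime p∤c) ⟩
        fromℤ (ℤ.- μ c)          ≈⟨ fromℤ-neg (μ c) ⟩
        - fromℤ (μ c)            ≈⟨ *-identityˡ _ ⟨
        1# * (- fromℤ (μ c))     ∎

    prime-split : ∀ k .{{_ : NonZero k}} (h : ℕ → Carrier) →
      Σ (divisors (p ℕ.* k)) (λ d → h d * μ# d) ≈
      Σ (filter (λ d → ¬? (p ∣? d)) (divisors k)) (λ d → (h d - h (p ℕ.* d)) * μ# d)
    prime-split k h = begin
      Σ D hμ
        ≈⟨ Σ-cong D (λ {d} _ → 𝟙-split d) ⟩
      Σ D (λ d → 𝟙 (p∤? d) * hμ d + 𝟙 (p ∣? d) * hμ d)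
        ≈⟨ Σ-+ D _ _ ⟩
      Σ D (λ d → 𝟙 (p∤? d) * hμ d) + Σ D (λ d → 𝟙 (p ∣? d) * hμ d)
        ≈⟨ +-cong (Σ-filter p∤? D hμ) (Σ-filter (p ∣?_) D hμ) ⟨
      Σ (filter p∤? D) hμ + Σ (filter (p ∣?_) D) hμ
        ≈⟨ +-cong
             (Σ-sameMembers (Unique.filter⁺ p∤? (divisors-! (p ℕ.* k))) (Unique.filter⁺ p∤? (divisors-! k))
               ∤-into ∤-onto hμ)
             (Σ-reindex (Unique.filter⁺ (p ∣?_) (divisors-! (p ℕ.* k))) (divisors-! k)
               (p ℕ.*_) (λ {y} {z} → ℕₚ.*-cancelˡ-≡ y z p) ∣-into ∣-onto hμ) ⟩
      Σ E hμ + Σ (divisors k) (λ d → hμ (p ℕ.* d))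
        ≈⟨ +-congˡ (Σ-cong (divisors k) (λ {d} _ → trans (*-congˡ (μ#-* d)) (neg d))) ⟩
      Σ E hμ + Σ (divisors k) (λ d → 𝟙 (p∤? d) * (- (h (p ℕ.* d) * μ# d)))
        ≈⟨ +-congˡ (Σ-filter p∤? (divisors k) _) ⟨
      Σ E hμ + Σ E (λ d → - (h (p ℕ.* d) * μ# d))
        ≈⟨ Σ-+ E _ _ ⟨
      Σ E (λ d → hμ d - h (p ℕ.* d) * μ# d)
        ≈⟨ Σ-cong E (λ {d} _ → trans (distribʳ _ _ _) (+-congˡ (sym (-‿distribˡ-* _ _)))) ⟨
      Σ E (λ d → (h d - h (p ℕ.* d)) * μ# d) ∎
      where
      instance
        pk≢0 : NonZero (p ℕ.* k)
        pk≢0 = ℕₚ.m*n≢0 p k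
      p∤? : Decidable (λ d → ¬ p ∣ d)
      p∤? d = ¬? (p ∣? d)
      D = divisors (p ℕ.* k)
      E = filter p∤? (divisors k)
      hμ : ℕ → Carrier
      hμ d = h d * μ# d
      𝟙-split : ∀ d → hμ d ≈ 𝟙 (p∤? d) * hμ d + 𝟙 (p ∣? d) * hμ d
      𝟙-split d with p ∣? d
      ... | yes _ = sym (trans (+-cong (zeroˡ _) (*-identityˡ _)) (+-identityˡ _))
      ... | no  _ = sym (trans (+-cong (*-identityˡ _) (zeroˡ _)) (+-identityʳ _))
      neg : ∀ d → h (p ℕ.* d) * (𝟙 (p∤? d) * (- μ# d)) ≈ 𝟙 (p∤? d) * (- (h (p ℕ.* d) * μ# d))
      neg d = begin
        h (p ℕ.* d) * (𝟙 (p∤? d) * (- μ# d)) ≈⟨ *-assoc _ _ _ ⟨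
        h (p ℕ.* d) * 𝟙 (p∤? d) * (- μ# d)   ≈⟨ *-congʳ (*-comm _ _) ⟩
        𝟙 (p∤? d) * h (p ℕ.* d) * (- μ# d)   ≈⟨ *-assoc _ _ _ ⟩
        𝟙 (p∤? d) * (h (p ℕ.* d) * (- μ# d)) ≈⟨ *-congˡ (-‿distribʳ-* _ _) ⟨
        𝟙 (p∤? d) * (- (h (p ℕ.* d) * μ# d)) ∎
      ∤-into : ∀ {d} → d ∈ E → d ∈ filter p∤? D
      ∤-into d∈ with d∈k , p∤d ← ∈ₚ.∈-filter⁻ p∤? {xs = divisors k} d∈ =
        ∈ₚ.∈-filter⁺ p∤? (∈-divisors⁺ (∣.∣n⇒∣m*n p (∈-divisors⁻ {n = k} d∈k))) p∤d
      ∤-onto : ∀ {d} → d ∈ filter p∤? D → d ∈ E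
      ∤-onto {d} d∈ with d∈pk , p∤d ← ∈ₚ.∈-filter⁻ p∤? {xs = D} d∈
        with divides q pk≡qd ← ∈-divisors⁻ {n = p ℕ.* k} d∈pk
        with euclidsLemma q d p-prime (≡.subst (p ∣_) pk≡qd (∣.m∣m*n k))
      ... | inj₂ p∣d = contradiction p∣d p∤d
      ... | inj₁ (divides r ≡.refl) = ∈ₚ.∈-filter⁺ p∤? (∈-divisors⁺ (divides r k≡rd)) p∤d
        where
        k≡rd : k ≡ r ℕ.* d
        k≡rd = ℕₚ.*-cancelˡ-≡ k (r ℕ.* d) p
          (≡.trans pk≡qd (≡.trans (≡.cong (ℕ._* d) (ℕₚ.*-comm r p)) (ℕₚ.*-assoc p r d)))
      ∣-into : ∀ {d} → d ∈ divisors k → p ℕ.* d ∈ filter (p ∣?_) D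
      ∣-into d∈ = ∈ₚ.∈-filter⁺ (p ∣?_)
        (∈-divisors⁺ (∣.*-monoʳ-∣ p (∈-divisors⁻ {n = k} d∈))) (∣.m∣m*n _)
      ∣-onto : ∀ {x} → x ∈ filter (p ∣?_) D → ∃[ d ] d ∈ divisors k × p ℕ.* d ≡ x
      ∣-onto x∈ with x∈D , divides q ≡.refl ← ∈ₚ.∈-filter⁻ (p ∣?_) {xs = D} x∈ =
        q , ∈-divisors⁺ (∣.*-cancelˡ-∣ p (≡.subst (_∣ p ℕ.* k) (ℕₚ.*-comm q p)
              (∈-divisors⁻ {n = p ℕ.* k} x∈D))) , ℕₚ.*-comm p q

  -- One prime factor `p` of `e` is enough: the terms at `d` and `p * d` cancel, without induction
  -- over the factorisation.
  Σμ : ∀ e .{{_ : NonZero e}} → Σ (divisors e) μ# ≈ 𝟙 (e ℕₚ.≟ 1)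
  Σμ e with factorise e
  ... | record { factors = [] ; isFactorisation = ≡.refl } =
    trans (+-identityʳ _) (+-identityʳ _)
  ... | record { factors = p ∷ ps ; isFactorisation = ≡.refl ; factorsPrime = p-prime ∷ _ } =
    begin
      Σ (divisors (p ℕ.* k)) μ#                       ≈⟨ Σ-cong (divisors (p ℕ.* k)) (λ _ → *-identityˡ _) ⟨
      Σ (divisors (p ℕ.* k)) (λ d → 1# * μ# d)        ≈⟨ prime-split p-prime k (λ _ → 1#) ⟩
      Σ E (λ d → (1# - 1#) * μ# d)                    ≈⟨ Σ-zero E (λ _ → trans (*-congʳ (-‿inverseʳ 1#)) (zeroˡ _)) ⟩
      0#                                              ≈⟨ 𝟙-no (p ℕ.* k ℕₚ.≟ 1) pk≢1 ⟨
      𝟙 (p ℕ.* k ℕₚ.≟ 1)                              ∎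
    where
    k = product ps
    instance
      k≢0 : NonZero k
      k≢0 = ℕₚ.m*n≢0⇒n≢0 p
    E = filter (λ d → ¬? (p ∣? d)) (divisors k)
    pk≢1 : p ℕ.* k ≢ 1
    pk≢1 pk≡1 = ¬prime[1] (≡.subst Prime (ℕₚ.m*n≡1⇒m≡1 p k pk≡1) p-prime)

  parity# : Parity → Carrier
  parity# 0ℙ = 1#
  parity# 1ℙ = - 1#

  sgn≈parity# : ∀ a → (- 1#) ^ a ≈ parity# (ℕ.parity a)
  sgn≈parity# zero          = refl
  sgn≈parity# (suc zero)    = *-identityʳ _
  sgn≈parity# (suc (suc a)) = begin
    - 1# * (- 1# * (- 1#) ^ a) ≈⟨ *-assoc _ _ _ ⟨
    - 1# * - 1# * (- 1#) ^ a   ≈⟨ *-congʳ (trans (-1*x≈-x _) (-‿involutive 1#)) ⟩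
    1# * (- 1#) ^ a            ≈⟨ *-identityˡ _ ⟩
    (- 1#) ^ a                 ≈⟨ sgn≈parity# a ⟩
    parity# (ℕ.parity a)       ∎

  divisorSign : ℕ → ℕ → Carrier
  divisorSign m zero      = 0#
  divisorSign m d@(suc _) = (- 1#) ^ (m ℕ.+ m / d)

  module _ (k : ℕ) where

    private
      -- `k` stands for the number of odd letters of a primitive word u, so that `e * k` is the
      -- number of odd letters of its `e`-th power.
      ε : ℕ → ℕ → Carrier
      ε e = divisorSign (e ℕ.* k)

    -- For `e = q * d` the exponent of the sign is q d k + q k. Only its parity matters, and in
    -- `Parity` the remaining evaluations are finite case checks.
    ε-quotient : ∀ q d .{{_ : NonZero d}} →
      ε (q ℕ.* d) d ≈ parity# (ℕ.parity q Parity.* ℕ.parity d Parity.* ℕ.parity k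
                                Parity.+ (ℕ.parity q Parity.* ℕ.parity k))
    ε-quotient q d@(suc _) = begin
      (- 1#) ^ (q ℕ.* d ℕ.* k ℕ.+ q ℕ.* d ℕ.* k / d)
        ≡⟨ ≡.cong (λ a → (- 1#) ^ (q ℕ.* d ℕ.* k ℕ.+ a)) quotient ⟩
      (- 1#) ^ (q ℕ.* d ℕ.* k ℕ.+ q ℕ.* k)
        ≈⟨ sgn≈parity# (q ℕ.* d ℕ.* k ℕ.+ q ℕ.* k) ⟩
      parity# (ℕ.parity (q ℕ.* d ℕ.* k ℕ.+ q ℕ.* k))
        ≡⟨ ≡.cong parity# (≡.trans (Parityₚ.+-homo-+ (q ℕ.* d ℕ.* k) (q ℕ.* k))
             (≡.cong₂ Parity._+_
               (≡.trans (Parityₚ.*-homo-* (q ℕ.* d) k)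
                 (≡.cong (Parity._* ℕ.parity k) (Parityₚ.*-homo-* q d)))
               (Parityₚ.*-homo-* q k))) ⟩
      _ ∎
      where
      quotient : q ℕ.* d ℕ.* k / d ≡ q ℕ.* k
      quotient = ≡.trans
        (DivMod./-congˡ (≡.trans (ℕₚ.*-assoc q d k) (≡.trans
          (≡.cong (q ℕ.*_) (ℕₚ.*-comm d k)) (≡.sym (ℕₚ.*-assoc q k d)))))
        (DivMod.m*n/n≡m (q ℕ.* k) d)

    ε-odd : ∀ {d e} .{{_ : NonZero e}} → d ∣ e → ℕ.parity d ≡ 1ℙ → ε e d ≈ 1#
    ε-odd {suc d-1} (divides q ≡.refl) odd = trans (ε-quotient q (suc d-1))
      (reflexive (≡.cong parity# (helper (ℕ.parity q) (ℕ.parity k) odd)))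
      where
      helper : ∀ a b {c} → c ≡ 1ℙ → a Parity.* c Parity.* b Parity.+ (a Parity.* b) ≡ 0ℙ
      helper 0ℙ _  ≡.refl = ≡.refl
      helper 1ℙ 0ℙ ≡.refl = ≡.refl
      helper 1ℙ 1ℙ ≡.refl = ≡.refl

    -- At the divisor 2d of 2f the number m = 2fk is even, and m / (2d) = (f / d) k has the parity
    -- of f k because d is odd.
    ε-double : ∀ {d f} .{{_ : NonZero f}} → d ∣ f → ℕ.parity d ≡ 1ℙ →
      ε (2 ℕ.* f) (2 ℕ.* d) ≈ parity# (ℕ.parity f Parity.* ℕ.parity k)
    ε-double {suc d-1} (divides q ≡.refl) odd = begin
      ε (2 ℕ.* (q ℕ.* d)) (2 ℕ.* d)
        ≡⟨ ≡.cong (λ e → ε e (2 ℕ.* d)) (≡.trans (≡.sym (ℕₚ.*-assoc 2 q d))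
             (≡.trans (≡.cong (ℕ._* d) (ℕₚ.*-comm 2 q)) (ℕₚ.*-assoc q 2 d))) ⟩
      ε (q ℕ.* (2 ℕ.* d)) (2 ℕ.* d)
        ≈⟨ ε-quotient q (2 ℕ.* d) ⟩
      parity# (ℕ.parity q Parity.* ℕ.parity (2 ℕ.* d) Parity.* ℕ.parity k
        Parity.+ (ℕ.parity q Parity.* ℕ.parity k))
        ≡⟨ ≡.cong parity# (helper (ℕ.parity q) (ℕ.parity k) (2∣⇒even (∣.m∣m*n {2} d))
             (≡.trans (Parityₚ.*-homo-* q d) (≡.trans (≡.cong (ℕ.parity q Parity.*_) odd)
               (Parityₚ.*-identityʳ _)))) ⟩
      parity# (ℕ.parity (q ℕ.* d) Parity.* ℕ.parity k) ∎
      where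
      d = suc d-1
      helper : ∀ a b {c f} → c ≡ 0ℙ → f ≡ a →
        a Parity.* c Parity.* b Parity.+ (a Parity.* b) ≡ f Parity.* b
      helper 0ℙ _ ≡.refl ≡.refl = ≡.refl
      helper 1ℙ _ ≡.refl ≡.refl = ≡.refl

    -- For odd `e` all divisors are odd, the signs are 1 and `Σμ` applies. For `e` = 2f, splitting
    -- at 2 leaves the odd divisors d of f, each with the factor 1 - (-1)^(f k), which does not
    -- depend on d. It vanishes unless f and k are odd; then it is 2, every divisor of f is odd, and
    -- `Σμ` at f gives the indicator of f = 1.
    Σεμ : ∀ e .{{_ : NonZero e}} →
      Σ (divisors e) (λ d → ε e d * μ# d) ≈
      𝟙 (e ℕₚ.≟ 1) + 𝟙 (e ℕₚ.≟ 2) * (𝟙 (ℕ.parity k Parityₚ.≟ 1ℙ) * (1# + 1#))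
    Σεμ e with 2 ∣? e
    ... | no 2∤e = begin
      Σ (divisors e) (λ d → ε e d * μ# d)
        ≈⟨ Σ-cong (divisors e) (λ {d} d∈ → trans (*-congʳ
             (ε-odd (∈-divisors⁻ {n = e} d∈)
               (2∤⇒odd (λ 2∣d → 2∤e (∣.∣-trans 2∣d (∈-divisors⁻ {n = e} d∈))))))
             (*-identityˡ _)) ⟩
      Σ (divisors e) μ#   ≈⟨ Σμ e ⟩
      𝟙 (e ℕₚ.≟ 1)        ≈⟨ +-identityʳ _ ⟨
      𝟙 (e ℕₚ.≟ 1) + 0#   ≈⟨ +-congˡ (trans (*-congʳ (𝟙-no (e ℕₚ.≟ 2) λ { ≡.refl → 2∤e ∣.∣-refl })) (zeroˡ _)) ⟨
      _ ∎
    ... | yes (divides f ≡.refl) = begin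
      Σ (divisors (f ℕ.* 2)) (λ d → ε (f ℕ.* 2) d * μ# d)
        ≡⟨ ≡.cong (λ e → Σ (divisors e) (λ d → ε e d * μ# d)) (ℕₚ.*-comm f 2) ⟩
      Σ (divisors (2 ℕ.* f)) (λ d → ε (2 ℕ.* f) d * μ# d)
        ≈⟨ prime-split prime[2] f (ε (2 ℕ.* f)) ⟩
      Σ E (λ d → (ε (2 ℕ.* f) d - ε (2 ℕ.* f) (2 ℕ.* d)) * μ# d)
        ≈⟨ Σ-cong E (λ {d} d∈ → *-congʳ (difference d∈)) ⟩
      Σ E (λ d → (1# - parity# (ℕ.parity f Parity.* ℕ.parity k)) * μ# d)
        ≈⟨ Σ-*ˡ E _ μ# ⟨
      (1# - parity# (ℕ.parity f Parity.* ℕ.parity k)) * Σ E μ#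
        ≈⟨ cases (ℕ.parity f) (ℕ.parity k) ≡.refl ⟩
      𝟙 (f ℕₚ.≟ 1) * (𝟙 (ℕ.parity k Parityₚ.≟ 1ℙ) * (1# + 1#))
        ≈⟨ *-congʳ (𝟙-⇔ (f ℕₚ.≟ 1) (f ℕ.* 2 ℕₚ.≟ 2)
             (λ { ≡.refl → ≡.refl }) (ℕₚ.*-cancelʳ-≡ f 1 2)) ⟩
      𝟙 (f ℕ.* 2 ℕₚ.≟ 2) * _
        ≈⟨ +-identityˡ _ ⟨
      0# + 𝟙 (f ℕ.* 2 ℕₚ.≟ 2) * _
        ≈⟨ +-congʳ (𝟙-no (f ℕ.* 2 ℕₚ.≟ 1) f*2≢1) ⟨
      𝟙 (f ℕ.* 2 ℕₚ.≟ 1) + 𝟙 (f ℕ.* 2 ℕₚ.≟ 2) * _ ∎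
      where
      instance
        f≢0 : NonZero f
        f≢0 = ℕₚ.m*n≢0⇒m≢0 f
        2f≢0 : NonZero (2 ℕ.* f)
        2f≢0 = ℕₚ.m*n≢0 2 f
      2∤? : Decidable (λ d → ¬ 2 ∣ d)
      2∤? d = ¬? (2 ∣? d)
      E = filter 2∤? (divisors f)
      f*2≢1 : f ℕ.* 2 ≢ 1
      f*2≢1 f*2≡1 = contradiction (ℕₚ.m*n≡1⇒n≡1 f 2 f*2≡1) λ ()
      E⁻ : ∀ {d} → d ∈ E → d ∣ f × ℕ.parity d ≡ 1ℙ
      E⁻ d∈ with d∈f , 2∤d ← ∈ₚ.∈-filter⁻ 2∤? {xs = divisors f} d∈ =
        ∈-divisors⁻ {n = f} d∈f , 2∤⇒odd 2∤d
      difference : ∀ {d} → d ∈ E → ε (2 ℕ.* f) d - ε (2 ℕ.* f) (2 ℕ.* d) ≈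
        1# - parity# (ℕ.parity f Parity.* ℕ.parity k)
      difference d∈ with d∣f , odd ← E⁻ d∈ =
        +-cong (ε-odd (∣.∣n⇒∣m*n 2 d∣f) odd) (-‿cong (ε-double d∣f odd))
      cases : ∀ p q → p ≡ ℕ.parity f → (1# - parity# (p Parity.* q)) * Σ E μ# ≈
        𝟙 (f ℕₚ.≟ 1) * (𝟙 (q Parityₚ.≟ 1ℙ) * (1# + 1#))
      cases p 0ℙ _ = trans
        (*-congʳ (trans (+-congˡ (-‿cong (reflexive (≡.cong parity# (Parityₚ.*-zeroʳ p)))))
          (-‿inverseʳ 1#)))
        (trans (zeroˡ _) (sym (trans (*-congˡ (zeroˡ _)) (zeroʳ _))))
      cases 0ℙ 1ℙ f-even = trans (*-congʳ (-‿inverseʳ 1#)) (trans (zeroˡ _)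
        (sym (trans (*-congʳ (𝟙-no (f ℕₚ.≟ 1) λ { ≡.refl → contradiction f-even λ () })) (zeroˡ _))))
      cases 1ℙ 1ℙ f-odd = begin
        (1# - - 1#) * Σ E μ#   ≈⟨ *-comm _ _ ⟩
        Σ E μ# * (1# - - 1#)   ≈⟨ *-cong E≈ (+-congˡ (-‿involutive 1#)) ⟩
        𝟙 (f ℕₚ.≟ 1) * (1# + 1#) ≈⟨ *-congˡ (*-identityˡ _) ⟨
        𝟙 (f ℕₚ.≟ 1) * (1# * (1# + 1#)) ∎
        where
        all-odd : ∀ {d} → d ∈ divisors f → d ∈ E
        all-odd d∈ = ∈ₚ.∈-filter⁺ 2∤? d∈ λ 2∣d → contradiction
          (≡.trans f-odd (2∣⇒even (∣.∣-trans 2∣d (∈-divisors⁻ {n = f} d∈)))) λ ()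
        E≈ : Σ E μ# ≈ 𝟙 (f ℕₚ.≟ 1)
        E≈ = trans (Σ-sameMembers (Unique.filter⁺ 2∤? (divisors-! f)) (divisors-! f)
          all-odd (λ d∈ → proj₁ (∈ₚ.∈-filter⁻ 2∤? {xs = divisors f} d∈)) μ#) (Σμ f)

-- Rotations, powers and periods of words.

module Rotation {A : Set} where

  open import Data.Nat.Base using (_+_; _*_; _%_)

  rotate₁ : List A → List A
  rotate₁ []      = []
  rotate₁ (a ∷ w) = w ∷ʳ a

  rotate : ℕ → List A → List A
  rotate zero    w = w
  rotate (suc r) w = rotate r (rotate₁ w)

  rotate₁-length : ∀ w → length (rotate₁ w) ≡ length w
  rotate₁-length []      = ≡.refl
  rotate₁-length (a ∷ w) = ≡.trans (Listₚ.length-++ w) (ℕₚ.+-comm (length w) 1)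

  rotate-[] : ∀ r → rotate r [] ≡ []
  rotate-[] zero    = ≡.refl
  rotate-[] (suc r) = rotate-[] r

  rotate-length : ∀ r w → length (rotate r w) ≡ length w
  rotate-length zero    w = ≡.refl
  rotate-length (suc r) w = ≡.trans (rotate-length r (rotate₁ w)) (rotate₁-length w)

  rotate₁-injective : ∀ v w → rotate₁ v ≡ rotate₁ w → v ≡ w
  rotate₁-injective []      []      _  = ≡.refl
  rotate₁-injective []      (b ∷ w) eq =
    contradiction (≡.trans (≡.cong length eq) (rotate₁-length (b ∷ w))) λ ()
  rotate₁-injective (a ∷ v) []      eq =
    contradiction (≡.trans (≡.sym (≡.cong length eq)) (rotate₁-length (a ∷ v))) λ ()
  rotate₁-injective (a ∷ v) (b ∷ w) eq with ≡.refl , ≡.refl ← Listₚ.∷ʳ-injective v w eq = ≡.refl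

  rotate-injective : ∀ r v w → rotate r v ≡ rotate r w → v ≡ w
  rotate-injective zero    v w eq = eq
  rotate-injective (suc r) v w eq = rotate₁-injective v w (rotate-injective r _ _ eq)

  rotate-+ : ∀ r s w → rotate (r + s) w ≡ rotate s (rotate r w)
  rotate-+ zero    s w = ≡.refl
  rotate-+ (suc r) s w = rotate-+ r s (rotate₁ w)

  rotate-comm : ∀ r s w → rotate r (rotate s w) ≡ rotate s (rotate r w)
  rotate-comm r s w = ≡.trans (≡.sym (rotate-+ s r w))
    (≡.trans (≡.cong (λ k → rotate k w) (ℕₚ.+-comm s r)) (rotate-+ r s w))

  rotate-++ : ∀ u v → rotate (length u) (u ++ v) ≡ v ++ u
  rotate-++ []      v = ≡.sym (Listₚ.++-identityʳ v)
  rotate-++ (a ∷ u) v = ≡.trans (≡.cong (rotate (length u)) (Listₚ.++-assoc u v (a ∷ [])))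
    (≡.trans (rotate-++ u (v ++ a ∷ [])) (Listₚ.++-assoc v (a ∷ []) u))

  rotate-full : ∀ w → rotate (length w) w ≡ w
  rotate-full w = ≡.trans (≡.cong (rotate (length w)) (≡.sym (Listₚ.++-identityʳ w))) (rotate-++ w [])

  rotate-split : ∀ r w → r ℕ.≤ length w → rotate r w ≡ List.drop r w ++ List.take r w
  rotate-split r w r≤w = ≡.trans
    (≡.cong₂ rotate (≡.sym (≡.trans (Listₚ.length-take r w) (ℕₚ.m≤n⇒m⊓n≡m r≤w)))
                    (≡.sym (Listₚ.take++drop≡id r w)))
    (rotate-++ (List.take r w) (List.drop r w))

  rotate-* : ∀ k p w → rotate p w ≡ w → rotate (k * p) w ≡ w
  rotate-* zero    p w eq = ≡.refl
  rotate-* (suc k) p w eq = ≡.trans (rotate-+ p (k * p) w)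
    (≡.trans (≡.cong (rotate (k * p)) eq) (rotate-* k p w eq))

  rotate-% : ∀ s p .{{_ : NonZero p}} w → rotate p w ≡ w → rotate s w ≡ rotate (s % p) w
  rotate-% s p w eq = ≡.trans
    (≡.cong (λ k → rotate k w) (≡.trans (DivMod.m≡m%n+[m/n]*n s p) (ℕₚ.+-comm (s % p) _)))
    (≡.trans (rotate-+ (s / p * p) (s % p) w)
      (≡.cong (rotate (s % p)) (rotate-* (s / p) p w eq)))

  rotate-square : ∀ r w → rotate r (w ++ w) ≡ rotate r w ++ rotate r w
  rotate-square zero    w       = ≡.refl
  rotate-square (suc r) []      = rotate-square r []
  rotate-square (suc r) (a ∷ w) = ≡.trans
    (≡.cong (rotate r) (≡.trans (Listₚ.++-assoc w (a ∷ w) (a ∷ []))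
      (≡.sym (Listₚ.++-assoc w (a ∷ []) (w ++ a ∷ [])))))
    (rotate-square r (w ∷ʳ a))

  power : ℕ → List A → List A
  power zero    u = []
  power (suc d) u = u ++ power d u

  power-comm : ∀ d u → power d u ++ u ≡ u ++ power d u
  power-comm zero    u = ≡.sym (Listₚ.++-identityʳ u)
  power-comm (suc d) u = ≡.trans (Listₚ.++-assoc u (power d u) u) (≡.cong (u ++_) (power-comm d u))

  power-length : ∀ d u → length (power d u) ≡ d * length u
  power-length zero    u = ≡.refl
  power-length (suc d) u = ≡.trans (Listₚ.length-++ u) (≡.cong (λ k → length u + k) (power-length d u))

  rotate-power : ∀ d u → rotate (length u) (power d u) ≡ power d u
  rotate-power zero    u = rotate-[] (length u)
  rotate-power (suc d) u = ≡.trans (rotate-++ u (power d u)) (power-comm d u)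

  ++-injective : ∀ (u v : List A) {x y} → length u ≡ length v → u ++ x ≡ v ++ y → u ≡ v × x ≡ y
  ++-injective []      []      _  eq = ≡.refl , eq
  ++-injective (a ∷ u) (b ∷ v) l≡ eq
    with ≡.refl , eq′ ← Listₚ.∷-injective eq
    with ≡.refl , x≡y ← ++-injective u v (ℕₚ.suc-injective l≡) eq′ = ≡.refl , x≡y

  square-injective : ∀ (u v : List A) → u ++ u ≡ v ++ v → u ≡ v
  square-injective u v eq = proj₁ (++-injective u v (double-injective (≡.trans
    (≡.sym (Listₚ.length-++ u)) (≡.trans (≡.cong length eq) (Listₚ.length-++ v)))) eq)
    where
    double-injective : ∀ {k l} → k + k ≡ l + l → k ≡ l
    double-injective {k} {l} eq with ℕₚ.<-cmp k l
    ... | tri< k<l _ _ = contradiction eq (ℕₚ.<⇒≢ (ℕₚ.+-mono-< k<l k<l))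
    ... | tri≈ _ k≡l _ = k≡l
    ... | tri> _ _ l<k = contradiction (≡.sym eq) (ℕₚ.<⇒≢ (ℕₚ.+-mono-< l<k l<k))

  -- For positive `d` the word `v` is at least as long as `u`, so the equation forces `v` to begin
  -- with `u`; removing this copy preserves the equation and lowers `d`.
  commute⇒power : ∀ d u v → length v ≡ d * length u → v ++ u ≡ u ++ v → v ≡ power d u
  commute⇒power zero    u []      _  _  = ≡.refl
  commute⇒power (suc d) u v       l≡ eq = ≡.trans (≡.sym split) (≡.cong (u ++_)
    (commute⇒power d u v′
      (ℕₚ.+-cancelˡ-≡ n _ _ (≡.trans (≡.sym (Listₚ.length-++ u)) (≡.trans (≡.cong length split) l≡)))
      (Listₚ.++-cancelˡ u _ _ (≡.trans (≡.sym (Listₚ.++-assoc u v′ u))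
        (≡.trans (≡.cong (_++ u) split) (≡.trans eq (≡.cong (u ++_) (≡.sym split))))))))
    where
    n = length u
    v′ = List.drop n v
    n≤v : n ℕ.≤ length v
    n≤v = ≡.subst (n ℕ.≤_) (≡.sym l≡) (ℕₚ.m≤m+n n _)
    take≡u : List.take n v ≡ u
    take≡u = proj₁ (++-injective (List.take n v) u
      (≡.trans (Listₚ.length-take n v) (ℕₚ.m≤n⇒m⊓n≡m n≤v))
      (≡.trans (≡.sym (Listₚ.++-assoc (List.take n v) v′ u))
        (≡.trans (≡.cong (_++ u) (Listₚ.take++drop≡id n v)) eq)))
    split : u ++ v′ ≡ v
    split = ≡.trans (≡.cong (_++ v′) (≡.sym take≡u)) (Listₚ.take++drop≡id n v)

  -- Cut `w` after `h` letters into `u ++ v`: invariance under the rotation reads `v ++ u ≡ u ++ v`,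
  -- and commuting words of these lengths are powers.
  period⇒power : ∀ d h w → length w ≡ d * h → rotate h w ≡ w → w ≡ power d (List.take h w)
  period⇒power zero    h []  _  _  = ≡.refl
  period⇒power (suc d) h w   l≡ eq = ≡.trans (≡.sym w≡) (≡.cong (u ++_) (commute⇒power d u v
    (ℕₚ.+-cancelˡ-≡ h _ _ (≡.trans (≡.cong (_+ length v) (≡.sym u-length))
      (≡.trans (≡.sym (Listₚ.length-++ u)) (≡.trans (≡.cong length w≡)
        (≡.trans l≡ (≡.cong (λ k → h + d * k) (≡.sym u-length)))))))
    (≡.trans (≡.sym (rotate-split h w h≤w)) (≡.trans eq (≡.sym w≡)))))
    where
    u = List.take h w
    v = List.drop h w
    h≤w : h ℕ.≤ length w
    h≤w = ≡.subst (h ℕ.≤_) (≡.sym l≡) (ℕₚ.m≤m+n h _)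
    u-length : length u ≡ h
    u-length = ≡.trans (Listₚ.length-take h w) (ℕₚ.m≤n⇒m⊓n≡m h≤w)
    w≡ : u ++ v ≡ w
    w≡ = Listₚ.take++drop≡id h w

  rotate-conj : ∀ r s w → rotate r (rotate s w) ≡ rotate s w → rotate r w ≡ w
  rotate-conj r s w eq = rotate-injective s _ _ (≡.trans (rotate-comm s r w) eq)

  -- Minimality is stated by divisibility because the length has to be a multiple of the period: the
  -- quotient is the exponent of `w` as a power of a primitive word.
  record MinimalPeriod (w : List A) : Set where
    field
      period  : ℕ
      {{period≢0}} : NonZero period
      rotates : rotate period w ≡ w
      minimal : ∀ {k} → rotate k w ≡ w → period ∣ k

  module _ (_≟_ : DecidableEquality (List A)) where

    private
      Least : (ℕ → Set) → ℕ → Set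
      Least P m = P m × (∀ {k} → k ℕ.< m → ¬ P k)

      least : ∀ {P : ℕ → Set} → Decidable P → ∀ n → P n → ∃[ m ] Least P m
      least {P} P? = <-rec (λ n → P n → ∃[ m ] Least P m) step
        where
        step : ∀ n → (∀ {k} → k ℕ.< n → P k → ∃[ m ] Least P m) → P n → ∃[ m ] Least P m
        step n rec Pn with ℕₚ.anyUpTo? P? n
        ... | yes (m , m<n , Pm) = rec m<n Pm
        ... | no none            = n , Pn , λ k<n Pk → none (_ , k<n , Pk)

    minimalPeriod : ∀ w → w ≢ [] → MinimalPeriod w
    minimalPeriod []        w≢[] = contradiction ≡.refl w≢[]
    minimalPeriod w@(_ ∷ v) _    = build
      -- The search is over the predecessor `m` of a period, which excludes the trivial period 0; it
      -- starts at `length v`, that is, at the full length of `w`.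
      (least (λ m → rotate (suc m) w ≟ w) (length v) (rotate-full w))
      where
      P : ℕ → Set
      P m = rotate (suc m) w ≡ w
      remainder : ∀ {m} → (∀ {k} → k ℕ.< m → ¬ P k) → ∀ r → r ℕ.< suc m → rotate r w ≡ w → r ≡ 0
      remainder ¬P zero    _         _  = ≡.refl
      remainder ¬P (suc r) (s≤s r<m) eq = contradiction eq (¬P r<m)
      build : ∃[ m ] Least P m → MinimalPeriod w
      build (m , Pm , ¬P) = record
        { period  = suc m
        ; rotates = Pm
        -- The remainder of a period modulo the least one is again a period, hence 0.
        ; minimal = λ {k} eq → ∣.m%n≡0⇒n∣m k (suc m)
            (remainder ¬P (k % suc m) (DivMod.m%n<n k (suc m))
              (≡.trans (≡.sym (rotate-% k (suc m) w Pm)) eq))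
        }

-- Lyndon words: standard factorisation, and Lyndon words among the rotations of a word.

module LyndonWords {A : Set} {_≺_ : Rel A Level.zero} (≺-sto : IsStrictTotalOrder _≡_ _≺_) where

  open import Data.Nat.Base using (_+_)
  private
    module ≺ = IsStrictTotalOrder ≺-sto

  infix 4 _<_ _≮_
  _<_ : Rel (List A) Level.zero
  _<_ = Lex.Lex-< _≡_ _≺_

  _≮_ : Rel (List A) Level.zero
  u ≮ v = ¬ u < v

  <-trans : ∀ {u v w} → u < v → v < w → u < w
  <-trans = Lex.<-transitive ≡.isEquivalence ≺.<-resp-≈ ≺.trans

  <-irrefl : ∀ {w} → w ≮ w
  <-irrefl = Lex.<-irreflexive ≺.irrefl (Pointwise.refl ≡.refl)

  <-asym : ∀ {u v} → u < v → v ≮ u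
  <-asym u<v v<u = <-irrefl (<-trans u<v v<u)

  <-cmp : ∀ u v → Tri (u < v) (u ≡ v) (v < u)
  <-cmp u v with Lex.<-compare ≡.sym ≺.compare u v
  ... | tri< a ¬b ¬c = tri< a (λ { ≡.refl → <-irrefl a }) ¬c
  ... | tri≈ ¬a b ¬c = tri≈ ¬a (Pointwise.Pointwise-≡⇒≡ b) ¬c
  ... | tri> ¬a ¬b c = tri> ¬a (λ { ≡.refl → <-irrefl c }) c

  _<?_ : ∀ u v → Dec (u < v)
  u <? v with <-cmp u v
  ... | tri< u<v _ _ = yes u<v
  ... | tri≈ u≮v _ _ = no u≮v
  ... | tri> u≮v _ _ = no u≮v

  _≟_ : DecidableEquality (List A)
  _≟_ = Listₚ.≡-dec ≺._≟_

  ≮∧<⇒< : ∀ {u v w} → v ≮ u → v < w → u < w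
  ≮∧<⇒< {u} {v} v≮u v<w with <-cmp u v
  ... | tri< u<v _ _    = <-trans u<v v<w
  ... | tri≈ _ ≡.refl _ = v<w
  ... | tri> _ _ v<u    = contradiction v<u v≮u

  <∧≮⇒< : ∀ {u v w} → u < v → w ≮ v → u < w
  <∧≮⇒< {u} {v} {w} u<v w≮v with <-cmp v w
  ... | tri< v<w _ _    = <-trans u<v v<w
  ... | tri≈ _ ≡.refl _ = u<v
  ... | tri> _ _ w<v    = contradiction w<v w≮v

  ++-monoʳ-< : ∀ u {v w} → v < w → u ++ v < u ++ w
  ++-monoʳ-< []      v<w = v<w
  ++-monoʳ-< (a ∷ u) v<w = Lex.next ≡.refl (++-monoʳ-< u v<w)

  ++-cancelˡ-< : ∀ u {v w} → u ++ v < u ++ w → v < w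
  ++-cancelˡ-< []      p              = p
  ++-cancelˡ-< (a ∷ u) (Lex.this a≺a) = contradiction a≺a (≺.irrefl ≡.refl)
  ++-cancelˡ-< (a ∷ u) (Lex.next _ p) = ++-cancelˡ-< u p

  u<u++a∷v : ∀ u {a v} → u < u ++ a ∷ v
  u<u++a∷v []      = Lex.halt
  u<u++a∷v (a ∷ u) = Lex.next ≡.refl (u<u++a∷v u)

  v++u≮v : ∀ v u → v ++ u ≮ v
  v++u≮v []      u       v++u<v              = Lex.xs≮[] v++u<v
  v++u≮v (a ∷ v) u       (Lex.this a≺a)      = ≺.irrefl ≡.refl a≺a
  v++u≮v (a ∷ v) u       (Lex.next _ v++u<v) = v++u≮v v u v++u<v

  -- Either a letter decides, and the comparison survives any continuation of both words, or `u` is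
  -- a proper prefix of `v`. The prefix case is the one that calls for a Lyndon property, a
  -- minimality or a comparison of lengths.
  <-cases : ∀ {u v} → u < v → (∀ x y → u ++ x < v ++ y) ⊎ ∃[ a ] ∃[ r ] v ≡ u ++ a ∷ r
  <-cases Lex.halt             = inj₂ (_ , _ , ≡.refl)
  <-cases (Lex.this a≺b)       = inj₁ λ _ _ → Lex.this a≺b
  <-cases (Lex.next ≡.refl p) with <-cases p
  ... | inj₁ differ            = inj₁ λ x y → Lex.next ≡.refl (differ x y)
  ... | inj₂ (b , r , ≡.refl)  = inj₂ (b , r , ≡.refl)

  module _ (≺-wf : ∀ a → Acc _≺_ a) where

    -- Without the bound on the length the order is not well founded:
    -- b > ab > aab > ….
    Below : ℕ → Rel (List A) Level.zero
    Below n u v = u < v × length u ℕ.≤ n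

    private
      []-acc : ∀ n → Acc (Below n) []
      []-acc n = acc λ { (Lex.base () , _) }

    mutual
      -- Induction on the length bound, and for each bound on the first letter and then on the tail.
      -- When the first letter drops, the tail may become any word, whose accessibility comes from
      -- the smaller bound.
      <-acc : ∀ n w → Acc (Below n) w
      <-acc n       []      = []-acc n
      <-acc zero    (a ∷ w) = acc λ { {[]} _ → []-acc zero ; {_ ∷ _} (_ , ()) }
      <-acc (suc n) (a ∷ w) = ∷-acc n (≺-wf a) (<-acc n w)

      ∷-acc : ∀ n {a w} → Acc _≺_ a → Acc (Below n) w → Acc (Below (suc n)) (a ∷ w)
      ∷-acc n p q = acc (∷-below n p q)

      ∷-below : ∀ n {a w v} → Acc _≺_ a → Acc (Below n) w →
                Below (suc n) v (a ∷ w) → Acc (Below (suc n)) v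
      ∷-below n {v = []}    _        _        _                           = []-acc (suc n)
      ∷-below n {v = b ∷ v} (acc rs) _        (Lex.this b≺a , _)          =
        ∷-acc n (rs b≺a) (<-acc n v)
      ∷-below n {v = b ∷ v} p        (acc rs) (Lex.next ≡.refl q , s≤s v≤) =
        ∷-acc n p (rs (q , v≤))

  -- The empty suffix is left out: it is smaller than every nonempty word, so no word could be
  -- Lyndon if it took part in the comparison.
  suffixes : List A → List (List A)
  suffixes []      = []
  suffixes (a ∷ w) = (a ∷ w) ∷ suffixes w

  properSuffixes : List A → List (List A)
  properSuffixes []      = []
  properSuffixes (a ∷ w) = suffixes w

  suffixes-++ : ∀ u v → suffixes (u ++ v) ≡ map (_++ v) (suffixes u) ++ suffixes v
  suffixes-++ []      v = ≡.refl
  suffixes-++ (a ∷ u) v = ≡.cong ((a ∷ u ++ v) ∷_) (suffixes-++ u v)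

  ∈-suffixes⁺ : ∀ u {a v} → a ∷ v ∈ suffixes (u ++ a ∷ v)
  ∈-suffixes⁺ []      = here ≡.refl
  ∈-suffixes⁺ (_ ∷ u) = there (∈-suffixes⁺ u)

  ∈-suffixes⁻ : ∀ {w s} → s ∈ suffixes w → ∃[ u ] ∃[ a ] ∃[ v ] s ≡ a ∷ v × w ≡ u ++ s
  ∈-suffixes⁻ {a ∷ w} (here ≡.refl) = [] , _ , _ , ≡.refl , ≡.refl
  ∈-suffixes⁻ {a ∷ w} (there s∈) with u , b , v , s≡ , w≡ ← ∈-suffixes⁻ s∈ =
    a ∷ u , b , v , s≡ , ≡.cong (a ∷_) w≡

  suffix-length : ∀ {w s} → s ∈ suffixes w → length s ℕ.≤ length w
  suffix-length {a ∷ w} (here ≡.refl) = ℕₚ.≤-refl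
  suffix-length {a ∷ w} (there s∈)    = ℕₚ.m≤n⇒m≤1+n (suffix-length s∈)

  properSuffix≢ : ∀ {w s} → s ∈ properSuffixes w → w ≢ s
  properSuffix≢ {a ∷ w} s∈ ≡.refl = ℕₚ.<-irrefl ≡.refl (suffix-length s∈)

  data Lyndon : Pred (List A) Level.zero where
    lyndon : ∀ {a w} → All (a ∷ w <_) (suffixes w) → Lyndon (a ∷ w)

  lyndon⁻ : ∀ {a w} → Lyndon (a ∷ w) → All (a ∷ w <_) (suffixes w)
  lyndon⁻ (lyndon w<) = w<

  Lyndon⇒nonZero : ∀ {w} → Lyndon w → NonZero (length w)
  Lyndon⇒nonZero (lyndon _) = _

  ¬square-Lyndon : ∀ {u} → u ≢ [] → ¬ Lyndon (u ++ u)
  ¬square-Lyndon {[]}    u≢[] _        = u≢[] ≡.refl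
  ¬square-Lyndon {a ∷ u} _    uu-lyn   =
    v++u≮v (a ∷ u) (a ∷ u) (All.lookup (lyndon⁻ uu-lyn) (∈-suffixes⁺ u))

  lyndon? : Decidable Lyndon
  lyndon? []      = no λ ()
  lyndon? (a ∷ w) = map′ lyndon lyndon⁻ (All.all? ((a ∷ w) <?_) (suffixes w))

  Lyndon⇒< : ∀ {w} u {b v} → Lyndon w → w ≡ u ++ b ∷ v → u ≢ [] → w < b ∷ v
  Lyndon⇒< []      _           _      u≢[] = contradiction ≡.refl u≢[]
  Lyndon⇒< (_ ∷ u) (lyndon w<) ≡.refl _    = All.lookup w< (∈-suffixes⁺ u)

  -- The standard bracketing of a Lyndon word: the last condition makes v the
  -- smallest proper suffix of u ++ v (node-min).
  data LyndonTree : Pred (List A) Level.zero where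
    leaf : ∀ a → LyndonTree (a ∷ [])
    node : ∀ {u v} → LyndonTree u → LyndonTree v → u < v →
           All (_≮ v) (properSuffixes u) → LyndonTree (u ++ v)

  tree≢[] : ∀ {w} → LyndonTree w → w ≢ []
  tree≢[] (node {[]} t _ _ _) _  = tree≢[] t ≡.refl
  tree≢[] (node {_ ∷ _} _ _ _ _) ()

  -- If `u` is a proper prefix of `v`, say `v ≡ u ++ r`, then v < r because `v` is Lyndon, and `u`
  -- can be put in front of both.
  ++<ʳ : ∀ {u v} → Lyndon v → u ≢ [] → u < v → u ++ v < v
  ++<ʳ {u} {v} v-lyn u≢[] u<v with <-cases u<v
  ... | inj₁ differ     = ≡.subst (u ++ v <_) (Listₚ.++-identityʳ v) (differ v [])
  ... | inj₂ (a , r , ≡.refl) = ++-monoʳ-< u (Lyndon⇒< u v-lyn ≡.refl u≢[])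

  -- In the prefix case `v ≡ u ++ r` one has u < v < r. This keeps squares inside the bound `_< v`
  -- of the spanning induction.
  square< : ∀ {u v} → Lyndon v → u ≢ [] → u < v → u ++ u < v
  square< {u} {v} v-lyn u≢[] u<v with <-cases u<v
  ... | inj₁ differ     = ≡.subst (u ++ u <_) (Listₚ.++-identityʳ v) (differ u [])
  ... | inj₂ (a , r , ≡.refl) = ++-monoʳ-< u (<-trans u<v (Lyndon⇒< u v-lyn ≡.refl u≢[]))

  -- A proper suffix is `s ++ v` with `s` a proper suffix of `u`, or it is a suffix of `v`. For the
  -- former, u < s is decided by a letter, since `s` is too short to have `u` as a prefix; the
  -- latter are all at least `v`, which is above `u ++ v`.
  Lyndon-++ : ∀ {u v} → Lyndon u → Lyndon v → u < v → Lyndon (u ++ v)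
  Lyndon-++ {a ∷ u} {v@(_ ∷ _)} (lyndon u<) v-lyn@(lyndon v<) u<v = lyndon
    (≡.subst (All (_ <_)) (≡.sym (suffixes-++ u v)) (Allₚ.++⁺
      (Allₚ.map⁺ (All.tabulate λ {s} s∈ → extend (All.lookup u< s∈) (suffix-length s∈)))
      (uv<v ∷ All.map (<-trans uv<v) v<)))
    where
    uv<v : a ∷ u ++ v < v
    uv<v = ++<ʳ v-lyn (λ ()) u<v
    extend : ∀ {s} → a ∷ u < s → length s ℕ.≤ length u → a ∷ u ++ v < s ++ v
    extend {s} u<s s≤u with <-cases u<s
    ... | inj₁ differ           = differ v v
    ... | inj₂ (b , r , ≡.refl) = contradiction
      (ℕₚ.≤-trans (≡.subst (suc (length u) ℕ.≤_) (≡.sym (Listₚ.length-++ (a ∷ u)))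
        (ℕₚ.m≤m+n _ _)) s≤u) (ℕₚ.<-irrefl ≡.refl)

  LyndonTree⇒Lyndon : ∀ {w} → LyndonTree w → Lyndon w
  LyndonTree⇒Lyndon (leaf a)           = lyndon []
  LyndonTree⇒Lyndon (node tᵤ tᵥ u<v _) =
    Lyndon-++ (LyndonTree⇒Lyndon tᵤ) (LyndonTree⇒Lyndon tᵥ) u<v

  -- A suffix `s ++ v` below `v` would force s < v, since `s` is at most `s ++ v`.
  node-min : ∀ {u v} → u ≢ [] → Lyndon v → All (_≮ v) (properSuffixes u) →
             v ∈ properSuffixes (u ++ v) × All (_≮ v) (properSuffixes (u ++ v))
  node-min {[]}    u≢[] _ _ = contradiction ≡.refl u≢[]
  node-min {a ∷ u} {v@(_ ∷ _)} _ (lyndon v<) ≮v = ∈-suffixes⁺ u ,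
    ≡.subst (All _) (≡.sym (suffixes-++ u v)) (Allₚ.++⁺
      (Allₚ.map⁺ (All.map (λ {s} s≮v sv<v → s≮v (≮∧<⇒< (v++u≮v s v) sv<v)) ≮v))
      (<-irrefl ∷ All.map <-asym v<))

  -- As `u₂` is the smallest proper suffix of `u₁ ++ u₂`, comparing it with `v` decides whether a
  -- further factor `v` gives a standard tree; where this fails, the Jacobi identity takes over.
  node-cond : ∀ {u₁ u₂ v} → u₁ ≢ [] → Lyndon u₂ → All (_≮ u₂) (properSuffixes u₁) → u₂ ≮ v →
              All (_≮ v) (properSuffixes (u₁ ++ u₂))
  node-cond u₁≢[] u₂-lyn ≮u₂ u₂≮v = All.map (λ s≮u₂ s<v → s≮u₂ (<∧≮⇒< s<v u₂≮v))
    (proj₂ (node-min u₁≢[] u₂-lyn ≮u₂))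

  -- The right factor is recovered from the word as its smallest proper suffix.
  node-unique : ∀ {u v u′ v′} → u ≢ [] → u′ ≢ [] → Lyndon v → Lyndon v′ →
                All (_≮ v) (properSuffixes u) → All (_≮ v′) (properSuffixes u′) →
                u ++ v ≡ u′ ++ v′ → u ≡ u′ × v ≡ v′
  node-unique {u} {v} {u′} {v′} u≢[] u′≢[] v-lyn v′-lyn ≮v ≮v′ uv≡u′v′
    with v∈ , v-min ← node-min u≢[] v-lyn ≮v
       | v′∈ , v′-min ← node-min u′≢[] v′-lyn ≮v′
    with <-cmp v v′
  ... | tri< v<v′ _ _ = contradiction v<v′
    (All.lookup v′-min (≡.subst (λ w → v ∈ properSuffixes w) uv≡u′v′ v∈))
  ... | tri> _ _ v′<v = contradiction v′<v
    (All.lookup v-min (≡.subst (λ w → v′ ∈ properSuffixes w) (≡.sym uv≡u′v′) v′∈))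
  ... | tri≈ _ ≡.refl _ = Listₚ.++-cancelʳ v u u′ uv≡u′v′ , ≡.refl

  smallestSuffix : ∀ a w → ∃[ u ] ∃[ b ] ∃[ v ]
    a ∷ w ≡ u ++ b ∷ v × All (_≮ b ∷ v) (suffixes (a ∷ w))
  smallestSuffix a []      = [] , a , [] , ≡.refl , <-irrefl ∷ []
  smallestSuffix a (c ∷ w) with u , b , v , cw≡ , min ← smallestSuffix c w
    with (a ∷ c ∷ w) <? (b ∷ v)
  ... | yes aw<bv = [] , a , c ∷ w , ≡.refl ,
    <-irrefl ∷ All.map (λ s≮bv s<aw → s≮bv (<-trans s<aw aw<bv)) min
  ... | no aw≮bv  = a ∷ u , b , v , ≡.cong (a ∷_) cw≡ , aw≮bv ∷ min

  module Factorisation {a u b v} (uv-lyn : Lyndon (a ∷ u ++ b ∷ v))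
                       (min : All (_≮ b ∷ v) (suffixes (u ++ b ∷ v))) where

    private
      mins : All (_≮ b ∷ v) (map (_++ b ∷ v) (suffixes u)) × All (_≮ b ∷ v) (suffixes (b ∷ v))
      mins = Allₚ.++⁻ _ (≡.subst (All _) (suffixes-++ u (b ∷ v)) min)

    -- A proper suffix of `b ∷ v` is also a proper suffix of the whole word, hence not below the
    -- smallest one, and its length rules out equality.
    right-lyndon : Lyndon (b ∷ v)
    right-lyndon with _ , (_ ∷ ≮bv) ← mins = lyndon (All.tabulate λ {s} s∈ →
      case <-cmp (b ∷ v) s of λ where
        (tri< bv<s _ _) → bv<s
        (tri≈ _ bv≡s _) → contradiction bv≡s (properSuffix≢ {b ∷ v} s∈)
        (tri> _ _ s<bv) → contradiction s<bv (All.lookup ≮bv s∈))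

    -- Let a suffix `s` of `u` be below `a ∷ u`. If a letter decides, appending `b ∷ v` to both
    -- contradicts the Lyndon property of the whole word. If `a ∷ u` is `s ++ c ∷ r`, cancelling `s`
    -- in that property puts `c ∷ r ++ b ∷ v` below the smallest suffix.
    left-lyndon : Lyndon (a ∷ u)
    left-lyndon = lyndon (All.tabulate λ {s} s∈ → case <-cmp (a ∷ u) s of λ where
        (tri< au<s _ _) → au<s
        (tri≈ _ au≡s _) → contradiction au≡s (properSuffix≢ {a ∷ u} s∈)
        (tri> _ _ s<au) → contradiction s<au (s≮au s∈))
      where
      s≮au : ∀ {s} → s ∈ suffixes u → s ≮ a ∷ u
      s≮au {s} s∈ s<au
        with uv<sv ← All.lookup (Allₚ.map⁻ (Allₚ.++⁻ˡ _
               (≡.subst (All _) (suffixes-++ u (b ∷ v)) (lyndon⁻ uv-lyn)))) s∈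
        with <-cases s<au
      ... | inj₁ differ = <-asym uv<sv (differ (b ∷ v) (b ∷ v))
      ... | inj₂ (c , r , au≡sr) = All.lookup (Allₚ.map⁻ (proj₁ mins)) r∈
        (++-cancelˡ-< s (≡.subst (_< s ++ b ∷ v)
          (≡.trans (≡.cong (_++ b ∷ v) au≡sr) (Listₚ.++-assoc s (c ∷ r) (b ∷ v))) uv<sv))
        where
        r∈ : c ∷ r ∈ suffixes u
        r∈ with ∈-suffixes⁻ s∈
        ... | _ , d , s′ , ≡.refl , _ = ≡.subst (λ w → c ∷ r ∈ suffixes w)
          (≡.sym (Listₚ.∷-injectiveʳ au≡sr)) (∈-suffixes⁺ s′)

    left<right : a ∷ u < b ∷ v
    left<right = <-trans (u<u++a∷v (a ∷ u)) (Lyndon⇒< (a ∷ u) uv-lyn ≡.refl λ ())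

    -- If s < b v, then `s ++ b ∷ v` would be below `b ∷ v` too, against minimality; when `s` is a
    -- prefix of `b ∷ v` this uses that `b ∷ v` is Lyndon.
    standard : All (_≮ b ∷ v) (suffixes u)
    standard = All.tabulate λ {s} s∈ s<bv → case <-cases s<bv of λ where
      (inj₁ differ)             → All.lookup (Allₚ.map⁻ (proj₁ mins)) s∈
        (≡.subst (s ++ b ∷ v <_) (Listₚ.++-identityʳ _) (differ (b ∷ v) []))
      (inj₂ (c , r , bv≡sr)) → All.lookup (Allₚ.map⁻ (proj₁ mins)) s∈
        (≡.subst (s ++ b ∷ v <_) (≡.sym bv≡sr) (++-monoʳ-< s
          (Lyndon⇒< s right-lyndon bv≡sr λ { ≡.refl →
            case ∈-suffixes⁻ s∈ of λ { (_ , _ , _ , () , _) } })))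

  Lyndon⇒LyndonTree : ∀ {w} → Lyndon w → LyndonTree w
  Lyndon⇒LyndonTree {w} = go w (<-wellFounded (length w))
    where
    go : ∀ w → Acc ℕ._<_ (length w) → Lyndon w → LyndonTree w
    go (a ∷ [])    _         _ = leaf a
    go (a ∷ c ∷ w) (acc rec) w-lyn with u , b , v , cw≡uv , min ← smallestSuffix c w =
      ≡.subst LyndonTree (≡.sym (≡.cong (a ∷_) cw≡uv)) (node
        (go (a ∷ u) (rec (≡.subst (suc (length (a ∷ u)) ℕ.≤_) (≡.sym length≡) left)) left-lyndon)
        (go (b ∷ v) (rec (≡.subst (suc (length (b ∷ v)) ℕ.≤_) (≡.sym length≡) right)) right-lyndon)
        left<right standard)
      where
      open Factorisation {a} {u} {b} {v} (≡.subst Lyndon (≡.cong (a ∷_) cw≡uv) w-lyn)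
        (≡.subst (λ x → All (_≮ b ∷ v) (suffixes x)) cw≡uv min)
      length≡ : length (a ∷ c ∷ w) ≡ length (a ∷ u) + length (b ∷ v)
      length≡ = ≡.trans (≡.cong (suc ∘ length) cw≡uv) (Listₚ.length-++ (a ∷ u))
      left : suc (length (a ∷ u)) ℕ.≤ length (a ∷ u) + length (b ∷ v)
      left = ℕₚ.m<m+n (length (a ∷ u)) (s≤s z≤n)
      right : suc (length (b ∷ v)) ℕ.≤ length (a ∷ u) + length (b ∷ v)
      right = ℕₚ.m<n+m (length (b ∷ v)) (s≤s z≤n)

  open Rotation {A}

  -- Cutting `w` into `u ++ b ∷ v`, the rotation is `b ∷ v ++ u`, which is at least the suffix
  -- `b ∷ v`, and this is above `w`.
  Lyndon⇒<rotate : ∀ {w r} → Lyndon w → 0 ℕ.< r → r ℕ.< length w → w < rotate r w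
  Lyndon⇒<rotate {w} {r} w-lyn 0<r r<w
    with List.take r w in take≡ | List.drop r w in drop≡ | Listₚ.take++drop≡id r w
       | rotate-split r w (ℕₚ.<⇒≤ r<w)
  ... | u | []    | _      | _ = contradiction
    (≡.trans (≡.sym (Listₚ.length-drop r w)) (≡.cong length drop≡)) (ℕₚ.m>n⇒m∸n≢0 r<w)
  ... | u | b ∷ v | uv≡w   | rotate≡ = ≡.subst (w <_) (≡.sym rotate≡)
    (<∧≮⇒< (Lyndon⇒< u w-lyn (≡.sym uv≡w) u≢[]) (v++u≮v (b ∷ v) u))
    where
    u≢[] : u ≢ []
    u≢[] ≡.refl = ℕₚ.<⇒≢ 0<r (≡.trans (≡.cong length (≡.sym take≡))
      (≡.trans (Listₚ.length-take r w) (ℕₚ.m≤n⇒m⊓n≡m (ℕₚ.<⇒≤ r<w))))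

  -- Write the word as `U ++ s` and suppose that `s` is smaller. If a letter decides, the rotation
  -- `s ++ U` lies below the word. Otherwise the word is also `s ++ T`; comparing it with `s ++ U`
  -- gives T < U, and comparing it with the rotation `T ++ s` gives U s < T s. As T and U have equal
  -- length, a letter decides T < U, and the two contradict each other.
  <rotate⇒Lyndon : ∀ {a w} → (∀ {r} → 0 ℕ.< r → r ℕ.≤ length w → a ∷ w < rotate r (a ∷ w)) →
                   Lyndon (a ∷ w)
  <rotate⇒Lyndon {a} {w} <rot = lyndon (All.tabulate λ s∈ → helper (∈-suffixes⁻ s∈))
    where
    helper : ∀ {s} → ∃[ u ] ∃[ b ] ∃[ v ] s ≡ b ∷ v × w ≡ u ++ s → a ∷ w < s
    helper {s} (u , b , v , ≡.refl , ≡.refl) with <-cmp (a ∷ w) s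
    ... | tri< w<s _ _ = w<s
    ... | tri≈ _ w≡s _ = contradiction w≡s (properSuffix≢ {a ∷ w} (∈-suffixes⁺ u))
    ... | tri> _ _ s<w = contradiction s<w (s≮w ∘ <-cases)
      where
      U = a ∷ u
      uv<vu : U ++ s < s ++ U
      uv<vu = ≡.subst (U ++ s <_) (rotate-++ U s) (<rot (s≤s z≤n)
        (≡.subst (suc (length u) ℕ.≤_) (≡.sym (Listₚ.length-++ u)) (ℕₚ.m<m+n (length u) (s≤s z≤n))))
      s≮w : ¬ ((∀ x y → s ++ x < (a ∷ w) ++ y) ⊎ ∃[ c ] ∃[ t ] a ∷ w ≡ s ++ c ∷ t)
      s≮w (inj₁ differ) = <-asym uv<vu (≡.subst (s ++ U <_) (Listₚ.++-identityʳ _) (differ U []))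
      s≮w (inj₂ (c , t , w≡st)) = T≮U (<-cases T<U)
        where
        T = c ∷ t
        T<U : T < U
        T<U = ++-cancelˡ-< s (≡.subst (_< s ++ U) w≡st uv<vu)
        lengths : length s + length T ≡ length s + length U
        lengths = ≡.trans (≡.sym (Listₚ.length-++ s)) (≡.trans (≡.cong length (≡.sym w≡st))
          (≡.trans (Listₚ.length-++ U) (ℕₚ.+-comm (length U) (length s))))
        w<Ts : U ++ s < T ++ s
        w<Ts = ≡.subst (U ++ s <_) (≡.trans (≡.cong (rotate (length s)) w≡st) (rotate-++ s T))
          (<rot (s≤s z≤n) (≡.subst (suc (length v) ℕ.≤_) (≡.sym (Listₚ.length-++ u))
            (ℕₚ.m≤n+m (length s) (length u))))
        T≮U : ¬ ((∀ x y → T ++ x < U ++ y) ⊎ ∃[ c ] ∃[ r ] U ≡ T ++ c ∷ r)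
        T≮U (inj₁ differ)         = <-asym w<Ts (differ s s)
        T≮U (inj₂ (d , r , U≡Tr)) = ℕₚ.m≢1+m+n (length T) (≡.trans
          (ℕₚ.+-cancelˡ-≡ (length s) _ _ lengths) (≡.trans (≡.cong length U≡Tr)
            (≡.trans (Listₚ.length-++ T) (ℕₚ.+-suc (length T) (length r)))))

  Lyndon⇒primitive : ∀ {w r} → Lyndon w → 0 ℕ.< r → r ℕ.< length w → rotate r w ≢ w
  Lyndon⇒primitive {w} w-lyn 0<r r<w eq =
    <-irrefl (≡.subst (w <_) eq (Lyndon⇒<rotate w-lyn 0<r r<w))

  private
    Lyndon-rotation-≮ : ∀ {w r s} → r ℕ.< s → s ℕ.< length w →
      Lyndon (rotate r w) → ¬ Lyndon (rotate s w)
    Lyndon-rotation-≮ {w} {r} {s} r<s s<w r-lyn s-lyn = <-asym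
      (≡.subst (rotate r w <_) eq₁ (Lyndon⇒<rotate r-lyn (ℕₚ.m<n⇒0<n∸m r<s)
        (≡.subst (k ℕ.<_) (≡.sym (rotate-length r w)) k<w)))
      (≡.subst (rotate s w <_) eq₂ (Lyndon⇒<rotate s-lyn (ℕₚ.m<n⇒0<n∸m k<w)
        (≡.subst (length w ℕ.∸ k ℕ.<_) (≡.sym (rotate-length s w))
          (ℕₚ.∸-monoʳ-< (ℕₚ.m<n⇒0<n∸m r<s) (ℕₚ.<⇒≤ k<w)))))
      where
      k = s ℕ.∸ r
      k<w : k ℕ.< length w
      k<w = ℕₚ.≤-<-trans (ℕₚ.m∸n≤m s r) s<w
      eq₁ : rotate k (rotate r w) ≡ rotate s w
      eq₁ = ≡.trans (≡.sym (rotate-+ r k w)) (≡.cong (λ i → rotate i w) (ℕₚ.m+[n∸m]≡n (ℕₚ.<⇒≤ r<s)))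
      eq₂ : rotate (length w ℕ.∸ k) (rotate s w) ≡ rotate r w
      eq₂ = ≡.trans (≡.cong (rotate (length w ℕ.∸ k)) (≡.sym eq₁))
        (≡.trans (≡.sym (rotate-+ k _ (rotate r w)))
          (≡.trans (≡.cong (λ i → rotate i (rotate r w)) (≡.trans (ℕₚ.m+[n∸m]≡n (ℕₚ.<⇒≤ k<w))
              (≡.sym (rotate-length r w))))
            (rotate-full (rotate r w))))

  Lyndon-rotation-unique : ∀ {w r s} → r ℕ.< length w → s ℕ.< length w →
    Lyndon (rotate r w) → Lyndon (rotate s w) → r ≡ s
  Lyndon-rotation-unique {w} {r} {s} r<w s<w r-lyn s-lyn with ℕₚ.<-cmp r s
  ... | tri≈ _ r≡s _ = r≡s
  ... | tri< r<s _ _ = contradiction s-lyn (Lyndon-rotation-≮ r<s s<w r-lyn)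
  ... | tri> _ _ s<r = contradiction r-lyn (Lyndon-rotation-≮ s<r r<w s-lyn)

  private
    argmin : ∀ (f : ℕ → List A) n → ∃[ r ] r ℕ.≤ n × (∀ {s} → s ℕ.≤ n → f s ≮ f r)
    argmin f zero = 0 , z≤n , λ { z≤n → <-irrefl }
    argmin f (suc n) with r , r≤n , min ← argmin f n with f (suc n) <? f r
    ... | yes fn<fr = suc n , ℕₚ.≤-refl , λ {s} s≤ → case ℕₚ.m≤n⇒m<n∨m≡n s≤ of λ where
      (inj₁ (s≤s s≤n)) fs<fn → min s≤n (<-trans fs<fn fn<fr)
      (inj₂ ≡.refl)          → <-irrefl
    ... | no fn≮fr  = r , ℕₚ.m≤n⇒m≤1+n r≤n , λ {s} s≤ → case ℕₚ.m≤n⇒m<n∨m≡n s≤ of λ where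
      (inj₁ (s≤s s≤n)) → min s≤n
      (inj₂ ≡.refl)    → fn≮fr

  -- The smallest rotation is Lyndon: as `w` is aperiodic, no other rotation ties with it.
  Lyndon-rotation-exists : ∀ {w} → w ≢ [] → (∀ {r} → 0 ℕ.< r → r ℕ.< length w → rotate r w ≢ w) →
    ∃[ r ] r ℕ.< length w × Lyndon (rotate r w)
  Lyndon-rotation-exists {[]}    w≢[] _ = contradiction ≡.refl w≢[]
  Lyndon-rotation-exists {w@(a ∷ v)} _ w-prim
    with r , r≤v , min ← argmin (λ r → rotate r w) (length v) =
    r , s≤s r≤v , lyn (rotate r w) ≡.refl (rotate-length r w)
    where
    lyn : ∀ z → z ≡ rotate r w → length z ≡ suc (length v) → Lyndon z
    lyn (b ∷ z) z≡ l≡ = <rotate⇒Lyndon λ {k} 0<k k≤z →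
      ≡.subst (λ x → x < rotate k x) (≡.sym z≡) (smaller k 0<k
        (≡.subst (k ℕ.<_) l≡ (s≤s k≤z)))
      where
      smaller : ∀ k → 0 ℕ.< k → k ℕ.< suc (length v) → rotate r w < rotate k (rotate r w)
      smaller k 0<k k<w with <-cmp (rotate r w) (rotate k (rotate r w))
      ... | tri< z<kz _ _ = z<kz
      ... | tri≈ _ z≡kz _ = contradiction (rotate-conj k r w (≡.sym z≡kz)) (w-prim 0<k k<w)
      -- The shift `r + k` can exceed the length; reduced modulo the length, it falls into the range
      -- of `argmin`.
      ... | tri> _ _ kz<z = contradiction (≡.subst (_< rotate r w) (≡.trans (≡.sym (rotate-+ r k w))
          (rotate-% (r + k) (length w) w (rotate-full w))) kz<z)
        (min (ℕₚ.<⇒≤pred (DivMod.m%n<n (r + k) (length w))))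

  module _ {w : List A} (mp : MinimalPeriod w) where

    open MinimalPeriod mp

    Lyndon⇒period≡length : ∀ {r} → Lyndon (rotate r w) → period ≡ length w
    Lyndon⇒period≡length {r} r-lyn with ℕₚ.m≤n⇒m<n∨m≡n (∣.∣⇒≤
      {{≡.subst NonZero (rotate-length r w) (Lyndon⇒nonZero r-lyn)}} (minimal (rotate-full w)))
    ... | inj₂ p≡w = p≡w
    ... | inj₁ p<w = contradiction
      (≡.trans (rotate-comm period r w) (≡.cong (rotate r) rotates))
      (Lyndon⇒primitive r-lyn (ℕ.>-nonZero⁻¹ period) (≡.subst (period ℕ.<_) (≡.sym (rotate-length r w)) p<w))

    Lyndon²⇒period≡length : ∀ {r u} → rotate r w ≡ u ++ u → Lyndon u → period ≡ length u
    Lyndon²⇒period≡length {r} {u} r≡uu u-lyn with ℕₚ.m≤n⇒m<n∨m≡n (∣.∣⇒≤ {{Lyndon⇒nonZero u-lyn}} (minimal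
        (rotate-conj (length u) r w (≡.trans (≡.cong (rotate (length u)) r≡uu)
          (≡.trans (rotate-++ u u) (≡.sym r≡uu))))))
    ... | inj₂ p≡u = p≡u
    ... | inj₁ p<u = contradiction
      (proj₁ (++-injective (rotate period u) u (rotate-length period u)
        (≡.trans (≡.sym (rotate-square period u)) (≡.trans (≡.cong (rotate period) (≡.sym r≡uu))
          (≡.trans (rotate-comm period r w) (≡.trans (≡.cong (rotate r) rotates) r≡uu))))))
      (Lyndon⇒primitive u-lyn (ℕ.>-nonZero⁻¹ period) p<u)

    period≡length⇒primitive : period ≡ length w → ∀ {r} → 0 ℕ.< r → r ℕ.< length w → rotate r w ≢ w
    period≡length⇒primitive p≡w {suc r} _ r<w eq =
      ℕₚ.<⇒≱ r<w (≡.subst (ℕ._≤ suc r) p≡w (∣.∣⇒≤ (minimal eq)))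

    period-half⇒primitive : ∀ {u} → w ≡ u ++ u → period ≡ length u →
      ∀ {r} → 0 ℕ.< r → r ℕ.< length u → rotate r u ≢ u
    period-half⇒primitive {u} ≡.refl p≡u {suc r} _ r<u eq =
      ℕₚ.<⇒≱ r<u (≡.subst (ℕ._≤ suc r) p≡u (∣.∣⇒≤ (minimal
        (≡.trans (rotate-square (suc r) u) (≡.cong₂ _++_ eq eq)))))


-- A well-founded total order on the letters.

module LetterOrder {N : ℕ} where

  private
    code : Parity × Fin N → ℕ
    code (0ℙ , i) = toℕ i
    code (1ℙ , i) = N ℕ.+ toℕ i

    code-injective : ∀ a b → code a ≡ code b → a ≡ b
    code-injective (0ℙ , i) (0ℙ , j) eq = ≡.cong (0ℙ ,_) (Finₚ.toℕ-injective eq)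
    code-injective (1ℙ , i) (1ℙ , j) eq =
      ≡.cong (1ℙ ,_) (Finₚ.toℕ-injective (ℕₚ.+-cancelˡ-≡ N _ _ eq))
    code-injective (0ℙ , i) (1ℙ , j) eq = contradiction
      (≡.subst (ℕ._< N) eq (Finₚ.toℕ<n i)) (ℕₚ.m+n≮m N (toℕ j))
    code-injective (1ℙ , i) (0ℙ , j) eq = contradiction
      (≡.subst (ℕ._< N) (≡.sym eq) (Finₚ.toℕ<n j)) (ℕₚ.m+n≮m N (toℕ i))

  _≺_ : Rel (Parity × Fin N) Level.zero
  a ≺ b = code a ℕ.< code b

  ≺-isStrictTotalOrder : IsStrictTotalOrder _≡_ _≺_
  ≺-isStrictTotalOrder = isStrictTotalOrderᶜ record
    { isEquivalence = ≡.isEquivalence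
    ; trans         = ℕₚ.<-trans
    ; compare       = λ a b → case ℕₚ.<-cmp (code a) (code b) of λ where
        (tri< a<b a≢b a≯b) → tri< a<b (a≢b ∘ ≡.cong code) a≯b
        (tri≈ a≮b a≡b a≯b) → tri≈ a≮b (code-injective a b a≡b) a≯b
        (tri> a≮b a≢b a>b) → tri> a≮b (a≢b ∘ ≡.cong code) a>b
    }

  ≺-acc : ∀ a → Acc _≺_ a
  ≺-acc = On.wellFounded code <-wellFounded

-- Super commutators in the tensor algebra: bilinearity, antisymmetry, Jacobi identity.

module SuperTensor {c ℓ₁ ℓ₂} (F : HeytingField c ℓ₁ ℓ₂) (N : ℕ) where

  open Field F
  open MöbiusSums F using (-‿involutive; -1*x≈-x; -‿distribʳ-*)
  open FreeLieSuperalgebra F N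
  open LyndonWords (LetterOrder.≺-isStrictTotalOrder {N})
  open SetoidReasoning setoid
  private
    module R = CommutativeRing commutativeRing
  open CommutativeSemigroupProperties R.+-commutativeSemigroup using (interchange)

  concat-cong : ∀ {f f′ g g′ : Word → Carrier} w → (∀ u → f u ≈ f′ u) → (∀ v → g v ≈ g′ v) →
                concat f g w ≈ concat f′ g′ w
  concat-cong []      f≈ g≈ = *-cong (f≈ []) (g≈ [])
  concat-cong (a ∷ w) f≈ g≈ =
    +-cong (*-cong (f≈ []) (g≈ (a ∷ w))) (concat-cong w (f≈ ∘ (a ∷_)) g≈)

  concat-+ˡ : ∀ f f′ g w → concat (λ u → f u + f′ u) g w ≈ concat f g w + concat f′ g w
  concat-+ˡ f f′ g []      = distribʳ _ _ _
  concat-+ˡ f f′ g (a ∷ w) =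
    trans (+-cong (distribʳ _ _ _) (concat-+ˡ (f ∘ (a ∷_)) (f′ ∘ (a ∷_)) g w)) (interchange _ _ _ _)

  concat-+ʳ : ∀ f g g′ w → concat f (λ v → g v + g′ v) w ≈ concat f g w + concat f g′ w
  concat-+ʳ f g g′ []      = distribˡ _ _ _
  concat-+ʳ f g g′ (a ∷ w) =
    trans (+-cong (distribˡ _ _ _) (concat-+ʳ (f ∘ (a ∷_)) g g′ w)) (interchange _ _ _ _)

  concat-*ˡ : ∀ k f g w → concat (λ u → k * f u) g w ≈ k * concat f g w
  concat-*ˡ k f g []      = *-assoc _ _ _
  concat-*ˡ k f g (a ∷ w) =
    trans (+-cong (*-assoc _ _ _) (concat-*ˡ k (f ∘ (a ∷_)) g w)) (sym (distribˡ _ _ _))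

  concat-*ʳ : ∀ k f g w → concat f (λ v → k * g v) w ≈ k * concat f g w
  concat-*ʳ k f g []      = x∙yz≈y∙xz _ _ _
    where open CommutativeSemigroupProperties R.*-commutativeSemigroup
  concat-*ʳ k f g (a ∷ w) =
    trans (+-cong (x∙yz≈y∙xz _ _ _) (concat-*ʳ k (f ∘ (a ∷_)) g w)) (sym (distribˡ _ _ _))
    where open CommutativeSemigroupProperties R.*-commutativeSemigroup

  concat-assoc : ∀ f g h w → concat (concat f g) h w ≈ concat f (concat g h) w
  concat-assoc f g h []      = *-assoc _ _ _
  concat-assoc f g h (a ∷ w) = begin
    f [] * g [] * h (a ∷ w) + concat (λ u → f [] * g (a ∷ u) + concat fₐ g u) h w
      ≈⟨ +-cong (*-assoc _ _ _) (trans (concat-+ˡ _ _ h w)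
           (+-cong (concat-*ˡ _ _ h w) (concat-assoc fₐ g h w))) ⟩
    f [] * (g [] * h (a ∷ w)) + (f [] * concat gₐ h w + concat fₐ (concat g h) w)
      ≈⟨ +-assoc _ _ _ ⟨
    f [] * (g [] * h (a ∷ w)) + f [] * concat gₐ h w + concat fₐ (concat g h) w
      ≈⟨ +-congʳ (distribˡ _ _ _) ⟨
    f [] * (g [] * h (a ∷ w) + concat gₐ h w) + concat fₐ (concat g h) w ∎
    where
    fₐ gₐ : Word → Carrier
    fₐ u = f (a ∷ u)
    gₐ u = g (a ∷ u)

  concat-zero : ∀ f g w → (∀ u v → u ++ v ≡ w → f u * g v ≈ 0#) → concat f g w ≈ 0#
  concat-zero f g []      fg≈0 = fg≈0 [] [] ≡.refl
  concat-zero f g (a ∷ w) fg≈0 = trans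
    (+-cong (fg≈0 [] (a ∷ w) ≡.refl)
            (concat-zero (f ∘ (a ∷_)) g w (λ u v eq → fg≈0 (a ∷ u) v (≡.cong (a ∷_) eq))))
    (+-identityˡ _)

  concat-single : ∀ f g u v →
    (∀ u′ v′ → u′ ++ v′ ≡ u ++ v → u′ ≢ u → f u′ * g v′ ≈ 0#) →
    concat f g (u ++ v) ≈ f u * g v
  concat-single f g []      []      fg≈0 = refl
  concat-single f g []      (a ∷ v) fg≈0 = trans
    (+-congˡ (concat-zero (f ∘ (a ∷_)) g v λ u′ v′ eq →
      fg≈0 (a ∷ u′) v′ (≡.cong (a ∷_) eq) λ ()))
    (+-identityʳ _)
  concat-single f g (a ∷ u) v       fg≈0 = trans
    (+-cong (fg≈0 [] (a ∷ u ++ v) ≡.refl λ ())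
            (concat-single (f ∘ (a ∷_)) g u v λ u′ v′ eq u′≢u →
              fg≈0 (a ∷ u′) v′ (≡.cong (a ∷_) eq) (u′≢u ∘ Listₚ.∷-injectiveʳ)))
    (+-identityˡ _)

  ⊗-assoc : ∀ x y z → (x ⊗ y) ⊗ z ≈ᵀ x ⊗ (y ⊗ z)
  ⊗-assoc x y z = concat-assoc (coeff x) (coeff y) (coeff z)

  -- The bracket is a sum of four signed combinations of products of parity components. Bilinearity
  -- as a property closed under these constructions reaches it without expanding its coefficients.
  record Bilinear (B : Tensor → Tensor → Tensor) : Set (c ⊔ ℓ₁) where
    field
      cong : ∀ {x x′ y y′} → x ≈ᵀ x′ → y ≈ᵀ y′ → B x y ≈ᵀ B x′ y′
      +ˡ   : ∀ x x′ y → B (x +ᵀ x′) y ≈ᵀ B x y +ᵀ B x′ y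
      +ʳ   : ∀ x y y′ → B x (y +ᵀ y′) ≈ᵀ B x y +ᵀ B x y′
      *ˡ   : ∀ k x y → B (k *ₗᵀ x) y ≈ᵀ k *ₗᵀ B x y
      *ʳ   : ∀ k x y → B x (k *ₗᵀ y) ≈ᵀ k *ₗᵀ B x y

    0ˡ : ∀ {x} y → x ≈ᵀ 0ᵀ → B x y ≈ᵀ 0ᵀ
    0ˡ {x} y x≈0 w = trans (cong {x′ = 0# *ₗᵀ x} (λ v → trans (x≈0 v) (sym (zeroˡ _))) (λ _ → refl) w)
      (trans (*ˡ 0# x y w) (zeroˡ _))

    0ʳ : ∀ x {y} → y ≈ᵀ 0ᵀ → B x y ≈ᵀ 0ᵀ
    0ʳ x {y} y≈0 w = trans (cong {y′ = 0# *ₗᵀ y} (λ _ → refl) (λ v → trans (y≈0 v) (sym (zeroˡ _))) w)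
      (trans (*ʳ 0# x y w) (zeroˡ _))

  open Bilinear

  ⊗-bilinear : Bilinear _⊗_
  ⊗-bilinear = record
    { cong = λ x≈ y≈ w → concat-cong w x≈ y≈
    ; +ˡ   = λ x x′ y → concat-+ˡ (coeff x) (coeff x′) (coeff y)
    ; +ʳ   = λ x y y′ → concat-+ʳ (coeff x) (coeff y) (coeff y′)
    ; *ˡ   = λ k x y → concat-*ˡ k (coeff x) (coeff y)
    ; *ʳ   = λ k x y → concat-*ʳ k (coeff x) (coeff y)
    }

  private
    +-bilinear : ∀ {B B′} → Bilinear B → Bilinear B′ → Bilinear (λ x y → B x y +ᵀ B′ x y)
    +-bilinear b b′ = record
      { cong = λ x≈ y≈ w → +-cong (cong b x≈ y≈ w) (cong b′ x≈ y≈ w)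
      ; +ˡ   = λ x x′ y w → trans (+-cong (+ˡ b x x′ y w) (+ˡ b′ x x′ y w)) (interchange _ _ _ _)
      ; +ʳ   = λ x y y′ w → trans (+-cong (+ʳ b x y y′ w) (+ʳ b′ x y y′ w)) (interchange _ _ _ _)
      ; *ˡ   = λ k x y w → trans (+-cong (*ˡ b k x y w) (*ˡ b′ k x y w)) (sym (distribˡ _ _ _))
      ; *ʳ   = λ k x y w → trans (+-cong (*ʳ b k x y w) (*ʳ b′ k x y w)) (sym (distribˡ _ _ _))
      }

    *-bilinear : ∀ {B} k → Bilinear B → Bilinear (λ x y → k *ₗᵀ B x y)
    *-bilinear k b = record
      { cong = λ x≈ y≈ w → *-congˡ (cong b x≈ y≈ w)
      ; +ˡ   = λ x x′ y w → trans (*-congˡ (+ˡ b x x′ y w)) (distribˡ _ _ _)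
      ; +ʳ   = λ x y y′ w → trans (*-congˡ (+ʳ b x y y′ w)) (distribˡ _ _ _)
      ; *ˡ   = λ l x y w → trans (*-congˡ (*ˡ b l x y w)) (x∙yz≈y∙xz _ _ _)
      ; *ʳ   = λ l x y w → trans (*-congˡ (*ʳ b l x y w)) (x∙yz≈y∙xz _ _ _)
      }
      where open CommutativeSemigroupProperties R.*-commutativeSemigroup

    -‿bilinear : ∀ {B} → Bilinear B → Bilinear (λ x y → -ᵀ B x y)
    -‿bilinear b = record
      { cong = λ x≈ y≈ w → -‿cong (cong b x≈ y≈ w)
      ; +ˡ   = λ x x′ y w → trans (-‿cong (+ˡ b x x′ y w)) (sym (⁻¹-∙-comm _ _))
      ; +ʳ   = λ x y y′ w → trans (-‿cong (+ʳ b x y y′ w)) (sym (⁻¹-∙-comm _ _))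
      ; *ˡ   = λ k x y w → trans (-‿cong (*ˡ b k x y w)) (-‿distribʳ-* _ _)
      ; *ʳ   = λ k x y w → trans (-‿cong (*ʳ b k x y w)) (-‿distribʳ-* _ _)
      }
      where open AbelianGroupProperties R.+-abelianGroup

    flip-bilinear : ∀ {B} → Bilinear B → Bilinear (λ x y → B y x)
    flip-bilinear b = record
      { cong = λ x≈ y≈ → cong b y≈ x≈
      ; +ˡ   = λ x x′ y → +ʳ b y x x′
      ; +ʳ   = λ x y y′ → +ˡ b y y′ x
      ; *ˡ   = λ k x y → *ʳ b k y x
      ; *ʳ   = λ k x y → *ˡ b k y x
      }

  homogeneousCommutator-bilinear : ∀ p q → Bilinear (homogeneousCommutator p q)
  homogeneousCommutator-bilinear p q = +-bilinear ⊗-bilinear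
    (-‿bilinear (*-bilinear (koszulSign p q) (flip-bilinear ⊗-bilinear)))

  private
    part-cong : ∀ p {x x′} → x ≈ᵀ x′ → homogeneousPart p x ≈ᵀ homogeneousPart p x′
    part-cong p x≈ w with parityOf w Parityₚ.≟ p
    ... | yes _ = x≈ w
    ... | no  _ = refl

    part-+ : ∀ p x x′ → homogeneousPart p (x +ᵀ x′) ≈ᵀ homogeneousPart p x +ᵀ homogeneousPart p x′
    part-+ p x x′ w with parityOf w Parityₚ.≟ p
    ... | yes _ = refl
    ... | no  _ = sym (+-identityˡ _)

    part-* : ∀ p k x → homogeneousPart p (k *ₗᵀ x) ≈ᵀ k *ₗᵀ homogeneousPart p x
    part-* p k x w with parityOf w Parityₚ.≟ p
    ... | yes _ = refl
    ... | no  _ = sym (zeroʳ _)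

    part-bilinear : ∀ {B} p q → Bilinear B →
                    Bilinear (λ x y → B (homogeneousPart p x) (homogeneousPart q y))
    part-bilinear {B} p q b = record
      { cong = λ {x} {x′} {y} {y′} x≈ y≈ → cong b (part-cong p {x} {x′} x≈) (part-cong q {y} {y′} y≈)
      ; +ˡ   = λ x x′ y w → trans (cong b (part-+ p x x′) (λ _ → refl) w) (+ˡ b _ _ _ w)
      ; +ʳ   = λ x y y′ w → trans (cong b (λ _ → refl) (part-+ q y y′) w) (+ʳ b _ _ _ w)
      ; *ˡ   = λ k x y w → trans (cong b (part-* p k x) (λ _ → refl) w) (*ˡ b k _ _ w)
      ; *ʳ   = λ k x y w → trans (cong b (λ _ → refl) (part-* q k y) w) (*ʳ b k _ _ w)
      }

  [,]-bilinear : Bilinear [_,_]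
  [,]-bilinear = +-bilinear (+-bilinear (+-bilinear (part 0ℙ 0ℙ) (part 0ℙ 1ℙ)) (part 1ℙ 0ℙ)) (part 1ℙ 1ℙ)
    where
    part : ∀ p q → Bilinear
      (λ x y → homogeneousCommutator p q (homogeneousPart p x) (homogeneousPart q y))
    part p q = part-bilinear p q (homogeneousCommutator-bilinear p q)

  Homogeneous : Parity → Pred Tensor ℓ₁
  Homogeneous p x = ∀ w → parityOf w ≢ p → coeff x w ≈ 0#

  private
    part-same : ∀ p x → Homogeneous p x → homogeneousPart p x ≈ᵀ x
    part-same p x x-hom w with parityOf w Parityₚ.≟ p
    ... | yes _  = refl
    ... | no  ≢p = sym (x-hom w ≢p)

    part-other : ∀ p q x → p ≢ q → Homogeneous p x → homogeneousPart q x ≈ᵀ 0ᵀ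
    part-other p q x p≢q x-hom w with parityOf w Parityₚ.≟ q
    ... | yes ≡q = x-hom w (λ ≡p → p≢q (≡.trans (≡.sym ≡p) ≡q))
    ... | no  _  = refl

  -- Of the four parity pairs summed in the bracket, the three others contain a vanishing component.
  [,]-homogeneous : ∀ p q {x y} → Homogeneous p x → Homogeneous q y →
                    [ x , y ] ≈ᵀ homogeneousCommutator p q x y
  [,]-homogeneous p q {x} {y} x-hom y-hom w = cases p q same otherˡ otherʳ
    where
    term : Parity → Parity → Carrier
    term p′ q′ = coeff (homogeneousCommutator p′ q′ (homogeneousPart p′ x) (homogeneousPart q′ y)) w
    same : term p q ≈ coeff (homogeneousCommutator p q x y) w
    same = cong (homogeneousCommutator-bilinear p q) {homogeneousPart p x} {x}
      {homogeneousPart q y} {y} (part-same p x x-hom) (part-same q y y-hom) w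
    otherˡ : ∀ p′ q′ → p ≢ p′ → term p′ q′ ≈ 0#
    otherˡ p′ q′ p≢p′ = 0ˡ (homogeneousCommutator-bilinear p′ q′)
      {homogeneousPart p′ x} (homogeneousPart q′ y) (part-other p p′ x p≢p′ x-hom) w
    otherʳ : ∀ p′ q′ → q ≢ q′ → term p′ q′ ≈ 0#
    otherʳ p′ q′ q≢q′ = 0ʳ (homogeneousCommutator-bilinear p′ q′)
      (homogeneousPart p′ x) {homogeneousPart q′ y} (part-other q q′ y q≢q′ y-hom) w
    cases : ∀ p q {t} → term p q ≈ t → (∀ p′ q′ → p ≢ p′ → term p′ q′ ≈ 0#) →
      (∀ p′ q′ → q ≢ q′ → term p′ q′ ≈ 0#) →
      term 0ℙ 0ℙ + term 0ℙ 1ℙ + term 1ℙ 0ℙ + term 1ℙ 1ℙ ≈ t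
    cases 0ℙ 0ℙ e l r = trans (+-cong (+-cong (+-cong e (r 0ℙ 1ℙ λ ())) (l 1ℙ 0ℙ λ ())) (l 1ℙ 1ℙ λ ()))
      (trans (+-identityʳ _) (trans (+-identityʳ _) (+-identityʳ _)))
    cases 0ℙ 1ℙ e l r = trans (+-cong (+-cong (+-cong (r 0ℙ 0ℙ λ ()) e) (l 1ℙ 0ℙ λ ())) (l 1ℙ 1ℙ λ ()))
      (trans (+-identityʳ _) (trans (+-identityʳ _) (+-identityˡ _)))
    cases 1ℙ 0ℙ e l r = trans (+-cong (+-cong (+-cong (l 0ℙ 0ℙ λ ()) (l 0ℙ 1ℙ λ ())) e) (r 1ℙ 1ℙ λ ()))
      (trans (+-identityʳ _) (trans (+-congʳ (+-identityˡ _)) (+-identityˡ _)))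
    cases 1ℙ 1ℙ e l r = trans (+-cong (+-cong (+-cong (l 0ℙ 0ℙ λ ()) (l 0ℙ 1ℙ λ ())) (r 1ℙ 0ℙ λ ())) e)
      (trans (+-congʳ (trans (+-identityʳ _) (+-identityˡ _))) (+-identityˡ _))

  count-++ : ∀ p u v → count p (u ++ v) ≡ count p u ℕ.+ count p v
  count-++ p u v = ≡.trans (≡.cong length (Listₚ.filter-++ _ u v)) (Listₚ.length-++ (filter _ u))

  parityOf-++ : ∀ u v → parityOf (u ++ v) ≡ parityOf u Parity.+ parityOf v
  parityOf-++ u v = ≡.trans (≡.cong ℕ.parity (count-++ 1ℙ u v)) (Parityₚ.+-homo-+ (count 1ℙ u) _)

  ⊗-homogeneous : ∀ p q x y → Homogeneous p x → Homogeneous q y →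
                  Homogeneous (p Parity.+ q) (x ⊗ y)
  ⊗-homogeneous p q x y x-hom y-hom w w≢ = concat-zero (coeff x) (coeff y) w zero-term
    where
    zero-term : ∀ u v → u ++ v ≡ w → coeff x u * coeff y v ≈ 0#
    zero-term u v uv≡w with parityOf u Parityₚ.≟ p | parityOf v Parityₚ.≟ q
    ... | no u≢p  | _         = trans (*-congʳ (x-hom u u≢p)) (zeroˡ _)
    ... | yes _   | no v≢q    = trans (*-congˡ (y-hom v v≢q)) (zeroʳ _)
    ... | yes u≡p | yes v≡q   = contradiction (≡.trans (≡.cong parityOf (≡.sym uv≡w))
      (≡.trans (parityOf-++ u v) (≡.cong₂ Parity._+_ u≡p v≡q))) w≢

  koszul-sym : ∀ p q → koszulSign p q ≡ koszulSign q p
  koszul-sym 0ℙ 0ℙ = ≡.refl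
  koszul-sym 0ℙ 1ℙ = ≡.refl
  koszul-sym 1ℙ 0ℙ = ≡.refl
  koszul-sym 1ℙ 1ℙ = ≡.refl

  -1*-1≈1 : - 1# * - 1# ≈ 1#
  -1*-1≈1 = trans (-1*x≈-x _) (-‿involutive 1#)

  koszul-square : ∀ p q → koszulSign p q * koszulSign p q ≈ 1#
  koszul-square 0ℙ 0ℙ = *-identityˡ 1#
  koszul-square 0ℙ 1ℙ = *-identityˡ 1#
  koszul-square 1ℙ 0ℙ = *-identityˡ 1#
  koszul-square 1ℙ 1ℙ = -1*-1≈1

  koszul-+ˡ : ∀ p q r → koszulSign (p Parity.+ q) r ≈ koszulSign p r * koszulSign q r
  koszul-+ˡ 0ℙ 0ℙ r  = sym (*-identityˡ _)
  koszul-+ˡ 0ℙ 1ℙ r  = sym (*-identityˡ _)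
  koszul-+ˡ 1ℙ 0ℙ 0ℙ = sym (*-identityʳ _)
  koszul-+ˡ 1ℙ 0ℙ 1ℙ = sym (*-identityʳ _)
  koszul-+ˡ 1ℙ 1ℙ 0ℙ = sym (*-identityˡ _)
  koszul-+ˡ 1ℙ 1ℙ 1ℙ = sym -1*-1≈1

  koszul-+ʳ : ∀ p q r → koszulSign p (q Parity.+ r) ≈ koszulSign p q * koszulSign p r
  koszul-+ʳ p q r = trans (reflexive (koszul-sym p (q Parity.+ r)))
    (trans (koszul-+ˡ q r p) (reflexive (≡.cong₂ _*_ (koszul-sym q p) (koszul-sym r p))))

  -- The sign of the reversed product is kept as a multiple of -1, so that the Jacobi identity can
  -- be left to a solver for commutative semirings, with -1 as a variable.
  -koszul : Parity → Parity → Carrier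
  -koszul p q = - 1# * koszulSign p q

  [,]-expand : ∀ p q x y → Homogeneous p x → Homogeneous q y →
               [ x , y ] ≈ᵀ x ⊗ y +ᵀ -koszul p q *ₗᵀ (y ⊗ x)
  [,]-expand p q x y x-hom y-hom w = trans ([,]-homogeneous p q {x} {y} x-hom y-hom w)
    (+-congˡ (trans (sym (-1*x≈-x _)) (sym (*-assoc _ _ _))))

  [,]-isHomogeneous : ∀ p q x y → Homogeneous p x → Homogeneous q y →
                      Homogeneous (p Parity.+ q) [ x , y ]
  [,]-isHomogeneous p q x y x-hom y-hom w w≢ = begin
    coeff [ x , y ] w
      ≈⟨ [,]-expand p q x y x-hom y-hom w ⟩
    coeff (x ⊗ y) w + -koszul p q * coeff (y ⊗ x) w
      ≈⟨ +-cong (⊗-homogeneous p q x y x-hom y-hom w w≢)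
           (*-congˡ (⊗-homogeneous q p y x y-hom x-hom w
             (λ eq → w≢ (≡.trans eq (Parityₚ.+-comm q p))))) ⟩
    0# + -koszul p q * 0#
      ≈⟨ trans (+-identityˡ _) (zeroʳ _) ⟩
    0# ∎

  antisymmetry : ∀ p q x y → Homogeneous p x → Homogeneous q y →
                 [ x , y ] ≈ᵀ -koszul p q *ₗᵀ [ y , x ]
  antisymmetry p q x y x-hom y-hom w = begin
    coeff [ x , y ] w
      ≈⟨ [,]-expand p q x y x-hom y-hom w ⟩
    a + k * b
      ≈⟨ +-comm _ _ ⟩
    k * b + a
      ≈⟨ +-congˡ (trans (*-congʳ k*k≈1) (*-identityˡ a)) ⟨
    k * b + k * -koszul q p * a
      ≈⟨ +-congˡ (*-assoc _ _ _) ⟩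
    k * b + k * (-koszul q p * a)
      ≈⟨ distribˡ _ _ _ ⟨
    k * (b + -koszul q p * a)
      ≈⟨ *-congˡ ([,]-expand q p y x y-hom x-hom w) ⟨
    k * coeff [ y , x ] w ∎
    where
    open CommutativeSemigroupProperties R.*-commutativeSemigroup using () renaming (interchange to *-interchange)
    k = -koszul p q
    a = coeff (x ⊗ y) w
    b = coeff (y ⊗ x) w
    k*k≈1 : k * -koszul q p ≈ 1#
    k*k≈1 = begin
      k * -koszul q p                                     ≡⟨ ≡.cong (λ s → k * (- 1# * s)) (koszul-sym q p) ⟩
      k * k                                               ≈⟨ *-interchange _ _ _ _ ⟩
      - 1# * - 1# * (koszulSign p q * koszulSign p q)     ≈⟨ *-cong -1*-1≈1 (koszul-square p q) ⟩
      1# * 1#                                             ≈⟨ *-identityˡ 1# ⟩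
      1#                                                  ∎

  jacobi : ∀ p q r x y z → Homogeneous p x → Homogeneous q y → Homogeneous r z →
    [ [ x , y ] , z ] ≈ᵀ [ x , [ y , z ] ] +ᵀ -koszul p q *ₗᵀ [ y , [ x , z ] ]
  jacobi p q r x y z x-hom y-hom z-hom w = begin
    coeff [ [ x , y ] , z ] w
      ≈⟨ [,]-expand (p Parity.+ q) r [ x , y ] z xy-hom z-hom w ⟩
    coeff ([ x , y ] ⊗ z) w + n * koszulSign (p Parity.+ q) r * coeff (z ⊗ [ x , y ]) w
      ≈⟨ +-cong (expandˡ x y z s (⊗-assoc x y z) (⊗-assoc y x z) ([,]-expand p q x y x-hom y-hom))
           (*-cong (*-congˡ (koszul-+ˡ p q r)) (expandʳ z x y s ([,]-expand p q x y x-hom y-hom))) ⟩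
    a₁ + n * s * a₂ + n * (t * u) * (a₃ + n * s * a₄)
      ≈⟨ solve 8 (λ a₁ a₂ a₃ a₄ s t u n →
           a₁ :+ n :* s :* a₂ :+ n :* (t :* u) :* (a₃ :+ n :* s :* a₄) :=
           a₁ :+ n :* s :* a₂ :+ n :* t :* u :* a₃ :+ n :* n :* (s :* t :* u :* a₄))
         refl a₁ a₂ a₃ a₄ s t u n ⟩
    a₁ + n * s * a₂ + n * t * u * a₃ + n * n * (s * t * u * a₄)
      -- Read backwards, this inserts n² s² = 1 before the term of `a₃` and adds null terms with the
      -- factors 1 + n s² and 1 + n: the contributions of x z y and y z x, which cancel on the
      -- right-hand side. After that the identity is polynomial in n, s, t, u.
      ≈⟨ trans (+-congˡ (trans (*-congʳ 1+n≈0) (zeroˡ _))) (trans (+-identityʳ _)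
           (trans (+-congˡ (trans (*-congʳ 1+nss≈0) (zeroˡ _))) (trans (+-identityʳ _)
             (+-congʳ (+-congˡ (trans (*-congʳ (trans (*-cong -1*-1≈1 (koszul-square p q)) (*-identityˡ 1#)))
               (*-identityˡ _))))))) ⟨
    a₁ + n * s * a₂ + n * n * (s * s) * (n * t * u * a₃) + n * n * (s * t * u * a₄)
      + (1# + n * (s * s)) * (n * u * a₅) + (1# + n) * (n * s * t * a₆)
      ≈⟨ solve 10 (λ a₁ a₂ a₃ a₄ a₅ a₆ s t u n →
           a₁ :+ n :* s :* a₂ :+ n :* n :* (s :* s) :* (n :* t :* u :* a₃) :+ n :* n :* (s :* t :* u :* a₄)
             :+ (con 1 :+ n :* (s :* s)) :* (n :* u :* a₅) :+ (con 1 :+ n) :* (n :* s :* t :* a₆) :=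
           a₁ :+ n :* u :* a₅ :+ n :* (s :* t) :* (a₆ :+ n :* u :* a₄)
             :+ n :* s :* (a₂ :+ n :* t :* a₆ :+ n :* (s :* u) :* (a₅ :+ n :* t :* a₃)))
         refl a₁ a₂ a₃ a₄ a₅ a₆ s t u n ⟩
    a₁ + n * u * a₅ + n * (s * t) * (a₆ + n * u * a₄)
      + n * s * (a₂ + n * t * a₆ + n * (s * u) * (a₅ + n * t * a₃))
      ≈⟨ +-cong
           (+-cong (expandʳ x y z u ([,]-expand q r y z y-hom z-hom))
             (*-cong (*-congˡ (koszul-+ʳ p q r))
               (expandˡ y z x u (⊗-assoc y z x) (⊗-assoc z y x) ([,]-expand q r y z y-hom z-hom))))
           (*-congˡ (+-cong (expandʳ y x z t ([,]-expand p r x z x-hom z-hom))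
             (*-cong (*-congˡ (trans (koszul-+ʳ q p r) (*-congʳ (reflexive (koszul-sym q p)))))
               (expandˡ x z y t (⊗-assoc x z y) (⊗-assoc z x y) ([,]-expand p r x z x-hom z-hom))))) ⟨
    coeff (x ⊗ [ y , z ]) w + n * koszulSign p (q Parity.+ r) * coeff ([ y , z ] ⊗ x) w
      + n * s * (coeff (y ⊗ [ x , z ]) w + n * koszulSign q (p Parity.+ r) * coeff ([ x , z ] ⊗ y) w)
      ≈⟨ +-cong ([,]-expand p (q Parity.+ r) x [ y , z ] x-hom yz-hom w)
           (*-congˡ ([,]-expand q (p Parity.+ r) y [ x , z ] y-hom xz-hom w)) ⟨
    coeff [ x , [ y , z ] ] w + n * s * coeff [ y , [ x , z ] ] w ∎
    where
    open NaturalSolver R.commutativeSemiring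
    n = - 1#
    s = koszulSign p q
    t = koszulSign p r
    u = koszulSign q r
    a₁ = coeff (x ⊗ (y ⊗ z)) w
    a₂ = coeff (y ⊗ (x ⊗ z)) w
    a₃ = coeff (z ⊗ (x ⊗ y)) w
    a₄ = coeff (z ⊗ (y ⊗ x)) w
    a₅ = coeff (x ⊗ (z ⊗ y)) w
    a₆ = coeff (y ⊗ (z ⊗ x)) w
    xy-hom = [,]-isHomogeneous p q x y x-hom y-hom
    yz-hom = [,]-isHomogeneous q r y z y-hom z-hom
    xz-hom = [,]-isHomogeneous p r x z x-hom z-hom
    1+n≈0 : 1# + n ≈ 0#
    1+n≈0 = -‿inverseʳ 1#
    1+nss≈0 : 1# + n * (s * s) ≈ 0#
    1+nss≈0 = trans (+-congˡ (trans (*-congˡ (koszul-square p q)) (*-identityʳ _))) 1+n≈0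
    expandˡ : ∀ x y z s → (x ⊗ y) ⊗ z ≈ᵀ x ⊗ (y ⊗ z) → (y ⊗ x) ⊗ z ≈ᵀ y ⊗ (x ⊗ z) →
      [ x , y ] ≈ᵀ x ⊗ y +ᵀ (n * s) *ₗᵀ (y ⊗ x) →
      coeff ([ x , y ] ⊗ z) w ≈ coeff (x ⊗ (y ⊗ z)) w + n * s * coeff (y ⊗ (x ⊗ z)) w
    expandˡ x y z s assoc₁ assoc₂ eq = begin
      coeff ([ x , y ] ⊗ z) w
        ≈⟨ concat-cong w eq (λ _ → refl) ⟩
      coeff ((x ⊗ y +ᵀ (n * s) *ₗᵀ (y ⊗ x)) ⊗ z) w
        ≈⟨ +ˡ ⊗-bilinear (x ⊗ y) ((n * s) *ₗᵀ (y ⊗ x)) z w ⟩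
      coeff ((x ⊗ y) ⊗ z) w + coeff (((n * s) *ₗᵀ (y ⊗ x)) ⊗ z) w
        ≈⟨ +-cong (assoc₁ w) (trans (*ˡ ⊗-bilinear (n * s) (y ⊗ x) z w) (*-congˡ (assoc₂ w))) ⟩
      coeff (x ⊗ (y ⊗ z)) w + n * s * coeff (y ⊗ (x ⊗ z)) w ∎
    expandʳ : ∀ z x y s → [ x , y ] ≈ᵀ x ⊗ y +ᵀ (n * s) *ₗᵀ (y ⊗ x) →
      coeff (z ⊗ [ x , y ]) w ≈ coeff (z ⊗ (x ⊗ y)) w + n * s * coeff (z ⊗ (y ⊗ x)) w
    expandʳ z x y s eq = begin
      coeff (z ⊗ [ x , y ]) w
        ≈⟨ concat-cong w (λ _ → refl) eq ⟩
      coeff (z ⊗ (x ⊗ y +ᵀ (n * s) *ₗᵀ (y ⊗ x))) w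
        ≈⟨ +ʳ ⊗-bilinear z (x ⊗ y) ((n * s) *ₗᵀ (y ⊗ x)) w ⟩
      coeff (z ⊗ (x ⊗ y)) w + coeff (z ⊗ ((n * s) *ₗᵀ (y ⊗ x))) w
        ≈⟨ +-congˡ (*ʳ ⊗-bilinear (n * s) z (y ⊗ x) w) ⟩
      coeff (z ⊗ (x ⊗ y)) w + n * s * coeff (z ⊗ (y ⊗ x)) w ∎

-- The super-Lyndon brackets span the free Lie superalgebra.

module SuperLyndonBasis {c ℓ₁ ℓ₂} (F : HeytingField c ℓ₁ ℓ₂) (N : ℕ) where

  open Field F hiding (zero)
  open MöbiusSums F
  open FreeLieSuperalgebra F N
  open SuperTensor F N
  open Bilinear
  open LyndonWords (LetterOrder.≺-isStrictTotalOrder {N})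
  open SetoidReasoning setoid

  private
    _≟ₗ_ : DecidableEquality Letter
    _≟ₗ_ = IsStrictTotalOrder._≟_ (LetterOrder.≺-isStrictTotalOrder {N})

  unit : Letter → V
  unit a p i = 𝟙 (a ≟ₗ (p , i))

  bracketing : ∀ {w} → LyndonTree w → Bracketing
  bracketing (leaf a)       = leaf (unit a)
  bracketing (node t s _ _) = node (bracketing t) (bracketing s)

  data SuperTree : Pred Word Level.zero where
    tree   : ∀ {w} → LyndonTree w → SuperTree w
    square : ∀ {u} → LyndonTree u → parityOf u ≡ 1ℙ → SuperTree (u ++ u)

  superBracketing : ∀ {w} → SuperTree w → Bracketing
  superBracketing (tree t)     = bracketing t
  superBracketing (square t _) = node (bracketing t) (bracketing t)

  P : ∀ {w} → SuperTree w → Tensor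
  P s = iteratedCommutator (superBracketing s)

  private
    leaf≢node : ∀ {a u v} → LyndonTree u → LyndonTree v → a ∷ [] ≢ u ++ v
    leaf≢node {u = []}        t s _  = tree≢[] t ≡.refl
    leaf≢node {u = _ ∷ []}    t s eq = tree≢[] s (≡.sym (Listₚ.∷-injectiveʳ eq))
    leaf≢node {u = _ ∷ _ ∷ _} t s ()

  -- Trees over one word may differ in their order proofs, so bracketings are compared. The equality
  -- of the words is a hypothesis because `u ++ v` does not determine its factors by unification;
  -- `node-unique` supplies them.
  bracketing-unique : ∀ {u v} (t : LyndonTree u) (s : LyndonTree v) → u ≡ v →
                      bracketing t ≡ bracketing s
  bracketing-unique (leaf a) (leaf .a) ≡.refl = ≡.refl
  bracketing-unique (leaf a) (node t s _ _) eq = contradiction eq (leaf≢node t s)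
  bracketing-unique (node t s _ _) (leaf a) eq = contradiction (≡.sym eq) (leaf≢node t s)
  bracketing-unique (node t s _ t-cond) (node t′ s′ _ t′-cond) eq
    with ≡.refl , ≡.refl ← node-unique (tree≢[] t) (tree≢[] t′)
           (LyndonTree⇒Lyndon s) (LyndonTree⇒Lyndon s′) t-cond t′-cond eq =
    ≡.cong₂ node (bracketing-unique t t′ ≡.refl) (bracketing-unique s s′ ≡.refl)

  ι-unit-support : ∀ a w → w ≢ a ∷ [] → coeff (ι (unit a)) w ≈ 0#
  ι-unit-support a []              _    = refl
  ι-unit-support a (b ∷ [])        b≢a  = 𝟙-no (a ≟ₗ b) (λ a≡b → b≢a (≡.cong (_∷ []) (≡.sym a≡b)))
  ι-unit-support a (_ ∷ _ ∷ _)     _    = refl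

  bracketing-homogeneous : ∀ {w} (t : LyndonTree w) →
                           Homogeneous (parityOf w) (iteratedCommutator (bracketing t))
  bracketing-homogeneous (leaf a) w w≢ = ι-unit-support a w λ { ≡.refl → w≢ ≡.refl }
  bracketing-homogeneous (node {u} {v} t s _ _) =
    ≡.subst (λ p → Homogeneous p (iteratedCommutator (node (bracketing t) (bracketing s))))
      (≡.sym (parityOf-++ u v))
      ([,]-isHomogeneous (parityOf u) (parityOf v)
        (iteratedCommutator (bracketing t)) (iteratedCommutator (bracketing s))
        (bracketing-homogeneous t) (bracketing-homogeneous s))

  P-homogeneous : ∀ {w} (s : SuperTree w) → Homogeneous (parityOf w) (P s)
  P-homogeneous (tree t) = bracketing-homogeneous t
  P-homogeneous (square {u} t odd) =
    ≡.subst (λ p → Homogeneous p (P (square t odd))) (≡.sym (parityOf-++ u u))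
      ([,]-isHomogeneous (parityOf u) (parityOf u) (P (tree t)) (P (tree t))
        (bracketing-homogeneous t) (bracketing-homogeneous t))

  -- A span as an inductive closure in place of explicit coefficients: linear statements are
  -- extended from the generators by recursion on the derivation, and `Q` records which words occur.
  data Spanned (Q : Pred Word Level.zero) : Pred Tensor (c ⊔ ℓ₁) where
    gen   : ∀ {w} (s : SuperTree w) → Q w → Spanned Q (P s)
    null  : Spanned Q 0ᵀ
    add   : ∀ {x y} → Spanned Q x → Spanned Q y → Spanned Q (x +ᵀ y)
    scale : ∀ k {x} → Spanned Q x → Spanned Q (k *ₗᵀ x)
    resp  : ∀ {x y} → x ≈ᵀ y → Spanned Q x → Spanned Q y

  Spanned-⊆ : ∀ {Q Q′} → (∀ {w} → Q w → Q′ w) → ∀ {x} → Spanned Q x → Spanned Q′ x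
  Spanned-⊆ Q⊆ (gen s q)     = gen s (Q⊆ q)
  Spanned-⊆ Q⊆ null          = null
  Spanned-⊆ Q⊆ (add x y)     = add (Spanned-⊆ Q⊆ x) (Spanned-⊆ Q⊆ y)
  Spanned-⊆ Q⊆ (scale k x)   = scale k (Spanned-⊆ Q⊆ x)
  Spanned-⊆ Q⊆ (resp x≈y x)  = resp x≈y (Spanned-⊆ Q⊆ x)

  Spanned-[,]ʳ : ∀ {Q Q′} x → (∀ {w} (s : SuperTree w) → Q w → Spanned Q′ [ x , P s ]) →
                 ∀ {y} → Spanned Q y → Spanned Q′ [ x , y ]
  Spanned-[,]ʳ x f (gen s q) = f s q
  Spanned-[,]ʳ x f null = resp (λ w → sym (0ʳ [,]-bilinear x {0ᵀ} (λ _ → refl) w)) null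
  Spanned-[,]ʳ x f (add {y} {z} sy sz) = resp (λ w → sym (+ʳ [,]-bilinear x y z w))
    (add (Spanned-[,]ʳ x f sy) (Spanned-[,]ʳ x f sz))
  Spanned-[,]ʳ x f (scale k {y} sy) = resp (λ w → sym (*ʳ [,]-bilinear k x y w))
    (scale k (Spanned-[,]ʳ x f sy))
  Spanned-[,]ʳ x f (resp {y} {z} y≈z sy) = resp (cong [,]-bilinear {x} {x} {y} {z} (λ _ → refl) y≈z)
    (Spanned-[,]ʳ x f sy)

  Spanned-[,]ˡ : ∀ {Q Q′} y → (∀ {w} (s : SuperTree w) → Q w → Spanned Q′ [ P s , y ]) →
                 ∀ {x} → Spanned Q x → Spanned Q′ [ x , y ]
  Spanned-[,]ˡ y f (gen s q) = f s q
  Spanned-[,]ˡ y f null = resp (λ w → sym (0ˡ [,]-bilinear {0ᵀ} y (λ _ → refl) w)) null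
  Spanned-[,]ˡ y f (add {x} {z} sx sz) = resp (λ w → sym (+ˡ [,]-bilinear x z y w))
    (add (Spanned-[,]ˡ y f sx) (Spanned-[,]ˡ y f sz))
  Spanned-[,]ˡ y f (scale k {x} sx) = resp (λ w → sym (*ˡ [,]-bilinear k x y w))
    (scale k (Spanned-[,]ˡ y f sx))
  Spanned-[,]ˡ y f (resp {x} {z} x≈z sx) = resp (cong [,]-bilinear {x} {z} {y} {y} x≈z (λ _ → refl))
    (Spanned-[,]ˡ y f sx)

  Spanned-antisym : ∀ {Q u v} (s : SuperTree u) (t : SuperTree v) →
                    Spanned Q [ P s , P t ] → Spanned Q [ P t , P s ]
  Spanned-antisym s t st =
    resp (λ w → sym (antisymmetry _ _ (P t) (P s) (P-homogeneous t) (P-homogeneous s) w)) (scale _ st)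

  Spanned-jacobi : ∀ {Q u v w} (r : SuperTree u) (s : SuperTree v) (t : SuperTree w) →
    Spanned Q [ P r , [ P s , P t ] ] → Spanned Q [ P s , [ P r , P t ] ] →
    Spanned Q [ [ P r , P s ] , P t ]
  Spanned-jacobi r s t rst srt =
    resp (λ w → sym (jacobi _ _ _ (P r) (P s) (P t)
           (P-homogeneous r) (P-homogeneous s) (P-homogeneous t) w))
      (add rst (scale _ srt))

  [even,even]≈0 : ∀ x → Homogeneous 0ℙ x → [ x , x ] ≈ᵀ 0ᵀ
  [even,even]≈0 x x-hom w = trans ([,]-homogeneous 0ℙ 0ℙ {x} {x} x-hom x-hom w)
    (trans (+-congˡ (-‿cong (*-identityˡ _))) (-‿inverseʳ _))

  -- For odd x, [ x , x ] is 2 x x, which commutes with x.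
  [[odd,odd],odd]≈0 : ∀ x → Homogeneous 1ℙ x → [ [ x , x ] , x ] ≈ᵀ 0ᵀ
  [[odd,odd],odd]≈0 x x-hom w = begin
    coeff [ [ x , x ] , x ] w
      ≈⟨ [,]-homogeneous 0ℙ 1ℙ {[ x , x ]} {x} ([,]-isHomogeneous 1ℙ 1ℙ x x x-hom x-hom) x-hom w ⟩
    coeff ([ x , x ] ⊗ x) w - 1# * coeff (x ⊗ [ x , x ]) w
      ≈⟨ +-cong
           (trans (concat-cong w xx≈ (λ _ → refl)) (trans (+ˡ ⊗-bilinear (x ⊗ x) (k *ₗᵀ (x ⊗ x)) x w)
             (+-cong (⊗-assoc x x x w)
               (trans (*ˡ ⊗-bilinear k (x ⊗ x) x w) (*-congˡ (⊗-assoc x x x w))))))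
           (-‿cong (trans (*-identityˡ _) (trans (concat-cong w (λ _ → refl) xx≈)
             (trans (+ʳ ⊗-bilinear x (x ⊗ x) (k *ₗᵀ (x ⊗ x)) w)
               (+-congˡ (*ʳ ⊗-bilinear k x (x ⊗ x) w)))))) ⟩
    xxx + k * xxx - (xxx + k * xxx)
      ≈⟨ -‿inverseʳ _ ⟩
    0# ∎
    where
    k = -koszul 1ℙ 1ℙ
    xxx = coeff (x ⊗ (x ⊗ x)) w
    xx≈ : [ x , x ] ≈ᵀ x ⊗ x +ᵀ k *ₗᵀ (x ⊗ x)
    xx≈ = [,]-expand 1ℙ 1ℙ x x x-hom x-hom

  Sp : ℕ → Pred Word Level.zero → Pred Tensor (c ⊔ ℓ₁)
  Sp L B = Spanned (λ w → length w ≡ L × B w)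

  -- The bound by `v` in the conclusion is what feeds the induction: after a bracket with `v`, only
  -- words below `v` are left for the next bracket.
  Brackets< : ℕ → Word → Set (c ⊔ ℓ₁)
  Brackets< L v = ∀ {u} (s : SuperTree u) (t : LyndonTree v) → u < v →
    length u ℕ.+ length v ≡ L → Sp L (_< v) [ P s , P (tree t) ]

  BracketsIn : ℕ → Pred Word Level.zero → Set (c ⊔ ℓ₁)
  BracketsIn L B = ∀ {u v} (t : LyndonTree u) (s : SuperTree v) → B u → B v →
    length u ℕ.+ length v ≡ L → Sp L B [ P (tree t) , P s ]

  private
    tree>0 : ∀ {w} → LyndonTree w → 0 ℕ.< length w
    tree>0 {w} t = ℕ.>-nonZero⁻¹ (length w) {{Lyndon⇒nonZero (LyndonTree⇒Lyndon t)}}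

    []<tree : ∀ {w} → LyndonTree w → [] < w
    []<tree t with lyndon _ ← LyndonTree⇒Lyndon t = Lex.halt

  -- Lexicographic induction on the total length of the two words and on the
  -- larger of them, which in the end is replaced by an arbitrary bound B.
  module Step (L : ℕ) (shorter : ∀ {L′} → L′ ℕ.< L → ∀ v → Brackets< L′ v) where

    -- Distinct trees are a matter of `Brackets<` at the larger word. Equal ones give 0 or, if odd,
    -- a square, so `B` has to be closed under squares. A bracket with a square reduces by the
    -- Jacobi identity to one nested bracket, occurring twice. Each Lyndon word involved is shorter
    -- than the total `L`, hence the length condition in `inner`.
    bracketsIn : ∀ {B : Pred Word Level.zero} →
      (∀ {u v} → u < v → B v → B u) → (∀ {u} → LyndonTree u → B u → B (u ++ u)) →
      (∀ {v} → LyndonTree v → B v → length v ℕ.< L → Brackets< L v × BracketsIn L (_< v)) →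
      BracketsIn L B
    bracketsIn {B} down sq inner {u} {v} t (tree s) Bu Bv |uv|≡L with <-cmp u v
    ... | tri< u<v _ _ = Spanned-⊆ (λ (l , w<v) → l , down w<v Bv)
      (proj₁ (inner s Bv (≡.subst (length v ℕ.<_) |uv|≡L (ℕₚ.m<n+m _ (tree>0 t)))) (tree t) s u<v |uv|≡L)
    ... | tri> _ _ v<u = Spanned-antisym (tree s) (tree t) (Spanned-⊆ (λ (l , w<u) → l , down w<u Bu)
      (proj₁ (inner t Bu (≡.subst (length u ℕ.<_) |uv|≡L (ℕₚ.m<m+n _ (tree>0 s)))) (tree s) t v<u
        (≡.trans (ℕₚ.+-comm (length v) (length u)) |uv|≡L)))
    ... | tri≈ _ ≡.refl _ = ≡.subst (λ b → Sp L B [ P (tree t) , iteratedCommutator b ])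
      (bracketing-unique t s ≡.refl) (diagonal (parityOf u) ≡.refl)
      where
      diagonal : ∀ p → parityOf u ≡ p → Sp L B [ P (tree t) , P (tree t) ]
      diagonal 0ℙ even = resp (λ w → sym ([even,even]≈0 (P (tree t))
        (≡.subst (λ p → Homogeneous p (P (tree t))) even (P-homogeneous (tree t))) w)) null
      diagonal 1ℙ odd  = gen (square t odd) (≡.trans (Listₚ.length-++ u) |uv|≡L , sq t Bu)
    bracketsIn {B} down sq inner {x} t (square {z} s odd) Bx Bzz |xzz|≡L =
      Spanned-antisym (square s odd) (tree t) (nested (<-cmp x z))
      where
      Bz : B z
      Bz = down (≡.subst (_< z ++ z) (Listₚ.++-identityʳ z) (++-monoʳ-< z ([]<tree s))) Bzz
      |z|+|xz|≡L : length z ℕ.+ (length x ℕ.+ length z) ≡ L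
      |z|+|xz|≡L = ≡.trans (ℕₚ.+-comm (length z) _) (≡.trans (ℕₚ.+-assoc (length x) _ _)
        (≡.trans (≡.cong (λ k → length x ℕ.+ k) (≡.sym (Listₚ.length-++ z))) |xzz|≡L))
      |xz|<L : length x ℕ.+ length z ℕ.< L
      |xz|<L = ≡.subst (length x ℕ.+ length z ℕ.<_) |z|+|xz|≡L (ℕₚ.m<n+m _ (tree>0 s))
      |z|<L : length z ℕ.< L
      |z|<L = ℕₚ.≤-<-trans (ℕₚ.m≤n+m (length z) (length x)) |xz|<L
      |x|<L : length x ℕ.< L
      |x|<L = ℕₚ.≤-<-trans (ℕₚ.m≤m+n (length x) (length z)) |xz|<L
      twice : Sp L B [ P (tree s) , [ P (tree s) , P (tree t) ] ] →
              Sp L B [ P (square s odd) , P (tree t) ]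
      twice zzx = Spanned-jacobi (tree s) (tree s) (tree t) zzx zzx
      -- The bracket of `z` and `x` has smaller total length and expands into words below the larger
      -- of the two. The bracket of these with `z` has `z` as its larger word if x < z, and stays
      -- below `x` if z < x.
      nested : Tri (x < z) (x ≡ z) (z < x) → Sp L B [ P (square s odd) , P (tree t) ]
      nested (tri< x<z _ _) = twice (Spanned-[,]ʳ (P (tree s))
        (λ {w} r (|w| , w<z) → Spanned-⊆ (λ (l , v<z) → l , down v<z Bz)
          (Spanned-antisym r (tree s) (proj₁ (inner s Bz |z|<L) r s w<z
            (≡.trans (ℕₚ.+-comm (length w) _) (≡.trans (≡.cong (λ k → length z ℕ.+ k) |w|) |z|+|xz|≡L)))))
        (Spanned-antisym (tree t) (tree s) (shorter |xz|<L z (tree t) s x<z ≡.refl)))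
      nested (tri> _ _ z<x) = twice (Spanned-[,]ʳ (P (tree s))
        (λ {w} r (|w| , w<x) → Spanned-⊆ (λ (l , v<x) → l , down v<x Bx)
          (proj₂ (inner t Bx |x|<L) s r z<x w<x
            (≡.trans (≡.cong (λ k → length z ℕ.+ k) |w|) |z|+|xz|≡L)))
        (shorter |xz|<L x (tree s) t z<x (ℕₚ.+-comm (length z) (length x))))
      nested (tri≈ _ ≡.refl _) = ≡.subst
        (λ b → Sp L B [ P (square s odd) , iteratedCommutator b ]) (bracketing-unique s t ≡.refl)
        (resp (λ w → sym ([[odd,odd],odd]≈0 (P (tree s))
          (≡.subst (λ p → Homogeneous p (P (tree s))) odd (P-homogeneous (tree s))) w)) null)

    brackets< : ∀ {v} → BracketsIn L (_< v) → Brackets< L v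
    brackets< {v} in-v (tree (leaf a)) t u<v |uv|≡L = gen (tree (node (leaf a) t u<v []))
      (|uv|≡L , ++<ʳ (LyndonTree⇒Lyndon t) (λ ()) u<v)
    brackets< {v} in-v (tree (node {u₁} {u₂} t₁ t₂ u₁<u₂ cond)) t u<v |uv|≡L with u₂ <? v
    ... | no u₂≮v = gen (tree (node (node t₁ t₂ u₁<u₂ cond) t u<v
            (node-cond (tree≢[] t₁) (LyndonTree⇒Lyndon t₂) cond u₂≮v)))
          (≡.trans (Listₚ.length-++ (u₁ ++ u₂)) |uv|≡L ,
           ++<ʳ (LyndonTree⇒Lyndon t) (tree≢[] (node t₁ t₂ u₁<u₂ cond)) u<v)
    -- Here u₁ < u₂ < v. In both nested brackets the inner one contains `v` and has smaller total
    -- length, so it expands into words below `v`; the outer one then joins two words below `v`,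
    -- which `in-v` covers.
    ... | yes u₂<v = Spanned-jacobi (tree t₁) (tree t₂) (tree t)
      (Spanned-[,]ʳ (P (tree t₁)) (λ r (|w| , w<v) → in-v t₁ r u₁<v w<v
          (≡.trans (≡.cong (λ k → length u₁ ℕ.+ k) |w|) total₁))
        (shorter |u₂v|<L v (tree t₂) t u₂<v ≡.refl))
      (Spanned-[,]ʳ (P (tree t₂)) (λ r (|w| , w<v) → in-v t₂ r u₂<v w<v
          (≡.trans (≡.cong (λ k → length u₂ ℕ.+ k) |w|) total₂))
        (shorter |u₁v|<L v (tree t₁) t u₁<v ≡.refl))
      where
      u₁<v : u₁ < v
      u₁<v = <-trans u₁<u₂ u₂<v
      total₁ : length u₁ ℕ.+ (length u₂ ℕ.+ length v) ≡ L
      total₁ = ≡.trans (≡.sym (ℕₚ.+-assoc (length u₁) _ _))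
        (≡.trans (≡.cong (ℕ._+ length v) (≡.sym (Listₚ.length-++ u₁))) |uv|≡L)
      total₂ : length u₂ ℕ.+ (length u₁ ℕ.+ length v) ≡ L
      total₂ = ≡.trans (≡.sym (ℕₚ.+-assoc (length u₂) _ _)) (≡.trans
        (≡.cong (ℕ._+ length v) (ℕₚ.+-comm (length u₂) _)) (≡.trans (ℕₚ.+-assoc (length u₁) _ _) total₁))
      |u₂v|<L : length u₂ ℕ.+ length v ℕ.< L
      |u₂v|<L = ≡.subst (length u₂ ℕ.+ length v ℕ.<_) total₁ (ℕₚ.m<n+m _ (tree>0 t₁))
      |u₁v|<L : length u₁ ℕ.+ length v ℕ.< L
      |u₁v|<L = ≡.subst (length u₁ ℕ.+ length v ℕ.<_) total₂ (ℕₚ.m<n+m _ (tree>0 t₂))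
    brackets< {v} in-v (square {z} s odd) t zz<v |zzv|≡L =
      Spanned-jacobi (tree s) (tree s) (tree t) nested nested
      where
      z<v : z < v
      z<v = ≮∧<⇒< (v++u≮v z z) zz<v
      total : length z ℕ.+ (length z ℕ.+ length v) ≡ L
      total = ≡.trans (≡.sym (ℕₚ.+-assoc (length z) _ _))
        (≡.trans (≡.cong (ℕ._+ length v) (≡.sym (Listₚ.length-++ z))) |zzv|≡L)
      nested : Sp L (_< v) [ P (tree s) , [ P (tree s) , P (tree t) ] ]
      nested = Spanned-[,]ʳ (P (tree s)) (λ r (|w| , w<v) → in-v s r z<v w<v
          (≡.trans (≡.cong (λ k → length z ℕ.+ k) |w|) total))
        (shorter (≡.subst (length z ℕ.+ length v ℕ.<_) total (ℕₚ.m<n+m _ (tree>0 s)))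
          v (tree s) t z<v ≡.refl)

    all< : ∀ {v} → LyndonTree v → Acc (Below (LetterOrder.≺-acc {N}) L) v →
           Brackets< L v × BracketsIn L (_< v)
    all< {v} t (acc rs) = brackets< in-v , in-v
      where
      in-v : BracketsIn L (_< v)
      in-v = bracketsIn <-trans (λ s u<v → square< (LyndonTree⇒Lyndon t) (tree≢[] s) u<v)
        -- The bound on the length turns the passage from `v` to a smaller word into a descent for
        -- `Below`.
        (λ s u<v |u|<L → all< s (rs (u<v , ℕₚ.<⇒≤ |u|<L)))

  brackets<-closed : ∀ L v → Brackets< L v
  brackets<-closed = <-rec _ λ L shorter v {u} s t →
    proj₁ (Step.all< L shorter t (<-acc (LetterOrder.≺-acc {N}) L v)) s t

  LieSpan : Pred Tensor (c ⊔ ℓ₁)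
  LieSpan = Spanned (λ _ → ⊤)

  bracketsIn-closed : ∀ {u v} (t : LyndonTree u) (s : SuperTree v) → LieSpan [ P (tree t) , P s ]
  bracketsIn-closed {u} {v} t s = Spanned-⊆ (λ _ → tt)
    (Step.bracketsIn L (λ _ → brackets<-closed _) {λ _ → ⊤} (λ _ _ → tt) (λ _ _ → tt)
      (λ t _ _ → Step.all< L (λ _ → brackets<-closed _) t (<-acc (LetterOrder.≺-acc {N}) L _))
      t s tt tt ≡.refl)
    where
    L = length u ℕ.+ length v

  brackets-closed : ∀ {u v} (r : SuperTree u) (s : SuperTree v) → LieSpan [ P r , P s ]
  brackets-closed (tree t)       s = bracketsIn-closed t s
  brackets-closed (square t odd) s = Spanned-jacobi (tree t) (tree t) s tts tts
    where
    tts : LieSpan [ P (tree t) , [ P (tree t) , P s ] ]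
    tts = Spanned-[,]ʳ (P (tree t)) (λ r _ → bracketsIn-closed t r) (bracketsIn-closed t s)

  LieSpan-[,] : ∀ {x y} → LieSpan x → LieSpan y → LieSpan [ x , y ]
  LieSpan-[,] {x} {y} sx sy =
    Spanned-[,]ˡ y (λ r _ → Spanned-[,]ʳ (P r) (λ s _ → brackets-closed r s) sy) sx

  coeff-combination : ∀ {k} (a : Vector Carrier k) (b : Vector Tensor k) w →
                      coeff (combination a b) w ≈ sum (λ i → a i * coeff (b i) w)
  coeff-combination {zero}  a b w = refl
  coeff-combination {suc k} a b w = +-congˡ (coeff-combination (a ∘ suc) (b ∘ suc) w)

  Spanned-combination : ∀ {Q k} (a : Vector Carrier k) (b : Vector Tensor k) →
                        (∀ i → Spanned Q (b i)) → Spanned Q (combination a b)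
  Spanned-combination {k = zero}  a b sb = null
  Spanned-combination {k = suc k} a b sb =
    add (scale (a zero) (sb zero)) (Spanned-combination (a ∘ suc) (b ∘ suc) (sb ∘ suc))

  sum-single : ∀ {k} (f : Vector Carrier k) i → (∀ j → j ≢ i → f j ≈ 0#) → sum f ≈ f i
  sum-single {k} f i f≈0 = trans (sym (Σ-tabulate {n = k} id f))
    (Σ-single i (Unique.allFin⁺ k) (∈ₚ.∈-allFin i) (λ {j} _ → f≈0 j))

  sum-zero : ∀ {k} (f : Vector Carrier k) → (∀ j → f j ≈ 0#) → sum f ≈ 0#
  sum-zero {k} f f≈0 = trans (sum-cong-≋ f≈0) (sum-replicate-zero k)

  ι-LieSpan : ∀ v → LieSpan (ι v)
  ι-LieSpan v = resp expand (add (span 0ℙ) (span 1ℙ))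
    where
    letters : Parity → Tensor
    letters p = combination (v p) (λ i → P (tree (leaf (p , i))))
    span : ∀ p → LieSpan (letters p)
    span p = Spanned-combination (v p) _ (λ i → gen (tree (leaf (p , i))) tt)
    letters-zero : ∀ p w → (∀ i → w ≢ (p , i) ∷ []) → coeff (letters p) w ≈ 0#
    letters-zero p w w≢ = trans (coeff-combination (v p) _ w) (sum-zero _ λ i →
      trans (*-congˡ (ι-unit-support (p , i) w (w≢ i))) (zeroʳ _))
    letters-coeff : ∀ p j → coeff (letters p) ((p , j) ∷ []) ≈ v p j
    letters-coeff p j = trans (coeff-combination (v p) _ ((p , j) ∷ []))
      (trans (sum-single _ j (λ i i≢j → trans
          (*-congˡ (ι-unit-support (p , i) ((p , j) ∷ []) λ { ≡.refl → i≢j ≡.refl })) (zeroʳ _)))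
        (trans (*-congˡ (𝟙-yes ((p , j) ≟ₗ (p , j)) ≡.refl)) (*-identityʳ _)))
    expand : letters 0ℙ +ᵀ letters 1ℙ ≈ᵀ ι v
    expand []              = trans (+-cong (letters-zero 0ℙ [] λ _ ()) (letters-zero 1ℙ [] λ _ ())) (+-identityʳ _)
    expand ((0ℙ , j) ∷ []) = trans (+-cong (letters-coeff 0ℙ j) (letters-zero 1ℙ _ λ _ ())) (+-identityʳ _)
    expand ((1ℙ , j) ∷ []) = trans (+-cong (letters-zero 0ℙ _ λ _ ()) (letters-coeff 1ℙ j)) (+-identityˡ _)
    expand w@(_ ∷ _ ∷ _)   = trans (+-cong (letters-zero 0ℙ w λ _ ()) (letters-zero 1ℙ w λ _ ())) (+-identityʳ _)

  FreeLie⇒LieSpan : ∀ {x} → FreeLie x → LieSpan x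
  FreeLie⇒LieSpan (k , a , s , x≈) =
    resp (λ w → sym (x≈ w)) (Spanned-combination a _ (iterated ∘ s))
    where
    iterated : ∀ b → LieSpan (iteratedCommutator b)
    iterated (leaf v)   = ι-LieSpan v
    iterated (node b d) = LieSpan-[,] (iterated b) (iterated d)

-- Bidegrees, leading words and weights of the brackets; enumeration of words.

module LieComponent {c ℓ₁ ℓ₂} (F : HeytingField c ℓ₁ ℓ₂) (N : ℕ) where

  open Field F hiding (zero)
  open MöbiusSums F
  open FreeLieSuperalgebra F N
  open SuperTensor F N
  open SuperLyndonBasis F N
  open LyndonWords (LetterOrder.≺-isStrictTotalOrder {N})
  open SetoidReasoning setoid

  private
    module R = CommutativeRing commutativeRing
    open CommutativeSemigroupProperties R.*-commutativeSemigroup using (x∙yz≈y∙xz; interchange)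

  HasBidegree-⊗ : ∀ {n m n′ m′} x y → HasBidegree n m x → HasBidegree n′ m′ y →
                  HasBidegree (n ℕ.+ n′) (m ℕ.+ m′) (x ⊗ y)
  HasBidegree-⊗ {n} {m} {n′} {m′} x y x-deg y-deg w w≢ =
    concat-zero (coeff x) (coeff y) w zero-term
    where
    zero-term : ∀ u v → u ++ v ≡ w → coeff x u * coeff y v ≈ 0#
    zero-term u v ≡.refl with count 0ℙ u ℕₚ.≟ n ×-dec count 1ℙ u ℕₚ.≟ m
                           | count 0ℙ v ℕₚ.≟ n′ ×-dec count 1ℙ v ℕₚ.≟ m′
    ... | no u≢         | _             = trans (*-congʳ (x-deg u u≢)) (zeroˡ _)
    ... | yes _         | no v≢         = trans (*-congˡ (y-deg v v≢)) (zeroʳ _)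
    ... | yes (u₀ , u₁) | yes (v₀ , v₁) = contradiction
      (≡.trans (count-++ 0ℙ u v) (≡.cong₂ ℕ._+_ u₀ v₀) ,
       ≡.trans (count-++ 1ℙ u v) (≡.cong₂ ℕ._+_ u₁ v₁)) w≢

  HasBidegree-[,] : ∀ {p q n m n′ m′} x y → Homogeneous p x → Homogeneous q y →
    HasBidegree n m x → HasBidegree n′ m′ y → HasBidegree (n ℕ.+ n′) (m ℕ.+ m′) [ x , y ]
  HasBidegree-[,] {p} {q} {n} {m} {n′} {m′} x y x-hom y-hom x-deg y-deg w w≢ =
    trans ([,]-expand p q x y x-hom y-hom w) (trans
      (+-cong (HasBidegree-⊗ x y x-deg y-deg w w≢)
        (trans (*-congˡ (HasBidegree-⊗ y x y-deg x-deg w λ (w₀ , w₁) →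
            w≢ (≡.trans w₀ (ℕₚ.+-comm n′ n) , ≡.trans w₁ (ℕₚ.+-comm m′ m)))) (zeroʳ _)))
      (+-identityʳ _))

  HasWordBidegree : Word → Pred Tensor ℓ₁
  HasWordBidegree w = HasBidegree (count 0ℙ w) (count 1ℙ w)

  private
    []-bidegree : ∀ u v {x y} → Homogeneous (parityOf u) x → Homogeneous (parityOf v) y →
      HasWordBidegree u x → HasWordBidegree v y → HasWordBidegree (u ++ v) [ x , y ]
    []-bidegree u v {x} {y} x-hom y-hom x-deg y-deg = ≡.subst₂ (λ n m → HasBidegree n m [ x , y ])
      (≡.sym (count-++ 0ℙ u v)) (≡.sym (count-++ 1ℙ u v))
      (HasBidegree-[,] {parityOf u} {parityOf v} x y x-hom y-hom x-deg y-deg)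

    tree-bidegree : ∀ {w} (t : LyndonTree w) → HasWordBidegree w (P (tree t))
    tree-bidegree (leaf a) w w≢ = ι-unit-support a w λ { ≡.refl → w≢ (≡.refl , ≡.refl) }
    tree-bidegree (node {u} {v} t s _ _) = []-bidegree u v {P (tree t)} {P (tree s)}
      (P-homogeneous (tree t)) (P-homogeneous (tree s)) (tree-bidegree t) (tree-bidegree s)

  P-bidegree : ∀ {w} (s : SuperTree w) → HasWordBidegree w (P s)
  P-bidegree (tree t)       = tree-bidegree t
  P-bidegree (square {u} t _) = []-bidegree u u {P (tree t)} {P (tree t)}
    (P-homogeneous (tree t)) (P-homogeneous (tree t)) (tree-bidegree t) (tree-bidegree t)

  count₀+count₁ : ∀ w → count 0ℙ w ℕ.+ count 1ℙ w ≡ length w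
  count₀+count₁ []             = ≡.refl
  count₀+count₁ ((0ℙ , _) ∷ w) = ≡.cong suc (count₀+count₁ w)
  count₀+count₁ ((1ℙ , _) ∷ w) =
    ≡.trans (ℕₚ.+-suc (count 0ℙ w) (count 1ℙ w)) (≡.cong suc (count₀+count₁ w))

  -- Homogeneity in the length is part of the notion: a splitting at any place other than `length u`
  -- then contributes nothing to a product, and at that place the order on `u ++ v` is decided by
  -- the two factors in turn.
  record Leading (w : Word) (k : Carrier) (x : Tensor) : Set ℓ₁ where
    field
      lengths : ∀ {v} → length v ≢ length w → coeff x v ≈ 0#
      lower   : ∀ {v} → v < w → coeff x v ≈ 0#
      lead    : coeff x w ≈ k

  open Leading

  private
    ++-< : ∀ {u v u′ v′ : Word} → length u′ ≡ length u → u′ ++ v′ < u ++ v →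
           u′ < u ⊎ (u′ ≡ u × v′ < v)
    ++-< {u} {v} {u′} {v′} l≡ u′v′<uv with <-cmp u′ u
    ... | tri< u′<u _ _    = inj₁ u′<u
    ... | tri≈ _ ≡.refl _  = inj₂ (≡.refl , ++-cancelˡ-< u u′v′<uv)
    ... | tri> _ _ u<u′ with <-cases u<u′
    ...   | inj₁ differ           = contradiction (differ v v′) (<-asym u′v′<uv)
    ...   | inj₂ (a , r , ≡.refl) = contradiction
      (≡.trans (≡.sym l≡) (≡.trans (Listₚ.length-++ u) (ℕₚ.+-suc (length u) (length r))))
      (ℕₚ.m≢1+m+n (length u))

    module _ {u v k l x y} (x-lead : Leading u k x) (y-lead : Leading v l y) where

      ⊗-lengths : ∀ w → length w ≢ length (u ++ v) → coeff (x ⊗ y) w ≈ 0#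
      ⊗-lengths w w≢ = concat-zero (coeff x) (coeff y) w zero-term
        where
        zero-term : ∀ u′ v′ → u′ ++ v′ ≡ w → coeff x u′ * coeff y v′ ≈ 0#
        zero-term u′ v′ ≡.refl with length u′ ℕₚ.≟ length u | length v′ ℕₚ.≟ length v
        ... | no u′≢  | _       = trans (*-congʳ (lengths x-lead u′≢)) (zeroˡ _)
        ... | yes _   | no v′≢  = trans (*-congˡ (lengths y-lead v′≢)) (zeroʳ _)
        ... | yes u≡  | yes v≡  = contradiction (≡.trans (Listₚ.length-++ u′)
          (≡.trans (≡.cong₂ ℕ._+_ u≡ v≡) (≡.sym (Listₚ.length-++ u)))) w≢

      ⊗-lower : ∀ {w} → w < u ++ v → coeff (x ⊗ y) w ≈ 0#
      ⊗-lower {w} w< = concat-zero (coeff x) (coeff y) w zero-term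
        where
        zero-term : ∀ u′ v′ → u′ ++ v′ ≡ w → coeff x u′ * coeff y v′ ≈ 0#
        zero-term u′ v′ ≡.refl with length u′ ℕₚ.≟ length u
        ... | no u′≢ = trans (*-congʳ (lengths x-lead u′≢)) (zeroˡ _)
        ... | yes l≡ with ++-< {u} {v} {u′} {v′} l≡ w<
        ...   | inj₁ u′<u       = trans (*-congʳ (lower x-lead u′<u)) (zeroˡ _)
        ...   | inj₂ (_ , v′<v) = trans (*-congˡ (lower y-lead v′<v)) (zeroʳ _)

      ⊗-lead : coeff (x ⊗ y) (u ++ v) ≈ k * l
      ⊗-lead = trans (concat-single (coeff x) (coeff y) u v zero-term)
                     (*-cong (lead x-lead) (lead y-lead))
        where
        zero-term : ∀ u′ v′ → u′ ++ v′ ≡ u ++ v → u′ ≢ u → coeff x u′ * coeff y v′ ≈ 0#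
        zero-term u′ v′ eq u′≢u with length u′ ℕₚ.≟ length u
        ... | no l≢  = trans (*-congʳ (lengths x-lead l≢)) (zeroˡ _)
        ... | yes l≡ = contradiction (proj₁ (Rotation.++-injective u′ u l≡ eq)) u′≢u

    tree-leading : ∀ {w} (t : LyndonTree w) → Leading w 1# (P (tree t))
    tree-leading (leaf a) = record
      { lengths = λ {v} l≢ → ι-unit-support a v λ { ≡.refl → l≢ ≡.refl }
      ; lower   = λ {v} v<a → ι-unit-support a v λ { ≡.refl → <-irrefl v<a }
      ; lead    = 𝟙-yes (IsStrictTotalOrder._≟_ (LetterOrder.≺-isStrictTotalOrder {N}) a a) ≡.refl
      }
    tree-leading (node {u} {v} t s u<v _) = record
      { lengths = λ {w} l≢ → trans (expand w) (trans
          (+-cong (⊗-lengths xL yL w l≢) (trans (*-congˡ (⊗-lengths yL xL w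
            (λ l≡ → l≢ (≡.trans l≡ lengths≡)))) (zeroʳ _))) (+-identityʳ _))
      ; lower   = λ {w} w<uv → trans (expand w) (trans
          (+-cong (⊗-lower xL yL w<uv) (trans (*-congˡ (⊗-lower yL xL (<-trans w<uv uv<vu))) (zeroʳ _)))
          (+-identityʳ _))
      ; lead    = trans (expand (u ++ v)) (trans
          (+-cong (trans (⊗-lead xL yL) (*-identityˡ 1#))
                  (trans (*-congˡ (⊗-lower yL xL uv<vu)) (zeroʳ _)))
          (+-identityʳ _))
      }
      where
      xL = tree-leading t
      yL = tree-leading s
      lengths≡ : length (v ++ u) ≡ length (u ++ v)
      lengths≡ = ≡.trans (Listₚ.length-++ v) (≡.trans (ℕₚ.+-comm (length v) _) (≡.sym (Listₚ.length-++ u)))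
      uv<vu : u ++ v < v ++ u
      -- u v < v, and `v` is at most `v ++ u`: the reversed product starts only beyond `u ++ v` and
      -- leaves the leading term alone.
      uv<vu = <∧≮⇒< (++<ʳ (LyndonTree⇒Lyndon s) (tree≢[] t) u<v) (v++u≮v v u)
      expand = [,]-expand (parityOf u) (parityOf v) (P (tree t)) (P (tree s))
        (P-homogeneous (tree t)) (P-homogeneous (tree s))

  leadCoeff : ∀ {w} → SuperTree w → Carrier
  leadCoeff (tree _)     = 1#
  leadCoeff (square _ _) = 1# + 1#

  P-leading : ∀ {w} (s : SuperTree w) → Leading w (leadCoeff s) (P s)
  P-leading (tree t) = tree-leading t
  P-leading (square {u} t odd) = record
    { lengths = λ {w} l≢ → trans (expand w) (vanish (⊗-lengths xL xL w l≢))
    ; lower   = λ {w} w<uu → trans (expand w) (vanish (⊗-lower xL xL w<uu))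
    -- For odd arguments the reversed product has the sign -(-1) = 1, so the leading coefficient
    -- doubles.
    ; lead    = trans (expand (u ++ u)) (+-cong xx≈1 (trans (*-cong -1*-1≈1 xx≈1) (*-identityˡ 1#)))
    }
    where
    xL = tree-leading t
    t-odd : Homogeneous 1ℙ (P (tree t))
    t-odd = ≡.subst (λ p → Homogeneous p (P (tree t))) odd (P-homogeneous (tree t))
    expand = [,]-expand 1ℙ 1ℙ (P (tree t)) (P (tree t)) t-odd t-odd
    xx≈1 = trans (⊗-lead xL xL) (*-identityˡ 1#)
    vanish : ∀ {k a} → a ≈ 0# → a + k * a ≈ 0#
    vanish a≈0 = trans (+-cong a≈0 (trans (*-congˡ a≈0) (zeroʳ _))) (+-identityʳ 0#)

  module _ (x : Vector Carrier N) where

    weight : Word → Carrier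
    weight []            = 1#
    weight ((_ , i) ∷ w) = x i * weight w

    weight-++ : ∀ u v → weight (u ++ v) ≈ weight u * weight v
    weight-++ []            v = sym (*-identityˡ _)
    weight-++ ((_ , i) ∷ u) v = trans (*-congˡ (weight-++ u v)) (sym (*-assoc _ _ _))

    -- By `act-diagonal` this is the eigenvector equation of `diag x` with eigenvalue `k`,
    -- coefficient by coefficient; it passes to products because `weight` is multiplicative.
    HasWeight : Carrier → Pred Tensor ℓ₁
    HasWeight k y = ∀ w → weight w * coeff y w ≈ k * coeff y w

    weight-concat : ∀ f g w → weight w * concat f g w ≈
                    concat (λ u → weight u * f u) (λ v → weight v * g v) w
    weight-concat f g [] = trans (*-congʳ (sym (*-identityˡ 1#))) (interchange _ _ _ _)
    weight-concat f g (a@(_ , i) ∷ w) = begin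
      weight (a ∷ w) * (f [] * g (a ∷ w) + concat fₐ g w)
        ≈⟨ distribˡ _ _ _ ⟩
      weight (a ∷ w) * (f [] * g (a ∷ w)) + x i * weight w * concat fₐ g w
        ≈⟨ +-cong (trans (x∙yz≈y∙xz _ _ _) (*-congʳ (sym (*-identityˡ _)))) (trans (*-assoc _ _ _)
             (trans (*-congˡ (weight-concat fₐ g w)) (sym (concat-*ˡ (x i) _ _ w)))) ⟩
      1# * f [] * (weight (a ∷ w) * g (a ∷ w)) +
        concat (λ u → x i * (weight u * fₐ u)) (λ v → weight v * g v) w
        ≈⟨ +-congˡ (concat-cong w (λ u → sym (*-assoc _ _ _)) (λ _ → refl)) ⟩
      concat (λ u → weight u * f u) (λ v → weight v * g v) (a ∷ w) ∎
      where
      fₐ : Word → Carrier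
      fₐ u = f (a ∷ u)

    HasWeight-⊗ : ∀ {k l} y z → HasWeight k y → HasWeight l z → HasWeight (k * l) (y ⊗ z)
    HasWeight-⊗ {k} {l} y z y-wt z-wt w = begin
      weight w * concat (coeff y) (coeff z) w
        ≈⟨ weight-concat (coeff y) (coeff z) w ⟩
      concat (λ u → weight u * coeff y u) (λ v → weight v * coeff z v) w
        ≈⟨ concat-cong w y-wt z-wt ⟩
      concat (λ u → k * coeff y u) (λ v → l * coeff z v) w
        ≈⟨ trans (concat-*ˡ k (coeff y) _ w) (*-congˡ (concat-*ʳ l (coeff y) (coeff z) w)) ⟩
      k * (l * concat (coeff y) (coeff z) w)
        ≈⟨ *-assoc _ _ _ ⟨
      k * l * concat (coeff y) (coeff z) w ∎

    HasWeight-[,] : ∀ {k l} p q y z → Homogeneous p y → Homogeneous q z →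
      HasWeight k y → HasWeight l z → HasWeight (k * l) [ y , z ]
    HasWeight-[,] {k} {l} p q y z y-hom z-hom y-wt z-wt w = begin
      weight w * coeff [ y , z ] w
        ≈⟨ *-congˡ (expand w) ⟩
      weight w * (coeff (y ⊗ z) w + s * coeff (z ⊗ y) w)
        ≈⟨ distribˡ _ _ _ ⟩
      weight w * coeff (y ⊗ z) w + weight w * (s * coeff (z ⊗ y) w)
        ≈⟨ +-cong (HasWeight-⊗ y z y-wt z-wt w) (trans (x∙yz≈y∙xz _ _ _)
             (*-congˡ (trans (HasWeight-⊗ z y z-wt y-wt w) (*-congʳ (*-comm l k))))) ⟩
      k * l * coeff (y ⊗ z) w + s * (k * l * coeff (z ⊗ y) w)
        ≈⟨ trans (distribˡ _ _ _) (+-congˡ (x∙yz≈y∙xz _ _ _)) ⟨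
      k * l * (coeff (y ⊗ z) w + s * coeff (z ⊗ y) w)
        ≈⟨ *-congˡ (expand w) ⟨
      k * l * coeff [ y , z ] w ∎
      where
      s = -koszul p q
      expand = [,]-expand p q y z y-hom z-hom

    private
      HasWeight-cong : ∀ {k l} y → k ≈ l → HasWeight k y → HasWeight l y
      HasWeight-cong y k≈l y-wt w = trans (y-wt w) (*-congʳ k≈l)

      tree-weight : ∀ {w} (t : LyndonTree w) → HasWeight (weight w) (P (tree t))
      tree-weight (leaf a) w with w ≟ (a ∷ [])
      ... | yes ≡.refl = refl
      ... | no w≢a     = trans (*-congˡ (ι-unit-support a w w≢a)) (trans (zeroʳ _)
        (sym (trans (*-congˡ (ι-unit-support a w w≢a)) (zeroʳ _))))
      tree-weight (node {u} {v} t s u<v cond) = HasWeight-cong (P (tree (node t s u<v cond)))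
        (sym (weight-++ u v)) (HasWeight-[,] (parityOf u) (parityOf v) (P (tree t)) (P (tree s))
          (P-homogeneous (tree t)) (P-homogeneous (tree s)) (tree-weight t) (tree-weight s))

    P-weight : ∀ {w} (s : SuperTree w) → HasWeight (weight w) (P s)
    P-weight (tree t)         = tree-weight t
    P-weight (square {u} t o) = HasWeight-cong (P (square t o)) (sym (weight-++ u u))
      (HasWeight-[,] (parityOf u) (parityOf u) (P (tree t)) (P (tree t))
        (P-homogeneous (tree t)) (P-homogeneous (tree t)) (tree-weight t) (tree-weight t))

    act-diagonal : ∀ (x#0 : ∀ i → x i # 0#) f w →
                   actCoeff (diagonalEmbedding (diag x x#0)) f w ≈ weight w * f w
    act-diagonal x#0 f []            = sym (*-identityˡ _)
    act-diagonal x#0 f ((p , i) ∷ w) = begin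
      sum (λ j → diagonalMatrix x i j * actCoeff _ (λ u → f ((p , j) ∷ u)) w)
        ≈⟨ sum-single _ i (λ j j≢i → trans (*-congʳ (off-diagonal (Finₚ._≟_ i j) (j≢i ∘ ≡.sym))) (zeroˡ _)) ⟩
      diagonalMatrix x i i * actCoeff _ (λ u → f ((p , i) ∷ u)) w
        ≈⟨ *-cong (diagonal (Finₚ._≟_ i i)) (act-diagonal x#0 (λ u → f ((p , i) ∷ u)) w) ⟩
      x i * (weight w * f ((p , i) ∷ w))
        ≈⟨ *-assoc _ _ _ ⟨
      x i * weight w * f ((p , i) ∷ w) ∎
      where
      off-diagonal : ∀ {j} (d : Dec (i ≡ j)) → i ≢ j → (if does d then x i else 0#) ≈ 0#
      off-diagonal (yes i≡j) i≢j = contradiction i≡j i≢j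
      off-diagonal (no _)    _   = refl
      diagonal : (d : Dec (i ≡ i)) → (if does d then x i else 0#) ≈ x i
      diagonal (yes _)  = refl
      diagonal (no i≢i) = contradiction ≡.refl i≢i

  -- A Lyndon word is not a square, so the two kinds of tree never share a word.
  P-unique : ∀ {u v} (s : SuperTree u) (t : SuperTree v) → u ≡ v → superBracketing s ≡ superBracketing t
  P-unique (tree s) (tree t) eq = bracketing-unique s t eq
  P-unique (square {u} s _) (square {v} t _) eq with ≡.refl ← Rotation.square-injective u v eq =
    ≡.cong₂ node (bracketing-unique s t ≡.refl) (bracketing-unique s t ≡.refl)
  P-unique (tree t) (square s _) eq =
    contradiction (≡.subst Lyndon eq (LyndonTree⇒Lyndon t)) (¬square-Lyndon (tree≢[] s))
  P-unique (square s _) (tree t) eq =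
    contradiction (≡.subst Lyndon (≡.sym eq) (LyndonTree⇒Lyndon t)) (¬square-Lyndon (tree≢[] s))

  OddSquare : Pred Word Level.zero
  OddSquare w = ∃[ u ] w ≡ u ++ u × Lyndon u × parityOf u ≡ 1ℙ

  SuperLyndon : Pred Word Level.zero
  SuperLyndon w = Lyndon w ⊎ OddSquare w

  superTree : ∀ {w} → SuperLyndon w → SuperTree w
  superTree (inj₁ w-lyn)                    = tree (Lyndon⇒LyndonTree w-lyn)
  superTree (inj₂ (u , ≡.refl , u-lyn , odd)) = square (Lyndon⇒LyndonTree u-lyn) odd

  superTree⁻ : ∀ {w} → SuperTree w → SuperLyndon w
  superTree⁻ (tree t)         = inj₁ (LyndonTree⇒Lyndon t)
  superTree⁻ (square t odd)   = inj₂ (_ , ≡.refl , LyndonTree⇒Lyndon t , odd)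

  -- The only candidate for the root of a square is the first half of the word.
  oddSquare? : Decidable OddSquare
  oddSquare? w = map′ (λ (w≡ , u-lyn , odd) → half , w≡ , u-lyn , odd) from
    (w ≟ (half ++ half) ×-dec lyndon? half ×-dec (parityOf half Parityₚ.≟ 1ℙ))
    where
    half = List.take ℕ.⌊ length w /2⌋ w
    from : OddSquare w → w ≡ half ++ half × Lyndon half × parityOf half ≡ 1ℙ
    from (u , ≡.refl , u-lyn , odd) = ≡.cong₂ _++_ u≡ u≡ , ≡.subst Lyndon u≡ u-lyn , ≡.trans (≡.cong parityOf (≡.sym u≡)) odd
      where
      u≡ : u ≡ half
      u≡ = proj₁ (Rotation.++-injective u half (≡.sym half-length) (≡.sym (Listₚ.take++drop≡id ℕ.⌊ length (u ++ u) /2⌋ (u ++ u))))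
        where
        ⌊⌋≡ : ℕ.⌊ length (u ++ u) /2⌋ ≡ length u
        ⌊⌋≡ = ≡.trans (≡.cong ℕ.⌊_/2⌋ (Listₚ.length-++ u)) (≡.sym (ℕₚ.n≡⌊n+n/2⌋ (length u)))
        half-length : length half ≡ length u
        half-length = ≡.trans (Listₚ.length-take ℕ.⌊ length (u ++ u) /2⌋ (u ++ u))
          (≡.trans (≡.cong (ℕ._⊓ length (u ++ u)) ⌊⌋≡) (ℕₚ.m≤n⇒m⊓n≡m
            (≡.subst (length u ℕ.≤_) (≡.sym (Listₚ.length-++ u)) (ℕₚ.m≤m+n _ _))))

  superLyndon? : Decidable SuperLyndon
  superLyndon? w = lyndon? w ⊎-dec oddSquare? w

  letters : List Letter
  letters = List.cartesianProduct (0ℙ ∷ 1ℙ ∷ []) (List.allFin N)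

  words : ℕ → List Word
  words zero    = [] ∷ []
  words (suc L) = List.cartesianProductWith _∷_ letters (words L)

  words-! : ∀ L → Unique (words L)
  words-! zero    = [] ∷ []
  words-! (suc L) = Unique.cartesianProductWith⁺ _∷_ Listₚ.∷-injective
    (Unique.cartesianProduct⁺ (((λ ()) ∷ []) ∷ [] ∷ []) (Unique.allFin⁺ N)) (words-! L)

  ∈-words⁺ : ∀ w → w ∈ words (length w)
  ∈-words⁺ []            = here ≡.refl
  ∈-words⁺ ((p , i) ∷ w) = ∈ₚ.∈-cartesianProductWith⁺ _∷_
    (∈ₚ.∈-cartesianProduct⁺ (parity∈ p) (∈ₚ.∈-allFin i)) (∈-words⁺ w)
    where
    parity∈ : ∀ p → p ∈ 0ℙ ∷ 1ℙ ∷ []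
    parity∈ 0ℙ = here ≡.refl
    parity∈ 1ℙ = there (here ≡.refl)

  ∈-words⁻ : ∀ L {w} → w ∈ words L → length w ≡ L
  ∈-words⁻ zero    (here ≡.refl) = ≡.refl
  ∈-words⁻ (suc L) w∈ with _ , v , _ , v∈ , ≡.refl ← ∈ₚ.∈-cartesianProductWith⁻ _∷_ letters (words L) w∈ =
    ≡.cong suc (∈-words⁻ L v∈)

  Bidegree : ℕ → ℕ → Pred Word Level.zero
  Bidegree n m w = count 0ℙ w ≡ n × count 1ℙ w ≡ m

  bidegree? : ∀ n m → Decidable (Bidegree n m)
  bidegree? n m w = count 0ℙ w ℕₚ.≟ n ×-dec count 1ℙ w ℕₚ.≟ m

  wordsOf : ℕ → ℕ → List Word
  wordsOf n m = filter (bidegree? n m) (words (n ℕ.+ m))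

  wordsOf-! : ∀ n m → Unique (wordsOf n m)
  wordsOf-! n m = Unique.filter⁺ (bidegree? n m) (words-! (n ℕ.+ m))

  ∈-wordsOf⁺ : ∀ {n m w} → Bidegree n m w → w ∈ wordsOf n m
  ∈-wordsOf⁺ {n} {m} {w} deg@(w₀ , w₁) = ∈ₚ.∈-filter⁺ (bidegree? n m)
    (≡.subst (λ L → w ∈ words L) (≡.trans (≡.sym (count₀+count₁ w)) (≡.cong₂ ℕ._+_ w₀ w₁)) (∈-words⁺ w)) deg

  ∈-wordsOf⁻ : ∀ {n m w} → w ∈ wordsOf n m → Bidegree n m w
  ∈-wordsOf⁻ {n} {m} w∈ = proj₂ (∈ₚ.∈-filter⁻ (bidegree? n m) {xs = words (n ℕ.+ m)} w∈)

  ∈-wordsOf-length : ∀ {n m w} → w ∈ wordsOf n m → length w ≡ n ℕ.+ m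
  ∈-wordsOf-length {n} {m} w∈ =
    ∈-words⁻ (n ℕ.+ m) (proj₁ (∈ₚ.∈-filter⁻ (bidegree? n m) {xs = words (n ℕ.+ m)} w∈))

-- A basis of the bidegree component, and the trace on it.

lookup-injective : ∀ {a} {A : Set a} {xs : List A} → Unique xs →
                   ∀ {i j} → lookup xs i ≡ lookup xs j → i ≡ j
lookup-injective {xs = x ∷ xs} (x∉ ∷ xs!) {zero}  {zero}  eq = ≡.refl
lookup-injective {xs = x ∷ xs} (x∉ ∷ xs!) {zero}  {suc j} eq =
  contradiction eq (All.lookup x∉ (∈ₚ.∈-lookup j))
lookup-injective {xs = x ∷ xs} (x∉ ∷ xs!) {suc i} {zero}  eq =
  contradiction (≡.sym eq) (All.lookup x∉ (∈ₚ.∈-lookup i))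
lookup-injective {xs = x ∷ xs} (x∉ ∷ xs!) {suc i} {suc j} eq = ≡.cong suc (lookup-injective xs! eq)

module LieComponentBasis {c ℓ₁ ℓ₂} (F : HeytingField c ℓ₁ ℓ₂) (N n m : ℕ) where

  open Field F hiding (zero)
  open MöbiusSums F
  open FreeLieSuperalgebra F N
  open SuperTensor F N
  open SuperLyndonBasis F N
  open LieComponent F N
  open LyndonWords (LetterOrder.≺-isStrictTotalOrder {N})
  open SemiringSum semiring using (∑-distrib-+; *-distribˡ-sum)
  open SetoidReasoning setoid

  basisWords : List Word
  basisWords = filter superLyndon? (wordsOf n m)

  basisWords-! : Unique basisWords
  basisWords-! = Unique.filter⁺ superLyndon? (wordsOf-! n m)

  private
    k = length basisWords

    word : Fin k → Word
    word = lookup basisWords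

    word∈ : ∀ i → word i ∈ wordsOf n m × SuperLyndon (word i)
    word∈ i = ∈ₚ.∈-filter⁻ superLyndon? {xs = wordsOf n m} (∈ₚ.∈-lookup i)

    word-tree : ∀ i → SuperTree (word i)
    word-tree i = superTree (proj₂ (word∈ i))

    word-bidegree : ∀ i → Bidegree n m (word i)
    word-bidegree i = ∈-wordsOf⁻ {n} {m} (proj₁ (word∈ i))

    word-length : ∀ i → length (word i) ≡ n ℕ.+ m
    word-length i = ∈-wordsOf-length {n} {m} (proj₁ (word∈ i))

  basis : Fin k → Tensor
  basis i = P (word-tree i)

  private
    basis-bidegree : ∀ i → HasBidegree n m (basis i)
    basis-bidegree i w w≢ = P-bidegree (word-tree i) w λ (w₀ , w₁) →
      w≢ (≡.trans w₀ (proj₁ (word-bidegree i)) , ≡.trans w₁ (proj₂ (word-bidegree i)))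

    basis-lie : ∀ i → FreeLie (basis i)
    basis-lie i = 1 , (λ _ → 1#) , (λ _ → superBracketing (word-tree i)) ,
      λ w → sym (trans (+-identityʳ _) (*-identityˡ _))

    combination-single : ∀ (a : Vector Carrier k) i → (∀ j → j ≢ i → a j ≈ 0#) →
      ∀ w → coeff (combination a basis) w ≈ a i * coeff (basis i) w
    combination-single a i a≈0 w = trans (coeff-combination a basis w)
      (sum-single _ i (λ j j≢i → trans (*-congʳ (a≈0 j j≢i)) (zeroˡ _)))

    δ : Carrier → Fin k → Fin k → Carrier
    δ r i j = 𝟙 (i Finₚ.≟ j) * r

    δ-same : ∀ r i → δ r i i ≈ r
    δ-same r i = trans (*-congʳ (𝟙-yes (i Finₚ.≟ i) ≡.refl)) (*-identityˡ r)

    δ-other : ∀ r {i j} → i ≢ j → δ r i j ≈ 0#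
    δ-other r {i} {j} i≢j = trans (*-congʳ (𝟙-no (i Finₚ.≟ j) i≢j)) (zeroˡ r)

    combination-δ : ∀ r i w → coeff (combination (δ r i) basis) w ≈ r * coeff (basis i) w
    combination-δ r i w = trans (combination-single (δ r i) i (λ j j≢i → δ-other r (j≢i ∘ ≡.sym)) w)
      (*-congʳ (δ-same r i))

    combination-0 : ∀ w → coeff (combination (λ (_ : Fin k) → 0#) basis) w ≈ 0#
    combination-0 w = trans (coeff-combination (λ _ → 0#) basis w)
      (sum-zero (λ i → 0# * coeff (basis i) w) (λ i → zeroˡ (coeff (basis i) w)))

    combination-bidegree : ∀ a → HasBidegree n m (combination a basis)
    combination-bidegree a w w≢ = trans (coeff-combination a basis w)
      (sum-zero _ λ i → trans (*-congˡ (basis-bidegree i w w≢)) (zeroʳ _))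

    -- A member of `FreeLie` is a combination of brackets of arbitrary bidegrees, and only their sum
    -- is known to vanish outside (n , m). Agreement on the words of bidegree (n , m) can be
    -- established summand by summand: a bracket of another bidegree meets it with zero
    -- coefficients.
    Projected : Tensor → Set _
    Projected y = ∃[ a ] ∀ w → Bidegree n m w → coeff y w ≈ coeff (combination a basis) w

    project-add : ∀ {y z} → Projected y → Projected z → Projected (y +ᵀ z)
    project-add (a , y≈) (b , z≈) = (λ i → a i + b i) , λ w deg → trans (+-cong (y≈ w deg) (z≈ w deg)) (begin
      coeff (combination a basis) w + coeff (combination b basis) w
        ≈⟨ +-cong (coeff-combination a basis w) (coeff-combination b basis w) ⟩
      sum (λ i → a i * coeff (basis i) w) + sum (λ i → b i * coeff (basis i) w)
        ≈⟨ ∑-distrib-+ (λ i → a i * coeff (basis i) w) (λ i → b i * coeff (basis i) w) ⟨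
      sum (λ i → a i * coeff (basis i) w + b i * coeff (basis i) w)
        ≈⟨ sum-cong-≋ {k} (λ i → distribʳ (coeff (basis i) w) (a i) (b i)) ⟨
      sum (λ i → (a i + b i) * coeff (basis i) w)
        ≈⟨ coeff-combination (λ i → a i + b i) basis w ⟨
      coeff (combination (λ i → a i + b i) basis) w ∎)

    project-scale : ∀ r {y} → Projected y → Projected (r *ₗᵀ y)
    project-scale r (a , y≈) = (λ i → r * a i) , λ w deg → trans (*-congˡ (y≈ w deg)) (begin
      r * coeff (combination a basis) w
        ≈⟨ *-congˡ (coeff-combination a basis w) ⟩
      r * sum (λ i → a i * coeff (basis i) w)
        ≈⟨ *-distribˡ-sum r (λ i → a i * coeff (basis i) w) ⟩
      sum (λ i → r * (a i * coeff (basis i) w))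
        ≈⟨ sum-cong-≋ {k} (λ i → *-assoc r (a i) (coeff (basis i) w)) ⟨
      sum (λ i → r * a i * coeff (basis i) w)
        ≈⟨ coeff-combination (λ i → r * a i) basis w ⟨
      coeff (combination (λ i → r * a i) basis) w ∎)

    project-gen : ∀ {w} (s : SuperTree w) → Dec (Bidegree n m w) → Projected (P s)
    project-gen s (no w≢)       = (λ _ → 0#) , λ v (v₀ , v₁) → trans
      (P-bidegree s v λ (v≡₀ , v≡₁) → w≢ (≡.trans (≡.sym v≡₀) v₀ , ≡.trans (≡.sym v≡₁) v₁))
      (sym (combination-0 v))
    project-gen {w} s (yes deg) = δ 1# i , λ v _ → begin
      -- The tree `s` need not be the one chosen for its word, but its bracketing is.
      coeff (P s) v                           ≡⟨ ≡.cong (λ b → coeff (iteratedCommutator b) v) (P-unique s (word-tree i) w≡) ⟩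
      coeff (basis i) v                       ≈⟨ *-identityˡ _ ⟨
      1# * coeff (basis i) v                  ≈⟨ combination-δ 1# i v ⟨
      coeff (combination (δ 1# i) basis) v    ∎
      where
      w∈ : w ∈ basisWords
      w∈ = ∈ₚ.∈-filter⁺ superLyndon? (∈-wordsOf⁺ {n} {m} deg) (superTree⁻ s)
      i = Any.index w∈
      w≡ : w ≡ word i
      w≡ = Anyₚ.lookup-index w∈

    project : ∀ {y} → LieSpan y → Projected y
    project (gen {w} s _)    = project-gen s (bidegree? n m w)
    project null             = (λ _ → 0#) , λ w _ → sym (combination-0 w)
    project (add {y} {z} sy sz) = project-add {y} {z} (project sy) (project sz)
    project (scale r {y} sy) = project-scale r {y} (project sy)
    project (resp y≈z sy)    = let a , y≈ = project sy in a , λ w deg → trans (sym (y≈z w)) (y≈ w deg)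

  module _ (char0 : CharacteristicZero) where

    private
      -- The leading coefficient 2 of a square is invertible in characteristic zero.
      leadCoeff-cancel : ∀ {w} (s : SuperTree w) {a} → a * leadCoeff s ≈ 0# → a ≈ 0#
      leadCoeff-cancel (tree _)     eq = trans (sym (*-identityʳ _)) eq
      leadCoeff-cancel (square _ _) {a} eq = begin
        a                                      ≈⟨ *-identityʳ a ⟨
        a * 1#                                 ≈⟨ *-congˡ (⁻¹-inverseʳ (fromℕ 2) (char0 2)) ⟨
        a * (fromℕ 2 * fromℕ 2 ⁻¹[ char0 2 ])  ≈⟨ *-assoc _ _ _ ⟨
        a * fromℕ 2 * fromℕ 2 ⁻¹[ char0 2 ]    ≈⟨ *-congʳ (trans (*-congˡ (+-congˡ (+-identityʳ 1#))) eq) ⟩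
        0# * fromℕ 2 ⁻¹[ char0 2 ]             ≈⟨ zeroˡ _ ⟩
        0#                                     ∎

    -- The system is triangular: at `word i` the brackets of larger words vanish, and the
    -- coefficients of smaller words are zero by induction along the order, which is well founded
    -- here as all words have length n + m.
    basis-independent : ∀ a → combination a basis ≈ᵀ 0ᵀ → ∀ i → a i ≈ 0#
    basis-independent a a≈0 i = go i (<-acc (LetterOrder.≺-acc {N}) (n ℕ.+ m) (word i))
      where
      go : ∀ i → Acc (Below (LetterOrder.≺-acc {N}) (n ℕ.+ m)) (word i) → a i ≈ 0#
      go i (acc rs) = leadCoeff-cancel (word-tree i) (begin
        a i * leadCoeff (word-tree i)
          ≈⟨ *-congˡ (Leading.lead (P-leading (word-tree i))) ⟨
        a i * coeff (basis i) (word i)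
          ≈⟨ sum-single _ i others ⟨
        sum (λ j → a j * coeff (basis j) (word i))
          ≈⟨ coeff-combination a basis (word i) ⟨
        coeff (combination a basis) (word i)
          ≈⟨ a≈0 (word i) ⟩
        0# ∎)
        where
        others : ∀ j → j ≢ i → a j * coeff (basis j) (word i) ≈ 0#
        others j j≢i = case <-cmp (word j) (word i) of λ where
          (tri< j<i _ _) → trans (*-congʳ (go j (rs (j<i , ℕₚ.≤-reflexive (word-length j))))) (zeroˡ _)
          (tri≈ _ j≡i _) → contradiction (lookup-injective basisWords-! j≡i) j≢i
          (tri> _ _ i<j) → trans (*-congˡ (Leading.lower (P-leading (word-tree j)) i<j)) (zeroʳ _)

    basis-isBasis : IsBasis (FreeLieComponent n m) basis
    basis-isBasis = record
      { members     = λ i → basis-lie i , basis-bidegree i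
      ; independent = basis-independent
      ; spanning    = λ y (y-lie , y-deg) → spanning y y-deg (project (FreeLie⇒LieSpan {y} y-lie))
      }
      where
      spanning : ∀ y → HasBidegree n m y → Projected y → ∃[ a ] y ≈ᵀ combination a basis
      spanning y y-deg (a , y≈) = a , expand
        where
        expand : y ≈ᵀ combination a basis
        expand w = case bidegree? n m w of λ where
          (yes deg) → y≈ w deg
          (no ¬deg) → trans (y-deg w ¬deg) (sym (combination-bidegree a w ¬deg))

    character : ∀ (x : Vector Carrier N) (x#0 : ∀ i → x i # 0#) {t} →
                Σ basisWords (weight x) ≈ t → IsCharacterValue (FreeLieComponent n m) x x#0 t
    character x x#0 {t} Σ≈t = k , basis , basis-isBasis , (λ i j → δ (weight x (word j)) j i) ,
      (λ j w → trans (act-diagonal x x#0 (coeff (basis j)) w) (trans (P-weight x (word-tree j) w)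
        (sym (combination-δ (weight x (word j)) j w)))) ,
      trans (sum-cong-≋ {k} (λ i → δ-same (weight x (word i)) i)) (trans (sym (Σ≈sum basisWords (weight x))) Σ≈t)

-- Weighted counts of words and of their super-Lyndon rotations.

module Counting {c ℓ₁ ℓ₂} (F : HeytingField c ℓ₁ ℓ₂) (N : ℕ) where

  open Möbius using (divisors)
  open Field F hiding (zero)
  open MöbiusSums F
  open FreeLieSuperalgebra F N
  open SuperTensor F N
  open LieComponent F N
  open LyndonWords (LetterOrder.≺-isStrictTotalOrder {N})
  open Rotation {Letter}
  open SemiringMult semiring using (×-homo-+)
  open CommutativeExp (CommutativeRing.commutativeSemiring commutativeRing) using (^-distrib-*)
  open SetoidReasoning setoid

  Σ-const : ∀ {a} {A : Set a} (xs : List A) k → Σ xs (λ _ → k) ≈ fromℕ (length xs) * k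
  Σ-const []       k = sym (zeroˡ k)
  Σ-const (x ∷ xs) k = begin
    k + Σ xs (λ _ → k)               ≈⟨ +-cong (sym (*-identityˡ k)) (Σ-const xs k) ⟩
    1# * k + fromℕ (length xs) * k   ≈⟨ distribʳ _ _ _ ⟨
    (1# + fromℕ (length xs)) * k     ∎

  Σ-upTo-+ : ∀ a b f → Σ (upTo (a ℕ.+ b)) f ≈ Σ (upTo a) f + Σ (upTo b) (λ r → f (a ℕ.+ r))
  Σ-upTo-+ a b f = trans (applyUpTo-+ id a) (+-congˡ (begin
    Σ (List.applyUpTo (a ℕ.+_) b) f   ≡⟨ ≡.cong (λ xs → Σ xs f) (Listₚ.map-upTo (a ℕ.+_) b) ⟨
    Σ (map (a ℕ.+_) (upTo b)) f       ≈⟨ Σ-map (a ℕ.+_) (upTo b) f ⟩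
    Σ (upTo b) (λ r → f (a ℕ.+ r))    ∎))
    where
    applyUpTo-+ : ∀ (g : ℕ → ℕ) a → Σ (List.applyUpTo g (a ℕ.+ b)) f ≈
                  Σ (List.applyUpTo g a) f + Σ (List.applyUpTo (g ∘ (a ℕ.+_)) b) f
    applyUpTo-+ g zero    = sym (+-identityˡ _)
    applyUpTo-+ g (suc a) = trans (+-congˡ (applyUpTo-+ (g ∘ suc) a)) (sym (+-assoc _ _ _))

  Σ-cartesianProductWith : ∀ {a b d} {A : Set a} {B : Set b} {D : Set d} (g : A → B → D) xs ys f →
    Σ (List.cartesianProductWith g xs ys) f ≈ Σ xs (λ x → Σ ys (λ y → f (g x y)))
  Σ-cartesianProductWith g []       ys f = refl
  Σ-cartesianProductWith g (x ∷ xs) ys f = trans (Σ-++ (map (g x) ys) _ f)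
    (+-cong (Σ-map (g x) ys f) (Σ-cartesianProductWith g xs ys f))

  𝟙-× : ∀ {p q} {A : Set p} {B : Set q} (A? : Dec A) (B? : Dec B) → 𝟙 (A? ×-dec B?) ≈ 𝟙 A? * 𝟙 B?
  𝟙-× (yes _) (yes _) = sym (*-identityˡ _)
  𝟙-× (yes _) (no _)  = sym (*-identityˡ _)
  𝟙-× (no _)  _       = sym (zeroˡ _)

  𝟙-⊎ : ∀ {p q} {A : Set p} {B : Set q} (A? : Dec A) (B? : Dec B) → (A → ¬ B) →
        𝟙 (A? ⊎-dec B?) ≈ 𝟙 A? + 𝟙 B?
  𝟙-⊎ (yes a) (yes b) disjoint = contradiction b (disjoint a)
  𝟙-⊎ (yes _) (no _)  _        = sym (+-identityʳ _)
  𝟙-⊎ (no _)  (yes _) _        = sym (+-identityˡ _)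
  𝟙-⊎ (no _)  (no _)  _        = sym (+-identityˡ _)

  module _ (x : Vector Carrier N) where

    private
      s = sum x

      countWords : ℕ → ℕ → Carrier
      countWords L m = Σ (words L) (λ w → 𝟙 (count 1ℙ w ℕₚ.≟ m) * weight x w)

      letter-sum : ∀ L (f : Word → Carrier) →
        Σ (List.allFin N) (λ i → Σ (words L) (λ w → f w * (x i * weight x w))) ≈
        s * Σ (words L) (λ w → f w * weight x w)
      letter-sum L f = begin
        Σ (List.allFin N) (λ i → Σ (words L) (λ w → f w * (x i * weight x w)))
          ≈⟨ Σ-cong (List.allFin N) (λ {i} _ → trans (Σ-cong (words L) (λ {w} _ → x∙yz≈y∙xz (f w) (x i) (weight x w)))
               (sym (Σ-*ˡ (words L) (x i) _))) ⟩
        Σ (List.allFin N) (λ i → x i * Σ (words L) (λ w → f w * weight x w))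
          ≈⟨ Σ-*ʳ (List.allFin N) _ x ⟨
        Σ (List.allFin N) x * Σ (words L) (λ w → f w * weight x w)
          ≈⟨ *-congʳ (Σ-tabulate {n = N} id x) ⟩
        s * Σ (words L) (λ w → f w * weight x w) ∎
        where open CommutativeSemigroupProperties (CommutativeRing.*-commutativeSemigroup commutativeRing)

      words-split : ∀ L (f : Word → Carrier) → Σ (words (suc L)) f ≈
        Σ (List.allFin N) (λ i → Σ (words L) (λ w → f ((0ℙ , i) ∷ w))) +
        Σ (List.allFin N) (λ i → Σ (words L) (λ w → f ((1ℙ , i) ∷ w)))
      words-split L f = trans (Σ-cartesianProductWith _∷_ letters (words L) f)
        (trans (Σ-cartesianProductWith _,_ (0ℙ ∷ 1ℙ ∷ []) (List.allFin N) _)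
          (+-congˡ (+-identityʳ _)))

      -- Removing the first letter is Pascal's rule: an even one leaves all odd letters to the rest,
      -- an odd one leaves one fewer, and in both cases the weights of the first letter add up to
      -- `s`.
      binomial : ∀ L m → countWords L m ≈ fromℕ (L C m) * s ^ L
      binomial zero    zero    = trans (+-identityʳ _) (*-cong (sym (+-identityʳ 1#)) refl)
      binomial zero    (suc m) = trans (+-identityʳ _) (*-congˡ refl)
      binomial (suc L) zero    = begin
        countWords (suc L) 0
          ≈⟨ words-split L _ ⟩
        Σ (List.allFin N) (λ i → Σ (words L) (λ w → 𝟙 (count 1ℙ w ℕₚ.≟ 0) * (x i * weight x w))) +
        Σ (List.allFin N) (λ i → Σ (words L) (λ w → 0# * (x i * weight x w)))
          ≈⟨ +-cong (letter-sum L _) (Σ-zero (List.allFin N) λ _ → Σ-zero (words L) λ _ → zeroˡ _) ⟩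
        s * countWords L 0 + 0#
          ≈⟨ trans (+-identityʳ _) (*-congˡ (binomial L 0)) ⟩
        s * (fromℕ 1 * s ^ L)
          ≈⟨ x∙yz≈y∙xz _ _ _ ⟩
        fromℕ 1 * s ^ suc L ∎
        where open CommutativeSemigroupProperties (CommutativeRing.*-commutativeSemigroup commutativeRing)
      binomial (suc L) (suc m) = begin
        countWords (suc L) (suc m)
          ≈⟨ words-split L _ ⟩
        Σ (List.allFin N) (λ i → Σ (words L) (λ w → 𝟙 (count 1ℙ w ℕₚ.≟ suc m) * (x i * weight x w))) +
        Σ (List.allFin N) (λ i → Σ (words L) (λ w → 𝟙 (suc (count 1ℙ w) ℕₚ.≟ suc m) * (x i * weight x w)))
          ≈⟨ +-cong (letter-sum L _) (letter-sum L _) ⟩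
        s * countWords L (suc m) + s * Σ (words L) (λ w → 𝟙 (suc (count 1ℙ w) ℕₚ.≟ suc m) * weight x w)
          ≈⟨ +-congˡ (*-congˡ (Σ-cong (words L) (λ {w} _ → *-congʳ
               (𝟙-⇔ (suc (count 1ℙ w) ℕₚ.≟ suc m) (count 1ℙ w ℕₚ.≟ m) ℕₚ.suc-injective (≡.cong suc))))) ⟩
        s * countWords L (suc m) + s * countWords L m
          ≈⟨ +-cong (*-congˡ (binomial L (suc m))) (*-congˡ (binomial L m)) ⟩
        s * (fromℕ (L C suc m) * s ^ L) + s * (fromℕ (L C m) * s ^ L)
          ≈⟨ trans (+-comm _ _) (+-cong (x∙yz≈y∙xz _ _ _) (x∙yz≈y∙xz _ _ _)) ⟩
        fromℕ (L C m) * s ^ suc L + fromℕ (L C suc m) * s ^ suc L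
          ≈⟨ distribʳ _ _ _ ⟨
        (fromℕ (L C m) + fromℕ (L C suc m)) * s ^ suc L
          ≈⟨ *-congʳ (trans (sym (×-homo-+ 1# (L C m) (L C suc m)))
               (reflexive (≡.cong fromℕ (C.nCk+nC[k+1]≡[n+1]C[k+1] L m)))) ⟩
        fromℕ (suc L C suc m) * s ^ suc L ∎
        where open CommutativeSemigroupProperties (CommutativeRing.*-commutativeSemigroup commutativeRing)

    Σ-wordsOf : ∀ n m → Σ (wordsOf n m) (weight x) ≈ fromℕ ((n ℕ.+ m) C m) * s ^ (n ℕ.+ m)
    Σ-wordsOf n m = trans (Σ-filter (bidegree? n m) (words (n ℕ.+ m)) (weight x))
      (trans (Σ-cong (words (n ℕ.+ m)) λ {w} w∈ → *-congʳ
        (𝟙-⇔ (bidegree? n m w) (count 1ℙ w ℕₚ.≟ m) proj₂ λ w₁ → ℕₚ.+-cancelʳ-≡ m _ _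
          (≡.trans (≡.cong (λ k → count 0ℙ w ℕ.+ k) (≡.sym w₁))
            (≡.trans (count₀+count₁ w) (∈-words⁻ (n ℕ.+ m) w∈))) , w₁))
        (binomial (n ℕ.+ m) m))

  -- The origin of the power sums: the weight of a d-th power is a weight in the variables
  -- `x i ^ d`, whose sum is `powerSum d x`.
  weight-power : ∀ x d u → weight x (power d u) ≈ weight (λ i → x i ^ d) u
  weight-power x d []            = weight-[] d
    where
    weight-[] : ∀ d → weight x (power d []) ≈ 1#
    weight-[] zero    = refl
    weight-[] (suc d) = weight-[] d
  weight-power x d ((p , i) ∷ u) = trans (weight-^ d (a ∷ u)) (trans (^-distrib-* (x i) (weight x u) d)
    (*-congˡ (trans (sym (weight-^ d u)) (weight-power x d u))))
    where
    a = (p , i)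
    weight-^ : ∀ d u → weight x (power d u) ≈ weight x u ^ d
    weight-^ zero    u = refl
    weight-^ (suc d) u = trans (weight-++ x u (power d u)) (*-congˡ (weight-^ d u))

  count-rotate : ∀ p r w → count p (rotate r w) ≡ count p w
  count-rotate p zero    w       = ≡.refl
  count-rotate p (suc r) []      = count-rotate p r []
  count-rotate p (suc r) (a ∷ w) = ≡.trans (count-rotate p r (w ∷ʳ a))
    (≡.trans (count-++ p w (a ∷ [])) (≡.trans (ℕₚ.+-comm (count p w) _) (≡.sym (count-++ p (a ∷ []) w))))

  count-power : ∀ p d u → count p (power d u) ≡ d ℕ.* count p u
  count-power p zero    u = ≡.refl
  count-power p (suc d) u = ≡.trans (count-++ p u (power d u))
    (≡.cong (λ k → count p u ℕ.+ k) (count-power p d u))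

  weight-rotate : ∀ x r w → weight x (rotate r w) ≈ weight x w
  weight-rotate x zero    w            = refl
  weight-rotate x (suc r) []           = weight-rotate x r []
  weight-rotate x (suc r) (a@(_ , i) ∷ w) = trans (weight-rotate x r (w ∷ʳ a))
    (trans (weight-++ x w (a ∷ [])) (trans (*-congˡ (*-identityʳ (x i))) (*-comm _ _)))

  Σ-rotate : ∀ n m r f → Σ (wordsOf n m) f ≈ Σ (wordsOf n m) (f ∘ rotate r)
  Σ-rotate n m zero    f = refl
  Σ-rotate n m (suc r) f = trans (Σ-rotate n m r f)
    (Σ-reindex (wordsOf-! n m) (wordsOf-! n m) rotate₁ (λ {v} {w} → rotate₁-injective v w)
      into (onto _) (f ∘ rotate r))
    where
    into : ∀ {w} → w ∈ wordsOf n m → rotate₁ w ∈ wordsOf n m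
    into {w} w∈ = let w₀ , w₁ = ∈-wordsOf⁻ {n} {m} w∈ in ∈-wordsOf⁺ {n} {m}
      (≡.trans (count-rotate 0ℙ 1 w) w₀ , ≡.trans (count-rotate 1ℙ 1 w) w₁)
    onto : ∀ w → w ∈ wordsOf n m → ∃[ v ] v ∈ wordsOf n m × rotate₁ v ≡ w
    onto w w∈ with List.initLast w
    ... | []           = [] , w∈ , ≡.refl
    ... | v List.∷ʳ′ a = a ∷ v , ∈-wordsOf⁺ {n} {m}
      (let w₀ , w₁ = ∈-wordsOf⁻ {n} {m} w∈ in
        ≡.trans (≡.sym (count-rotate 0ℙ 1 (a ∷ v))) w₀ , ≡.trans (≡.sym (count-rotate 1ℙ 1 (a ∷ v))) w₁) , ≡.refl

  Σ-Lyndon-rotations : ∀ {w} → w ≢ [] → (∀ {r} → 0 ℕ.< r → r ℕ.< length w → rotate r w ≢ w) →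
    Σ (upTo (length w)) (λ r → 𝟙 (lyndon? (rotate r w))) ≈ 1#
  Σ-Lyndon-rotations {w} w≢[] aperiodic with r , r<w , r-lyn ← Lyndon-rotation-exists w≢[] aperiodic =
    trans (Σ-single r (Unique.upTo⁺ (length w)) (∈ₚ.∈-upTo⁺ r<w)
      (λ {s} s∈ s≢r → 𝟙-no (lyndon? (rotate s w)) λ s-lyn → s≢r
        (Lyndon-rotation-unique (∈ₚ.∈-upTo⁻ s∈) r<w s-lyn r-lyn)))
      (𝟙-yes (lyndon? (rotate r w)) r-lyn)

  module _ {w} (w≢[] : w ≢ []) (mp : MinimalPeriod w) {e} (we : length w ≡ e ℕ.* MinimalPeriod.period mp) where

    open MinimalPeriod mp

    private
      u = List.take period w
      w≡ : w ≡ power e u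
      w≡ = period⇒power e period w we rotates

      e≢0 : NonZero e
      e≢0 = helper e ≡.refl
        where
        helper : ∀ k → k ≡ e → NonZero e
        helper zero    ≡.refl = contradiction w≡ w≢[]
        helper (suc _) ≡.refl = _

    Σ-Lyndon : Σ (upTo (length w)) (λ r → 𝟙 (lyndon? (rotate r w))) ≈ 𝟙 (e ℕₚ.≟ 1)
    Σ-Lyndon = cases (e ℕₚ.≟ 1)
      where
      cases : (d : Dec (e ≡ 1)) → Σ (upTo (length w)) (λ r → 𝟙 (lyndon? (rotate r w))) ≈ 𝟙 d
      cases (yes e≡1) = Σ-Lyndon-rotations w≢[] (period≡length⇒primitive mp
        (≡.sym (≡.trans we (≡.trans (≡.cong (ℕ._* period) e≡1) (ℕₚ.*-identityˡ period)))))
      cases (no e≢1)  = Σ-zero (upTo (length w)) λ {r} _ → 𝟙-no (lyndon? (rotate r w)) λ r-lyn →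
        e≢1 (ℕₚ.*-cancelʳ-≡ e 1 period (≡.trans (≡.sym we)
          (≡.trans (≡.sym (Lyndon⇒period≡length mp {r} r-lyn)) (≡.sym (ℕₚ.*-identityˡ period)))))

    -- A rotation of `u ++ u` is the square of a rotation of `u`. The range of `r` goes twice
    -- through the rotations of `u`, and each round meets one Lyndon word, whence the factor 2.
    -- Conversely, if a rotation is the square of a Lyndon word, the period is half the length, so
    -- `e` is 2.
    Σ-OddSquare : Σ (upTo (length w)) (λ r → 𝟙 (oddSquare? (rotate r w))) ≈
                  𝟙 (e ℕₚ.≟ 2) * (𝟙 (parityOf u Parityₚ.≟ 1ℙ) * (1# + 1#))
    Σ-OddSquare = cases (e ℕₚ.≟ 2)
      where
      cases : (d : Dec (e ≡ 2)) → Σ (upTo (length w)) (λ r → 𝟙 (oddSquare? (rotate r w))) ≈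
              𝟙 d * (𝟙 (parityOf u Parityₚ.≟ 1ℙ) * (1# + 1#))
      cases (no e≢2) = trans (Σ-zero (upTo (length w)) λ {r} _ → 𝟙-no (oddSquare? (rotate r w))
        λ (v , r≡vv , v-lyn , _) → e≢2 (ℕₚ.*-cancelʳ-≡ e 2 period (≡.trans (≡.sym we)
          (≡.trans (≡.sym (rotate-length r w)) (≡.trans (≡.cong length r≡vv) (≡.trans (Listₚ.length-++ v)
            (≡.trans (≡.cong (λ k → k ℕ.+ k) (≡.sym (Lyndon²⇒period≡length mp {r} r≡vv v-lyn)))
              (≡.cong (λ k → period ℕ.+ k) (≡.sym (ℕₚ.+-identityʳ period)))))))))
        ) (sym (zeroˡ _))
      cases (yes e≡2) = begin
        Σ (upTo (length w)) (λ r → 𝟙 (oddSquare? (rotate r w)))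
          ≈⟨ Σ-cong (upTo (length w)) (λ {r} _ → square-indicator r) ⟩
        Σ (upTo (length w)) (λ r → odd * lyn r)
          ≈⟨ Σ-*ˡ (upTo (length w)) odd lyn ⟨
        odd * Σ (upTo (length w)) lyn
          ≡⟨ ≡.cong (λ L → odd * Σ (upTo L) lyn) (≡.trans (≡.cong length w≡uu) (Listₚ.length-++ u)) ⟩
        odd * Σ (upTo (h ℕ.+ h)) lyn
          ≈⟨ *-congˡ (Σ-upTo-+ h h lyn) ⟩
        odd * (Σ (upTo h) lyn + Σ (upTo h) (λ r → lyn (h ℕ.+ r)))
          ≈⟨ *-congˡ (+-congˡ (Σ-cong (upTo h) (λ {r} _ → reflexive (≡.cong (λ v → 𝟙 (lyndon? v))
               (≡.trans (rotate-+ h r u) (≡.cong (rotate r) (rotate-full u))))))) ⟩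
        odd * (Σ (upTo h) lyn + Σ (upTo h) lyn)
          ≈⟨ *-congˡ (+-cong once once) ⟩
        odd * (1# + 1#)
          ≈⟨ *-identityˡ _ ⟨
        1# * (odd * (1# + 1#)) ∎
        where
        h = length u
        odd = 𝟙 (parityOf u Parityₚ.≟ 1ℙ)
        lyn : ℕ → Carrier
        lyn r = 𝟙 (lyndon? (rotate r u))
        w≡uu : w ≡ u ++ u
        w≡uu = ≡.trans w≡ (≡.trans (≡.cong (λ k → power k u) e≡2) (≡.cong (u ++_) (Listₚ.++-identityʳ u)))
        p≡h : period ≡ h
        p≡h = ≡.sym (≡.trans (Listₚ.length-take period w) (ℕₚ.m≤n⇒m⊓n≡m
          (≡.subst (period ℕ.≤_) (≡.sym we) (ℕₚ.m≤n*m period e {{e≢0}}))))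
        once : Σ (upTo h) lyn ≈ 1#
        once = Σ-Lyndon-rotations {u} (λ u≡[] → w≢[] (≡.trans w≡uu (≡.cong₂ _++_ u≡[] u≡[])))
          (period-half⇒primitive mp {u} w≡uu p≡h)
        square-indicator : ∀ r → 𝟙 (oddSquare? (rotate r w)) ≈ odd * lyn r
        square-indicator r = trans
          (𝟙-⇔ (oddSquare? (rotate r w)) ((parityOf u Parityₚ.≟ 1ℙ) ×-dec lyndon? (rotate r u))
            (λ (v , r≡vv , v-lyn , v-odd) → let v≡ = square-injective (rotate r u) v (≡.trans (≡.sym r≡) r≡vv) in
              ≡.trans (≡.sym parity≡) (≡.trans (≡.cong parityOf v≡) v-odd) , ≡.subst Lyndon (≡.sym v≡) v-lyn)
            (λ (u-odd , r-lyn) → rotate r u , r≡ , r-lyn , ≡.trans parity≡ u-odd))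
          (𝟙-× (parityOf u Parityₚ.≟ 1ℙ) (lyndon? (rotate r u)))
          where
          r≡ : rotate r w ≡ rotate r u ++ rotate r u
          r≡ = ≡.trans (≡.cong (rotate r) w≡uu) (rotate-square r u)
          parity≡ : parityOf (rotate r u) ≡ parityOf u
          parity≡ = ≡.cong ℕ.parity (count-rotate 1ℙ r u)

    -- Lyndon words are not squares, so the two counts add up, and their sum is the right-hand side
    -- of `Σεμ` at the number of odd letters of the root `u`; `e` times this number belongs to `w`.
    Σ-SuperLyndon : Σ (upTo (length w)) (λ r → 𝟙 (superLyndon? (rotate r w))) ≈
                    Σ (divisors e) (λ d → divisorSign (count 1ℙ w) d * μ# d)
    Σ-SuperLyndon = begin
      Σ (upTo (length w)) (λ r → 𝟙 (superLyndon? (rotate r w)))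
        ≈⟨ Σ-cong (upTo (length w)) (λ {r} _ → 𝟙-⊎ (lyndon? (rotate r w)) (oddSquare? (rotate r w)) disjoint) ⟩
      Σ (upTo (length w)) (λ r → 𝟙 (lyndon? (rotate r w)) + 𝟙 (oddSquare? (rotate r w)))
        ≈⟨ Σ-+ (upTo (length w)) _ _ ⟩
      _ ≈⟨ +-cong Σ-Lyndon Σ-OddSquare ⟩
      _ ≈⟨ Σεμ (count 1ℙ u) e {{e≢0}} ⟨
      Σ (divisors e) (λ d → divisorSign (e ℕ.* count 1ℙ u) d * μ# d)
        ≡⟨ ≡.cong (λ m → Σ (divisors e) (λ d → divisorSign m d * μ# d))
             (≡.trans (≡.cong (count 1ℙ) w≡) (count-power 1ℙ e u)) ⟨
      Σ (divisors e) (λ d → divisorSign (count 1ℙ w) d * μ# d) ∎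
      where
      disjoint : ∀ {v} → Lyndon v → ¬ OddSquare v
      disjoint v-lyn (_ , ≡.refl , lyndon {a} {u} _ , _) = ¬square-Lyndon {a ∷ u} (λ ()) v-lyn

    exponent-∣ : ∀ p → e ∣ count p w
    exponent-∣ p = divides (count p u) (≡.trans (≡.cong (count p) w≡)
      (≡.trans (count-power p e u) (ℕₚ.*-comm e _)))

    -- That w is fixed by the rotation by q means that w is a d-th power.
    rotate-fixed⇔ : ∀ {q d} → length w ≡ q ℕ.* d →
                    (rotate q w ≡ w → d ∣ e) × (d ∣ e → rotate q w ≡ w)
    rotate-fixed⇔ {q} {d} w≡qd = to , from
      where
      to : rotate q w ≡ w → d ∣ e
      to eq with divides j ≡.refl ← minimal {q} eq = divides j (ℕₚ.*-cancelʳ-≡ e (j ℕ.* d) period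
        (≡.trans (≡.sym we) (≡.trans w≡qd (≡.trans (ℕₚ.*-assoc j period d)
          (≡.trans (≡.cong (λ k → j ℕ.* k) (ℕₚ.*-comm period d)) (≡.sym (ℕₚ.*-assoc j d period)))))))
      from : d ∣ e → rotate q w ≡ w
      from (divides j e≡jd) = ≡.subst (λ k → rotate k w ≡ w) (≡.sym q≡jp) (rotate-* j period w rotates)
        where
        d≢0 : NonZero d
        d≢0 = helper d ≡.refl
          where
          helper : ∀ k → k ≡ d → NonZero d
          helper zero    ≡.refl = contradiction (≡.trans e≡jd (ℕₚ.*-zeroʳ j)) (ℕ.≢-nonZero⁻¹ e {{e≢0}})
          helper (suc _) ≡.refl = _
        q≡jp : q ≡ j ℕ.* period
        q≡jp = ℕₚ.*-cancelʳ-≡ q (j ℕ.* period) d {{d≢0}} (≡.trans (≡.sym w≡qd) (≡.trans we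
          (≡.trans (≡.cong (ℕ._* period) e≡jd) (≡.trans (ℕₚ.*-assoc j d period)
            (≡.trans (≡.cong (λ k → j ℕ.* k) (ℕₚ.*-comm d period)) (≡.sym (ℕₚ.*-assoc j period d)))))))

-- Double counting and the character formula.

module CharacterFormula {c ℓ₁ ℓ₂} (F : HeytingField c ℓ₁ ℓ₂) (char0 : Field.CharacteristicZero F)
  (n m : ℕ) .{{_ : NonZero (n ℕ.+ m)}} (N : ℕ) (x : Vector (HeytingField.Carrier F) N) where

  open Field F hiding (zero)
  open Möbius using (divisors; divisors-!; ∈-divisors⁺; ∈-divisors⁻)
  open MöbiusSums F
  open FreeLieSuperalgebra F N
  open LieComponent F N
  open LieComponentBasis F N n m
  open Counting F N
  open LyndonWords (LetterOrder.≺-isStrictTotalOrder {N})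
  open Rotation {Letter}
  open SetoidReasoning setoid

  private
    L = n ℕ.+ m
    G = gcd n m
    W = wordsOf n m

    -- Division, with the junk value 0 at the divisor 0.
    quot : ℕ → ℕ → ℕ
    quot a zero      = 0
    quot a d@(suc _) = a / d

    quot-* : ∀ {a d} → d ∣ a → quot a d ℕ.* d ≡ a
    quot-* {d = zero}  (divides k ≡.refl) = ≡.sym (ℕₚ.*-zeroʳ k)
    quot-* {d = suc _} d∣a                = DivMod.m/n*n≡m d∣a

    instance
      G≢0 : NonZero G
      G≢0 = ℕ.≢-nonZero λ G≡0 → ℕ.≢-nonZero⁻¹ L (≡.cong₂ ℕ._+_ (gcd[m,n]≡0⇒m≡0 {n} {m} G≡0) (gcd[m,n]≡0⇒n≡0 n {m} G≡0))

    module Divisor {d} (d∈ : d ∈ divisors G) where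

      d∣n : d ∣ n
      d∣n = ∣.∣-trans (∈-divisors⁻ {n = G} d∈) (gcd[m,n]∣m n m)

      d∣m : d ∣ m
      d∣m = ∣.∣-trans (∈-divisors⁻ {n = G} d∈) (gcd[m,n]∣n n m)

      d∣L : d ∣ L
      d∣L = ∣.∣m∣n⇒∣m+n d∣n d∣m

      instance
        d≢0 : NonZero d
        d≢0 = ℕ.≢-nonZero λ { ≡.refl → ℕ.≢-nonZero⁻¹ G (∣.0∣⇒≡0 (∈-divisors⁻ {n = G} d∈)) }

      quot-+ : quot n d ℕ.+ quot m d ≡ quot L d
      quot-+ = ℕₚ.*-cancelʳ-≡ _ _ d (≡.trans (ℕₚ.*-distribʳ-+ d (quot n d) (quot m d))
        (≡.trans (≡.cong₂ ℕ._+_ (quot-* d∣n) (quot-* d∣m)) (≡.sym (quot-* d∣L))))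

    power-injective : ∀ d .{{_ : NonZero d}} {u v} → power d u ≡ power d v → u ≡ v
    power-injective d@(suc _) {u} {v} eq = proj₁ (++-injective u v
      (ℕₚ.*-cancelˡ-≡ (length u) (length v) d
        (≡.trans (≡.sym (power-length d u)) (≡.trans (≡.cong length eq) (power-length d v)))) eq)

    coefficient : ℕ → Carrier
    coefficient d = divisorSign m d * μ# d

    fixed? : ∀ d → Decidable (λ w → rotate (quot L d) w ≡ w)
    fixed? d w = rotate (quot L d) w ≟ w

    -- The range of the sum in `Σ-SuperLyndon` depends on the exponent of `w`. This exponent divides
    -- `n` and `m`, so the sum can be extended to the divisors of the gcd with an indicator; the
    -- range is then common to all words, and sums over words and divisors can be exchanged.
    rotation-count : ∀ {w} → w ∈ W → Σ (upTo L) (λ r → 𝟙 (superLyndon? (rotate r w))) ≈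
                     Σ (divisors G) (λ d → 𝟙 (fixed? d w) * coefficient d)
    rotation-count {w} w∈ = go (MinimalPeriod.minimal mp (rotate-full w))
      where
      w-length : length w ≡ L
      w-length = ∈-wordsOf-length {n} {m} w∈
      w-degree : Bidegree n m w
      w-degree = ∈-wordsOf⁻ {n} {m} w∈
      w≢[] : w ≢ []
      w≢[] w≡[] = ℕ.≢-nonZero⁻¹ L (≡.trans (≡.sym w-length) (≡.cong length w≡[]))
      mp : MinimalPeriod w
      mp = minimalPeriod _≟_ w w≢[]
      go : MinimalPeriod.period mp ∣ length w → Σ (upTo L) (λ r → 𝟙 (superLyndon? (rotate r w))) ≈
           Σ (divisors G) (λ d → 𝟙 (fixed? d w) * coefficient d)
      go (divides e we) = begin
        Σ (upTo L) (λ r → 𝟙 (superLyndon? (rotate r w)))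
          ≡⟨ ≡.cong (λ L → Σ (upTo L) (λ r → 𝟙 (superLyndon? (rotate r w)))) w-length ⟨
        Σ (upTo (length w)) (λ r → 𝟙 (superLyndon? (rotate r w)))
          ≈⟨ Σ-SuperLyndon w≢[] mp {e} we ⟩
        Σ (divisors e) (λ d → divisorSign (count 1ℙ w) d * μ# d)
          ≡⟨ ≡.cong (λ m → Σ (divisors e) (λ d → divisorSign m d * μ# d)) (proj₂ w-degree) ⟩
        Σ (divisors e) coefficient
          ≈⟨ Σ-sameMembers (divisors-! e) (Unique.filter⁺ (_∣? e) (divisors-! G)) into onto coefficient ⟩
        Σ (filter (_∣? e) (divisors G)) coefficient
          ≈⟨ Σ-filter (_∣? e) (divisors G) coefficient ⟩
        Σ (divisors G) (λ d → 𝟙 (d ∣? e) * coefficient d)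
          ≈⟨ Σ-cong (divisors G) (λ {d} d∈ → *-congʳ (𝟙-⇔ (d ∣? e) (fixed? d w)
               (proj₂ (fixed⇔ d∈)) (proj₁ (fixed⇔ d∈)))) ⟩
        Σ (divisors G) (λ d → 𝟙 (fixed? d w) * coefficient d) ∎
        where
        e∣G : e ∣ G
        e∣G = gcd-greatest (≡.subst (e ∣_) (proj₁ w-degree) (exponent-∣ w≢[] mp we 0ℙ))
                           (≡.subst (e ∣_) (proj₂ w-degree) (exponent-∣ w≢[] mp we 1ℙ))
        e≢0 : NonZero e
        e≢0 = ℕ.≢-nonZero λ { ≡.refl → ℕ.≢-nonZero⁻¹ G (∣.0∣⇒≡0 e∣G) }
        into : ∀ {d} → d ∈ filter (_∣? e) (divisors G) → d ∈ divisors e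
        into d∈ = ∈-divisors⁺ {{e≢0}} (proj₂ (∈ₚ.∈-filter⁻ (_∣? e) {xs = divisors G} d∈))
        onto : ∀ {d} → d ∈ divisors e → d ∈ filter (_∣? e) (divisors G)
        onto d∈ = let d∣e = ∈-divisors⁻ {n = e} d∈ in
          ∈ₚ.∈-filter⁺ (_∣? e) (∈-divisors⁺ (∣.∣-trans d∣e e∣G)) d∣e
        fixed⇔ : ∀ {d} → d ∈ divisors G →
                 (rotate (quot L d) w ≡ w → d ∣ e) × (d ∣ e → rotate (quot L d) w ≡ w)
        fixed⇔ {d} d∈ = rotate-fixed⇔ w≢[] mp we {quot L d} (≡.trans w-length (≡.sym (quot-* (Divisor.d∣L d∈))))

    -- `power d` is a bijection from the words of bidegree (n/d , m/d) onto the fixed words of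
    -- bidegree (n , m); the inverse takes the prefix of length (n + m)/d.
    fixed-sum : ∀ {d} → d ∈ divisors G → Σ W (λ w → 𝟙 (fixed? d w) * weight x w) ≈
      fromℕ (quot L d C quot m d) * powerSum d x ^ quot L d
    fixed-sum {d} d∈ = begin
      Σ W (λ w → 𝟙 (fixed? d w) * weight x w)
        ≈⟨ Σ-filter (fixed? d) W (weight x) ⟨
      Σ (filter (fixed? d) W) (weight x)
        ≈⟨ Σ-reindex (Unique.filter⁺ (fixed? d) (wordsOf-! n m)) (wordsOf-! (quot n d) (quot m d))
             (power d) (power-injective d) into onto (weight x) ⟩
      Σ (wordsOf (quot n d) (quot m d)) (weight x ∘ power d)
        ≈⟨ Σ-cong (wordsOf (quot n d) (quot m d)) (λ {u} _ → weight-power x d u) ⟩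
      Σ (wordsOf (quot n d) (quot m d)) (weight (λ i → x i ^ d))
        ≈⟨ Σ-wordsOf (λ i → x i ^ d) (quot n d) (quot m d) ⟩
      fromℕ ((quot n d ℕ.+ quot m d) C quot m d) * powerSum d x ^ (quot n d ℕ.+ quot m d)
        ≡⟨ ≡.cong (λ k → fromℕ (k C quot m d) * powerSum d x ^ k) quot-+ ⟩
      fromℕ (quot L d C quot m d) * powerSum d x ^ quot L d ∎
      where
      open Divisor d∈
      into : ∀ {u} → u ∈ wordsOf (quot n d) (quot m d) → power d u ∈ filter (fixed? d) W
      into {u} u∈ = let u₀ , u₁ = ∈-wordsOf⁻ {quot n d} {quot m d} u∈ in
        ∈ₚ.∈-filter⁺ (fixed? d) (∈-wordsOf⁺ {n} {m}
          (≡.trans (count-power 0ℙ d u) (≡.trans (≡.cong (d ℕ.*_) u₀) (≡.trans (ℕₚ.*-comm d _) (quot-* d∣n))) ,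
           ≡.trans (count-power 1ℙ d u) (≡.trans (≡.cong (d ℕ.*_) u₁) (≡.trans (ℕₚ.*-comm d _) (quot-* d∣m)))))
          (≡.subst (λ k → rotate k (power d u) ≡ power d u)
            (≡.trans (∈-wordsOf-length {quot n d} {quot m d} u∈) quot-+) (rotate-power d u))
      onto : ∀ {w} → w ∈ filter (fixed? d) W → ∃[ u ] u ∈ wordsOf (quot n d) (quot m d) × power d u ≡ w
      onto {w} w∈ = u , ∈-wordsOf⁺ {quot n d} {quot m d}
          (degree 0ℙ d∣n (proj₁ w-degree) , degree 1ℙ d∣m (proj₂ w-degree)) , ≡.sym w≡
        where
        u = List.take (quot L d) w
        w∈W : w ∈ W
        w∈W = proj₁ (∈ₚ.∈-filter⁻ (fixed? d) {xs = W} w∈)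
        w-degree : Bidegree n m w
        w-degree = ∈-wordsOf⁻ {n} {m} w∈W
        w≡ : w ≡ power d u
        w≡ = period⇒power d (quot L d) w
          (≡.trans (∈-wordsOf-length {n} {m} w∈W) (≡.trans (≡.sym (quot-* d∣L)) (ℕₚ.*-comm _ d)))
          (proj₂ (∈ₚ.∈-filter⁻ (fixed? d) {xs = W} w∈))
        degree : ∀ p {k} → d ∣ k → count p w ≡ k → count p u ≡ quot k d
        degree p {k} d∣k w≡k = ℕₚ.*-cancelʳ-≡ (count p u) (quot k d) d (≡.trans (ℕₚ.*-comm _ d)
          (≡.trans (≡.sym (count-power p d u)) (≡.trans (≡.cong (count p) (≡.sym w≡))
            (≡.trans w≡k (≡.sym (quot-* d∣k))))))

    term : ∀ d → .{{NonZero d}} → Carrier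
    term d = (- 1#) ^ (m ℕ.+ m / d) * fromℤ (μ d) * fromℕ ((L / d) C (m / d)) * powerSum d x ^ (L / d)

    term₀ : ℕ → Carrier
    term₀ d = coefficient d * (fromℕ (quot L d C quot m d) * powerSum d x ^ quot L d)

    sumOverDivisors≈Σ : sumOverDivisors G term ≈ Σ (divisors G) term₀
    sumOverDivisors≈Σ = begin
      sum {G} (λ k → if does (suc (toℕ k) ∣? G) then term (suc (toℕ k)) else 0#)
        ≈⟨ sum-cong-≋ {G} (λ k → trans (if≈𝟙* (suc (toℕ k) ∣? G) _) (*-congˡ (*-assoc _ _ _))) ⟩
      sum {G} (λ k → 𝟙 (suc (toℕ k) ∣? G) * term₀ (suc (toℕ k)))
        ≈⟨ Σ-tabulate {n = G} (suc ∘ toℕ) (λ d → 𝟙 (d ∣? G) * term₀ d) ⟨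
      Σ (List.tabulate {n = G} (suc ∘ toℕ)) (λ d → 𝟙 (d ∣? G) * term₀ d)
        ≈⟨ Σ-filter (_∣? G) (List.tabulate {n = G} (suc ∘ toℕ)) term₀ ⟨
      Σ (divisors G) term₀ ∎

  -- Double counting of the pairs of a word w and a rotation taking w to a
  -- super-Lyndon word.
  Σ-basisWords : fromℕ L * Σ basisWords (weight x) ≈ sumOverDivisors G term
  Σ-basisWords = begin
    fromℕ L * Σ basisWords (weight x)
      ≈⟨ *-congˡ (Σ-filter superLyndon? W (weight x)) ⟩
    fromℕ L * Σ W f
      ≡⟨ ≡.cong (λ k → fromℕ k * Σ W f) (Listₚ.length-upTo L) ⟨
    fromℕ (length (upTo L)) * Σ W f
      ≈⟨ Σ-const (upTo L) _ ⟨
    Σ (upTo L) (λ _ → Σ W f)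
      -- Every rotation permutes `W` and preserves weights, so each of the `L` equal sums can be
      -- rewritten along its own rotation.
      ≈⟨ Σ-cong (upTo L) (λ {r} _ → trans (Σ-rotate n m r f) (Σ-cong W (λ {w} _ → *-congˡ (weight-rotate x r w)))) ⟩
    Σ (upTo L) (λ r → Σ W (λ w → 𝟙 (superLyndon? (rotate r w)) * weight x w))
      ≈⟨ Σ-swap (upTo L) W _ ⟩
    Σ W (λ w → Σ (upTo L) (λ r → 𝟙 (superLyndon? (rotate r w)) * weight x w))
      ≈⟨ Σ-cong W (λ {w} w∈ → trans (sym (Σ-*ʳ (upTo L) (weight x w) _)) (*-congʳ (rotation-count w∈))) ⟩
    Σ W (λ w → Σ (divisors G) (λ d → 𝟙 (fixed? d w) * coefficient d) * weight x w)
      ≈⟨ Σ-cong W (λ {w} _ → trans (Σ-*ʳ (divisors G) (weight x w) _) (Σ-cong (divisors G) λ {d} _ →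
           trans (*-congʳ (*-comm _ _)) (*-assoc _ _ _))) ⟩
    Σ W (λ w → Σ (divisors G) (λ d → coefficient d * (𝟙 (fixed? d w) * weight x w)))
      ≈⟨ Σ-swap W (divisors G) _ ⟩
    Σ (divisors G) (λ d → Σ W (λ w → coefficient d * (𝟙 (fixed? d w) * weight x w)))
      ≈⟨ Σ-cong (divisors G) (λ {d} d∈ → trans (sym (Σ-*ˡ W (coefficient d) _)) (*-congˡ (fixed-sum d∈))) ⟩
    Σ (divisors G) term₀
      ≈⟨ sumOverDivisors≈Σ ⟨
    sumOverDivisors G term ∎
    where
    f : Word → Carrier
    f w = 𝟙 (superLyndon? w) * weight x w

  characterValue : (x#0 : ∀ i → x i # 0#) → IsCharacterValue (FreeLieComponent n m) x x#0
    (fromℕ L ⁻¹[ char0 L ] * sumOverDivisors G term)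
  characterValue x#0 = character char0 x x#0 (begin
    Σ basisWords (weight x)
      ≈⟨ *-identityˡ _ ⟨
    1# * Σ basisWords (weight x)
      ≈⟨ *-congʳ (⁻¹-inverseˡ (fromℕ L) (char0 L)) ⟨
    fromℕ L ⁻¹[ char0 L ] * fromℕ L * Σ basisWords (weight x)
      ≈⟨ *-assoc _ _ _ ⟩
    fromℕ L ⁻¹[ char0 L ] * (fromℕ L * Σ basisWords (weight x))
      ≈⟨ *-congˡ Σ-basisWords ⟩
    fromℕ L ⁻¹[ char0 L ] * sumOverDivisors G term ∎)

theorem1p1 :
    ∀ {c ℓ₁ ℓ₂} (F : HeytingField c ℓ₁ ℓ₂) →
    let open Field F in
    (char0 : CharacteristicZero)
    (n m : ℕ) .{{_ : NonZero (n ℕ.+ m)}}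
    (N : ℕ) .{{_ : NonZero N}} →
    let open FreeLieSuperalgebra F N in
    (x : Fin N → Carrier) (x#0 : ∀ i → x i # 0#) →
    IsCharacterValue (FreeLieComponent n m) x x#0
      (fromℕ (n ℕ.+ m) ⁻¹[ char0 (n ℕ.+ m) ] *
        sumOverDivisors (gcd n m) (λ d →
          (- 1#) ^ (m ℕ.+ m / d) * fromℤ (μ d)
            * fromℕ (((n ℕ.+ m) / d) C (m / d))
            * powerSum d x ^ ((n ℕ.+ m) / d)))
theorem1p1 F char0 n m N x x#0 = CharacterFormula.characterValue F char0 n m N x x#0
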